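{- Let $\ell\ge 2$, let $S=\mathbb{R}[x_1,\dots,x_\ell]$, and let $m=2$, so that $\Lambda=\{(\lambda_1,\lambda_2)\in\mathbb{Z}^2\mid \ell-2\ge\lambda_1\ge\lambda_2\ge 0\}$. (1) The set $C_{\mathcal{A}}:=\{\eta^{\mathcal{A}}_i\mid i=1,\dots,\ell\}\cup\{\theta^{\mathcal{A}}_\lambda\mid\lambda\in\Lambda\}$ forms an $S$-basis for $D^{(2)}(\mathcal{A}_{\ell-1})$. Hence, as multisets, $$\exp D^{(2)}(\mathcal{A}_{\ell-1})=\{\underbrace{\ell-1,\dots,\ell-1}_{\ell}\}\cup\{|\lambda|\mid\lambda\in\Lambda\}.$$ (2) The set $C_{\mathcal{B}}:=\{\eta^{\mathcal{B}}_i\mid i=1,\dots,\ell\}\cup\{\theta^{\mathcal{B}}_\lambda\mid\lambda\in\Lambda\}$ forms an $S$-basis for $D^{(2)}(\mathcal{B}_{\ell})$. Hence, as multisets, $$\exp D^{(2)}(\mathcal{B}_{\ell})=\{\underbrace{2\ell-1,\dots,2\ell-1}_{\ell}\}\cup\{2|\lambda|+2\mid\lambda\in\Lambda\}.$$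
   Context: $S=\mathbb{R}[x_1,\dots,x_\ell]$, $\partial_i=\partial/\partial x_i$, and $D^{(m)}(S)=\bigoplus_{|\alpha|=m}S\,\partial^{\alpha}$ (sum over multi-indices $\alpha\in\mathbb{N}^\ell$ with $|\alpha|=\alpha_1+\cdots+\alpha_\ell=m$, $\partial^\alpha=\partial_1^{\alpha_1}\cdots\partial_\ell^{\alpha_\ell}$). A nonzero $\theta=\sum f_\alpha\partial^\alpha\in D^{(m)}(S)$ is homogeneous of degree $i$ if each $f_\alpha$ is zero or homogeneous of degree $i$. For a central hyperplane arrangement $\mathscr{A}$ in $\mathbb{R}^\ell$ with defining polynomial $Q(\mathscr{A})$ (product of one linear form per hyperplane), $D^{(m)}(\mathscr{A})=\{\theta\in D^{(m)}(S)\mid\theta(Q(\mathscr{A})S)\subseteq Q(\mathscr{A})S\}$. When $D^{(m)}(\mathscr{A})$ is a free $S$-module, $\exp D^{(m)}(\mathscr{A})$ denotes the multiset of degrees of a homogeneous basis. The arrangements are given by $Q(\mathcal{A}_{\ell-1})=\prod_{1\le i<j\le\ell}(x_i-x_j)$ and $Q(\mathcal{B}_\ell)=x_1\cdots x_\ell\prod_{1\le i<j\le\ell}(x_i^2-x_j^2)$. For $\alpha$ with $|\alpha|=m$, $x_\alpha=(x_1,\dots,x_1,x_2,\dots,x_2,\dots,x_\ell,\dots,x_\ell)$ with $x_i$ repeated $\alpha_i$ times, and $\alpha!=\alpha_1!\cdots\alpha_\ell!$. For $\lambda\in\Lambda$ put $|\lambda|=\lambda_1+\lambda_2$ and (with $m=2$)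 $$s^{\mathcal{A}}_\lambda(t_1,\dots,t_m)=\frac{\det(t_i^{\lambda_j+m-j})_{1\le i,j\le m}}{\det(t_i^{m-j})_{1\le i,j\le m}},\qquad s^{\mathcal{B}}_\lambda(t_1,\dots,t_m)=\frac{\det(t_i^{2(\lambda_j+m-j)+1})_{1\le i,j\le m}}{\det(t_i^{2(m-j)})_{1\le i,j\le m}},$$ which are symmetric polynomials. Define $$\theta^{\mathcal{A}}_\lambda=\sum_{|\alpha|=m}s^{\mathcal{A}}_\lambda(x_\alpha)\frac{1}{\alpha!}\partial^\alpha,\qquad \theta^{\mathcal{B}}_\lambda=\sum_{|\alpha|=m}s^{\mathcal{B}}_\lambda(x_\alpha)\frac{1}{\alpha!}\partial^\alpha,$$ $$\eta^{\mathcal{A}}_k=\Big(\prod_{i\ne k}(x_k-x_i)\Big)\frac{1}{m!}\partial_k^m,\qquad \eta^{\mathcal{B}}_k=\Big(x_k\prod_{i\ne k}(x_k^2-x_i^2)\Big)\frac{1}{m!}\partial_k^m\qquad(k=1,\dots,\ell).$$ -}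

module Defs where

open import Algebra.Bundles using (CommutativeRing)
open import Algebra.Module.Bundles using (Module)
open import Algebra.Module.Structures.Biased using (IsModuleFromLeft)
open import Data.Bool.Base using (true; false; if_then_else_)
open import Data.Fin.Base using (Fin; zero; suc; toℕ)
import Data.Fin.Properties as Fin
open import Data.Integer.Base using (+_)
open import Data.List.Base as List using (List; []; _∷_; _++_; length)
import Data.List.Properties as List
open import Data.List.Relation.Binary.Permutation.Propositional using (_↭_)
open import Data.List.Relation.Binary.Pointwise.Base using (Pointwise)
open import Data.List.Relation.Unary.All using (All)
open import Data.Nat.Base as ℕ using (ℕ; zero; suc; _∸_; _!)
open import Data.Nat.GeneralisedArithmetic using (fold)
import Data.Nat.Properties as ℕ
open import Data.Product using (∃; _×_; _,_; proj₁; proj₂)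
open import Data.Rational.Base as ℚ using (ℚ)
import Data.Rational.Properties as ℚ
open import Data.Rational.Solver using (module +-*-Solver)
open import Data.Vec.Base as Vec using (Vec; []; _∷_)
import Data.Vec.Properties as Vec
open import Level using (0ℓ; _⊔_)
open import Relation.Binary.Structures using (IsEquivalence)
open import Relation.Binary.PropositionalEquality
  using (_≡_; _≢_; refl; sym; trans; cong; cong₂; subst)
open import Relation.Nullary using (¬_; Dec; does; yes; no; contradiction)
open import Relation.Nullary.Decidable using (¬?)

module Reals where
  open import Data.Rational.Base
    using (0ℚ; 1ℚ; ½; ∣_∣; 1/_; _+_; _*_; -_; _-_; _<_; _≤_; Positive; positive; nonNegative)
  open +-*-Solver using (solve; _:+_; _:*_; :-_; _:-_; _:=_; con)

  -- As ∃ is Σ, a real number carries a modulus of convergence.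
  IsCauchy : (ℕ → ℚ) → Set
  IsCauchy x = ∀ ε → 0ℚ < ε → ∃ λ N → ∀ m n → N ℕ.≤ m → N ℕ.≤ n → ∣ x m - x n ∣ < ε

  IsNull : (ℕ → ℚ) → Set
  IsNull x = ∀ ε → 0ℚ < ε → ∃ λ N → ∀ n → N ℕ.≤ n → ∣ x n ∣ < ε

  -- Without eta, equations in ℝ are not checked by comparing Cauchy proofs.
  record ℝ : Set where
    no-eta-equality
    field
      seq    : ℕ → ℚ
      cauchy : IsCauchy seq
  open ℝ public

  infix 4 _≈_
  record _≈_ (x y : ℝ) : Set where
    constructor mk≈
    field
      null : IsNull (λ n → seq x n - seq y n)

  half : ∀ {ε} → 0ℚ < ε → 0ℚ < ½ * ε
  half {ε} 0<ε = subst (_< ½ * ε) (ℚ.*-zeroʳ ½) (ℚ.*-monoʳ-<-pos ½ 0<ε)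

  halves : ∀ ε → ½ * ε + ½ * ε ≡ ε
  halves = solve 1 (λ e → con ½ :* e :+ con ½ :* e := e) refl

  rewr : ∀ {p q ε} → p ≡ q → ∣ p ∣ < ε → ∣ q ∣ < ε
  rewr refl h = h

  ∣+∣< : ∀ {p q} ε → ∣ p ∣ < ½ * ε → ∣ q ∣ < ½ * ε → ∣ p + q ∣ < ε
  ∣+∣< {p} {q} ε hp hq = ℚ.≤-<-trans (ℚ.∣p+q∣≤∣p∣+∣q∣ p q)
    (subst (∣ p ∣ + ∣ q ∣ <_) (halves ε) (ℚ.+-mono-< hp hq))

  ≤₁ : ∀ {a b c} → a ℕ.⊔ b ℕ.≤ c → a ℕ.≤ c
  ≤₁ {a} {b} = ℕ.≤-trans (ℕ.m≤m⊔n a b)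

  ≤₂ : ∀ {a b c} → a ℕ.⊔ b ℕ.≤ c → b ℕ.≤ c
  ≤₂ {a} {b} = ℕ.≤-trans (ℕ.m≤n⊔m a b)

  null-≗ : ∀ {x y} → (∀ n → x n ≡ y n) → IsNull x → IsNull y
  null-≗ e hx ε 0<ε = let N , h = hx ε 0<ε in N , λ n N≤n → rewr (e n) (h n N≤n)

  null-0 : ∀ {x} → (∀ n → x n ≡ 0ℚ) → IsNull x
  null-0 e ε 0<ε = 0 , λ n _ → rewr (sym (e n)) 0<ε

  null-+ : ∀ {x y} → IsNull x → IsNull y → IsNull (λ n → x n + y n)
  null-+ hx hy ε 0<ε =
    let M , h = hx (½ * ε) (half 0<ε)
        N , k = hy (½ * ε) (half 0<ε)
    in M ℕ.⊔ N , λ n l → ∣+∣< ε (h n (≤₁ {M} l)) (k n (≤₂ {M} l))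

  null-neg : ∀ {x} → IsNull x → IsNull (λ n → - x n)
  null-neg {x} hx ε 0<ε = let N , h = hx ε 0<ε in
    N , λ n l → subst (_< ε) (sym (ℚ.∣-p∣≡∣p∣ (x n))) (h n l)

  -- Cauchy sequences are eventually bounded.
  Bounded : (ℕ → ℚ) → Set
  Bounded x = ∃ λ B → Positive B × ∃ λ N → ∀ n → N ℕ.≤ n → ∣ x n ∣ ≤ B

  bounded : ∀ x → IsCauchy x → Bounded x
  bounded x hx =
    let N , h = hx 1ℚ (ℚ.positive⁻¹ 1ℚ)
        B≥0 = ℚ.0≤∣p∣ (x N)
    in 1ℚ + ∣ x N ∣
     , positive (ℚ.+-mono-<-≤ (ℚ.positive⁻¹ 1ℚ) B≥0)
     , N
     , λ n l → ℚ.≤-trans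
         (subst (λ z → ∣ z ∣ ≤ ∣ x n - x N ∣ + ∣ x N ∣) (lemma (x n) (x N))
                (ℚ.∣p+q∣≤∣p∣+∣q∣ (x n - x N) (x N)))
         (ℚ.+-monoˡ-≤ ∣ x N ∣ (ℚ.<⇒≤ (h n N l ℕ.≤-refl)))
    where
    lemma : ∀ a b → (a - b) + b ≡ a
    lemma = solve 2 (λ a b → (a :- b) :+ b := a) refl

  -- For B > 0 and ε > 0, a bound δ > 0 with B δ = ε.
  shrink : ∀ B → Positive B → ∀ ε → 0ℚ < ε → ∃ λ δ → 0ℚ < δ × B * δ ≡ ε
  shrink B B>0 ε 0<ε = δ , 0<δ , eq
    where
    instance
      _ = B>0
      _ = ℚ.pos⇒nonZero B
      _ = ℚ.1/pos⇒pos B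
    δ = 1/ B * ε
    0<δ : 0ℚ < δ
    0<δ = subst (_< δ) (ℚ.*-zeroʳ (1/ B)) (ℚ.*-monoʳ-<-pos (1/ B) 0<ε)
    eq : B * δ ≡ ε
    eq = trans (sym (ℚ.*-assoc B (1/ B) ε))
           (trans (cong (_* ε) (ℚ.*-inverseʳ B)) (ℚ.*-identityˡ ε))

  ∣*∣< : ∀ p q B → Positive B → ∀ δ {ε} → B * δ ≡ ε → ∣ p ∣ ≤ B → ∣ q ∣ < δ → ∣ p * q ∣ < ε
  ∣*∣< p q B B>0 δ refl hp hq = subst (_< B * δ) (sym (ℚ.∣p*q∣≡∣p∣*∣q∣ p q))
    (ℚ.≤-<-trans (ℚ.*-monoʳ-≤-nonNeg ∣ q ∣ {{nonNegative (ℚ.0≤∣p∣ q)}} hp)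
                 (ℚ.*-monoʳ-<-pos B {{B>0}} hq))

  null-*ˡ : ∀ x y → Bounded x → IsNull y → IsNull (λ n → x n * y n)
  null-*ˡ x y (B , B>0 , M , hx) hy ε 0<ε =
    let δ , 0<δ , eq = shrink B B>0 ε 0<ε
        N , k = hy δ 0<δ
    in M ℕ.⊔ N , λ n l → ∣*∣< (x n) (y n) B B>0 δ eq (hx n (≤₁ {M} l)) (k n (≤₂ {M} l))

  cauchy-+ : ∀ x y → IsCauchy x → IsCauchy y → IsCauchy (λ n → x n + y n)
  cauchy-+ x y hx hy ε 0<ε =
    let M , h = hx (½ * ε) (half 0<ε)
        N , k = hy (½ * ε) (half 0<ε)
    in M ℕ.⊔ N , λ m n l l′ →
         rewr (lemma (x m) (x n) (y m) (y n))
           (∣+∣< ε (h m n (≤₁ {M} l) (≤₁ {M} l′)) (k m n (≤₂ {M} l) (≤₂ {M} l′)))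
    where
    lemma : ∀ a b c d → (a - b) + (c - d) ≡ (a + c) - (b + d)
    lemma = solve 4 (λ a b c d → (a :- b) :+ (c :- d) := (a :+ c) :- (b :+ d)) refl

  cauchy-neg : ∀ x → IsCauchy x → IsCauchy (λ n → - x n)
  cauchy-neg x hx ε 0<ε = let N , h = hx ε 0<ε in
    N , λ m n l l′ → rewr (lemma (x n) (x m)) (h n m l′ l)
    where
    lemma : ∀ a b → a - b ≡ (- b) - (- a)
    lemma = solve 2 (λ a b → a :- b := (:- b) :- (:- a)) refl

  cauchy-* : ∀ x y → IsCauchy x → IsCauchy y → IsCauchy (λ n → x n * y n)
  cauchy-* x y hx hy ε 0<ε =
    let B , B>0 , M , bx = bounded x hx
        C , C>0 , N , by = bounded y hy
        δ , 0<δ , eq  = shrink B B>0 (½ * ε) (half 0<ε)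
        γ , 0<γ , eq′ = shrink C C>0 (½ * ε) (half 0<ε)
        P , h = hx γ 0<γ
        Q , k = hy δ 0<δ
        R = (M ℕ.⊔ N) ℕ.⊔ (P ℕ.⊔ Q)
    in R , λ m n l l′ →
      rewr (lemma (x m) (x n) (y m) (y n))
        (∣+∣< ε
          (∣*∣< (x m) (y m - y n) B B>0 δ eq (bx m (≤₁ {M} {N} (≤₁ {M ℕ.⊔ N} {P ℕ.⊔ Q} l)))
             (k m n (≤₂ {P} {Q} (≤₂ {M ℕ.⊔ N} {P ℕ.⊔ Q} l)) (≤₂ {P} {Q} (≤₂ {M ℕ.⊔ N} {P ℕ.⊔ Q} l′))))
          (∣*∣< (y n) (x m - x n) C C>0 γ eq′ (by n (≤₂ {M} {N} (≤₁ {M ℕ.⊔ N} {P ℕ.⊔ Q} l′)))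
             (h m n (≤₁ {P} {Q} (≤₂ {M ℕ.⊔ N} {P ℕ.⊔ Q} l)) (≤₁ {P} {Q} (≤₂ {M ℕ.⊔ N} {P ℕ.⊔ Q} l′)))))
    where
    lemma : ∀ a b c d → a * (c - d) + d * (a - b) ≡ a * c - b * d
    lemma = solve 4 (λ a b c d → a :* (c :- d) :+ d :* (a :- b) := a :* c :- b :* d) refl

  fromℚ : ℚ → ℝ
  fromℚ q .seq    _ = q
  fromℚ q .cauchy ε 0<ε = 0 , λ _ _ _ _ → rewr (sym (ℚ.+-inverseʳ q)) 0<ε

  _+ᴿ_ _*ᴿ_ : ℝ → ℝ → ℝ
  (x +ᴿ y) .seq n  = seq x n + seq y n
  (x +ᴿ y) .cauchy = cauchy-+ (seq x) (seq y) (cauchy x) (cauchy y)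
  (x *ᴿ y) .seq n  = seq x n * seq y n
  (x *ᴿ y) .cauchy = cauchy-* (seq x) (seq y) (cauchy x) (cauchy y)

  -ᴿ_ : ℝ → ℝ
  (-ᴿ x) .seq n  = - seq x n
  (-ᴿ x) .cauchy = cauchy-neg (seq x) (cauchy x)

  pointwise : ∀ x y → (∀ n → seq x n ≡ seq y n) → x ≈ y
  pointwise x y e = mk≈ (null-0 λ n →
    trans (cong (_- seq y n) (e n)) (ℚ.+-inverseʳ (seq y n)))

  ≈-sym : ∀ {x y} → x ≈ y → y ≈ x
  ≈-sym {x} {y} (mk≈ h) = mk≈ (null-≗ (λ n → lemma (seq x n) (seq y n)) (null-neg h))
    where
    lemma : ∀ a b → - (a - b) ≡ b - a
    lemma = solve 2 (λ a b → :- (a :- b) := b :- a) refl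

  ≈-trans : ∀ {x y z} → x ≈ y → y ≈ z → x ≈ z
  ≈-trans {x} {y} {z} (mk≈ h) (mk≈ k) =
    mk≈ (null-≗ (λ n → lemma (seq x n) (seq y n) (seq z n)) (null-+ h k))
    where
    lemma : ∀ a b c → (a - b) + (b - c) ≡ a - c
    lemma = solve 3 (λ a b c → (a :- b) :+ (b :- c) := a :- c) refl

  +-cong : ∀ {x y u v} → x ≈ y → u ≈ v → (x +ᴿ u) ≈ (y +ᴿ v)
  +-cong {x} {y} {u} {v} (mk≈ h) (mk≈ k) =
    mk≈ (null-≗ (λ n → lemma (seq x n) (seq y n) (seq u n) (seq v n)) (null-+ h k))
    where
    lemma : ∀ a b c d → (a - b) + (c - d) ≡ (a + c) - (b + d)
    lemma = solve 4 (λ a b c d → (a :- b) :+ (c :- d) := (a :+ c) :- (b :+ d)) refl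

  neg-cong : ∀ {x y} → x ≈ y → (-ᴿ x) ≈ (-ᴿ y)
  neg-cong {x} {y} (mk≈ h) = mk≈ (null-≗ (λ n → lemma (seq x n) (seq y n)) (null-neg h))
    where
    lemma : ∀ a b → - (a - b) ≡ (- a) - (- b)
    lemma = solve 2 (λ a b → :- (a :- b) := (:- a) :- (:- b)) refl

  *-cong : ∀ {x y u v} → x ≈ y → u ≈ v → (x *ᴿ u) ≈ (y *ᴿ v)
  *-cong {x} {y} {u} {v} (mk≈ h) (mk≈ k) =
    mk≈ (null-≗ (λ n → lemma (seq x n) (seq y n) (seq u n) (seq v n))
      (null-+ (null-*ˡ (seq x) _ (bounded (seq x) (cauchy x)) k)
              (null-*ˡ (seq v) _ (bounded (seq v) (cauchy v)) h)))
    where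
    lemma : ∀ a b c d → a * (c - d) + d * (a - b) ≡ a * c - b * d
    lemma = solve 4 (λ a b c d → a :* (c :- d) :+ d :* (a :- b) := a :* c :- b :* d) refl

  +-assoc : ∀ x y z → ((x +ᴿ y) +ᴿ z) ≈ (x +ᴿ (y +ᴿ z))
  +-assoc x y z = pointwise ((x +ᴿ y) +ᴿ z) (x +ᴿ (y +ᴿ z))
    λ n → ℚ.+-assoc (seq x n) (seq y n) (seq z n)

  +-comm : ∀ x y → (x +ᴿ y) ≈ (y +ᴿ x)
  +-comm x y = pointwise (x +ᴿ y) (y +ᴿ x) λ n → ℚ.+-comm (seq x n) (seq y n)

  +-identityˡ : ∀ x → (fromℚ 0ℚ +ᴿ x) ≈ x
  +-identityˡ x = pointwise (fromℚ 0ℚ +ᴿ x) x λ n → ℚ.+-identityˡ (seq x n)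

  -‿inverseˡ : ∀ x → ((-ᴿ x) +ᴿ x) ≈ fromℚ 0ℚ
  -‿inverseˡ x = pointwise ((-ᴿ x) +ᴿ x) (fromℚ 0ℚ) λ n → ℚ.+-inverseˡ (seq x n)

  *-assoc : ∀ x y z → ((x *ᴿ y) *ᴿ z) ≈ (x *ᴿ (y *ᴿ z))
  *-assoc x y z = pointwise ((x *ᴿ y) *ᴿ z) (x *ᴿ (y *ᴿ z))
    λ n → ℚ.*-assoc (seq x n) (seq y n) (seq z n)

  *-comm : ∀ x y → (x *ᴿ y) ≈ (y *ᴿ x)
  *-comm x y = pointwise (x *ᴿ y) (y *ᴿ x) λ n → ℚ.*-comm (seq x n) (seq y n)

  *-identityˡ : ∀ x → (fromℚ 1ℚ *ᴿ x) ≈ x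
  *-identityˡ x = pointwise (fromℚ 1ℚ *ᴿ x) x λ n → ℚ.*-identityˡ (seq x n)

  *-distribʳ-+ : ∀ x y z → ((y +ᴿ z) *ᴿ x) ≈ ((y *ᴿ x) +ᴿ (z *ᴿ x))
  *-distribʳ-+ x y z = pointwise ((y +ᴿ z) *ᴿ x) ((y *ᴿ x) +ᴿ (z *ᴿ x))
    λ n → ℚ.*-distribʳ-+ (seq x n) (seq y n) (seq z n)

  isEquivalence : IsEquivalence _≈_
  isEquivalence = record
    { refl  = λ {x} → pointwise x x λ _ → refl
    ; sym   = ≈-sym
    ; trans = ≈-trans
    }

  ℝ-commutativeRing : CommutativeRing 0ℓ 0ℓ
  ℝ-commutativeRing = record
    { Carrier = ℝ
    ; _≈_ = _≈_
    ; _+_ = _+ᴿ_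
    ; _*_ = _*ᴿ_
    ; -_ = -ᴿ_
    ; 0# = fromℚ 0ℚ
    ; 1# = fromℚ 1ℚ
    ; isCommutativeRing = record
      { isRing = record
        { +-isAbelianGroup = record
          { isGroup = record
            { isMonoid = record
              { isSemigroup = record { isMagma = record { isEquivalence = isEquivalence ; ∙-cong = +-cong } ; assoc = +-assoc }
              ; identity = +-identityˡ , λ x → ≈-trans (+-comm x (fromℚ 0ℚ)) (+-identityˡ x)
              }
            ; inverse = -‿inverseˡ , λ x → ≈-trans (+-comm x (-ᴿ x)) (-‿inverseˡ x)
            ; ⁻¹-cong = neg-cong
            }
          ; comm = +-comm
          }
        ; *-cong = *-cong
        ; *-assoc = *-assoc
        ; *-identity = *-identityˡ , λ x → ≈-trans (*-comm x (fromℚ 1ℚ)) (*-identityˡ x)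
        ; distrib = (λ x y z → ≈-trans (*-comm x (y +ᴿ z))
                      (≈-trans (*-distribʳ-+ x y z)
                        (+-cong (*-comm y x) (*-comm z x))))
                  , *-distribʳ-+
        }
      ; *-comm = *-comm
      }
    }

module Polynomials {r ℓr} (R : CommutativeRing r ℓr) (n : ℕ) where
  open CommutativeRing R
    renaming (refl to ≈-refl; sym to ≈-sym; trans to ≈-trans; reflexive to ≈-reflexive)
  open import Algebra.Definitions.RawMonoid +-rawMonoid using () renaming (_×_ to _·_)
  open import Algebra.Properties.Ring ring using (-‿distribˡ-*; -‿+-comm; -0#≈0#; x∙y⁻¹≈ε⇒x≈y)
  open import Algebra.Solver.Ring.NaturalCoefficients.Default commutativeSemiring
    using (solve; _:+_; _:*_; _:=_; con)
  open import Relation.Binary.Reasoning.Setoid setoid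

  Exponents : Set
  Exponents = Vec ℕ n

  infix 4 _≟ᵉ_
  _≟ᵉ_ : (α β : Exponents) → Dec (α ≡ β)
  _≟ᵉ_ = Vec.≡-dec ℕ._≟_

  infixl 6 _+ᵉ_
  _+ᵉ_ : Exponents → Exponents → Exponents
  _+ᵉ_ = Vec.zipWith ℕ._+_

  0ᵉ : Exponents
  0ᵉ = Vec.replicate n 0

  -- A polynomial is presented as a formal sum of terms (c , α), standing for
  -- c x^α.  Exponents may repeat; equality compares total coefficients.
  Poly : Set r
  Poly = List (Carrier × Exponents)

  coeff : Poly → Exponents → Carrier
  coeff []            β = 0#
  coeff ((c , α) ∷ p) β = (if does (α ≟ᵉ β) then c else 0#) + coeff p β

  infix 4 _≈ᴾ_
  record _≈ᴾ_ (p q : Poly) : Set ℓr where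
    constructor mk≈ᴾ
    field
      coeff-≈ : ∀ β → coeff p β ≈ coeff q β

  infixl 6 _+ᴾ_
  _+ᴾ_ : Poly → Poly → Poly
  _+ᴾ_ = _++_

  -ᴾ_ : Poly → Poly
  -ᴾ_ = List.map λ (c , α) → - c , α

  infixl 7 _*ᴾ_
  _*ᴾ_ : Poly → Poly → Poly
  _*ᴾ_ = List.cartesianProductWith λ (c , α) (d , β) → c * d , α +ᵉ β

  C : Carrier → Poly
  C c = List.[ c , 0ᵉ ]

  X : Fin n → Poly
  X i = List.[ 1# , 0ᵉ Vec.[ i ]≔ 1 ]

  ∂ : Fin n → Poly → Poly
  ∂ i = List.map λ (c , α) → Vec.lookup α i · c , α Vec.[ i ]%= ℕ.pred

  Homogeneous : ℕ → Poly → Set ℓr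
  Homogeneous d p = ∀ α → Vec.sum α ≢ d → coeff p α ≈ 0#

  -- The linear functional on polynomials with x^α ↦ φ α.
  L : Poly → (Exponents → Carrier) → Carrier
  L []            φ = 0#
  L ((c , α) ∷ p) φ = c * φ α + L p φ

  δ : Exponents → Exponents → Carrier
  δ β α = if does (α ≟ᵉ β) then 1# else 0#

  coeff-L : ∀ p β → coeff p β ≈ L p (δ β)
  coeff-L []            β = ≈-refl
  coeff-L ((c , α) ∷ p) β = +-cong (lemma (does (α ≟ᵉ β))) (coeff-L p β)
    where
    lemma : ∀ b → (if b then c else 0#) ≈ c * (if b then 1# else 0#)
    lemma true  = ≈-sym (*-identityʳ c)
    lemma false = ≈-sym (zeroʳ c)

  L-cong : ∀ p {φ ψ} → (∀ α → φ α ≈ ψ α) → L p φ ≈ L p ψ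
  L-cong []      e = ≈-refl
  L-cong (t ∷ p) e = +-cong (*-congˡ (e _)) (L-cong p e)

  L-++ : ∀ p q φ → L (p ++ q) φ ≈ L p φ + L q φ
  L-++ []      q φ = ≈-sym (+-identityˡ _)
  L-++ (t ∷ p) q φ = ≈-trans (+-congˡ (L-++ p q φ)) (≈-sym (+-assoc _ _ _))

  L-neg : ∀ p φ → L (-ᴾ p) φ ≈ - L p φ
  L-neg []            φ = ≈-sym -0#≈0#
  L-neg ((c , α) ∷ p) φ =
    ≈-trans (+-cong (≈-sym (-‿distribˡ-* c (φ α))) (L-neg p φ)) (-‿+-comm _ _)

  L-zero : ∀ p → L p (λ _ → 0#) ≈ 0#
  L-zero []      = ≈-refl
  L-zero (t ∷ p) = ≈-trans (+-cong (zeroʳ _) (L-zero p)) (+-identityˡ _)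

  L-+ : ∀ p φ ψ → L p (λ α → φ α + ψ α) ≈ L p φ + L p ψ
  L-+ []            φ ψ = ≈-sym (+-identityˡ _)
  L-+ ((c , α) ∷ p) φ ψ = ≈-trans (+-congˡ (L-+ p φ ψ))
    (solve 5 (λ c x y u v → c :* (x :+ y) :+ (u :+ v) := (c :* x :+ u) :+ (c :* y :+ v))
      ≈-refl c (φ α) (ψ α) (L p φ) (L p ψ))

  L-* : ∀ p c φ → L p (λ α → c * φ α) ≈ c * L p φ
  L-* []            c φ = ≈-sym (zeroʳ c)
  L-* ((d , α) ∷ p) c φ = ≈-trans (+-congˡ (L-* p c φ))
    (solve 4 (λ c d x u → d :* (c :* x) :+ c :* u := c :* (d :* x :+ u))
      ≈-refl c d (φ α) (L p φ))

  L-swap : ∀ p q (f : Exponents → Exponents → Carrier) →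
           L p (λ α → L q (f α)) ≈ L q (λ β → L p (λ α → f α β))
  L-swap []            q f = ≈-sym (L-zero q)
  L-swap ((c , α) ∷ p) q f = begin
    c * L q (f α) + L p (λ α → L q (f α))
      ≈⟨ +-cong (≈-sym (L-* q c (f α))) (L-swap p q f) ⟩
    L q (λ β → c * f α β) + L q (λ β → L p (λ α → f α β))
      ≈⟨ ≈-sym (L-+ q _ _) ⟩
    L q (λ β → c * f α β + L p (λ α → f α β)) ∎

  L-*ᴾ : ∀ p q φ → L (p *ᴾ q) φ ≈ L p (λ α → L q (λ β → φ (α +ᵉ β)))
  L-*ᴾ []            q φ = ≈-refl
  L-*ᴾ ((c , α) ∷ p) q φ =
    ≈-trans (L-++ (List.map _ q) _ φ) (+-cong (row q) (L-*ᴾ p q φ))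
    where
    row : ∀ q → L (List.map (λ (d , β) → c * d , α +ᵉ β) q) φ ≈ c * L q (λ β → φ (α +ᵉ β))
    row []            = ≈-sym (zeroʳ c)
    row ((d , β) ∷ q) = ≈-trans (+-congˡ (row q))
      (solve 4 (λ c d x u → (c :* d) :* x :+ c :* u := c :* (d :* x :+ u))
        ≈-refl c d (φ (α +ᵉ β)) (L q (λ β → φ (α +ᵉ β))))

  remove : Exponents → Poly → Poly
  remove α []            = []
  remove α ((c , β) ∷ p) = if does (β ≟ᵉ α) then remove α p else (c , β) ∷ remove α p

  remove-length : ∀ α p → length (remove α p) ℕ.≤ length p
  remove-length α []            = ℕ.z≤n
  remove-length α ((c , β) ∷ p) with β ≟ᵉ α
  ... | yes _ = ℕ.m≤n⇒m≤1+n (remove-length α p)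
  ... | no  _ = ℕ.s≤s (remove-length α p)

  L-split : ∀ α p φ → L p φ ≈ coeff p α * φ α + L (remove α p) φ
  L-split α []            φ = ≈-sym (≈-trans (+-identityʳ _) (zeroˡ _))
  L-split α ((c , β) ∷ p) φ with β ≟ᵉ α
  ... | yes refl = ≈-trans (+-congˡ (L-split α p φ))
    (solve 4 (λ c x y u → c :* x :+ (y :* x :+ u) := (c :+ y) :* x :+ u)
      ≈-refl c (φ α) (coeff p α) (L (remove α p) φ))
  ... | no  _ = ≈-trans (+-congˡ (L-split α p φ))
    (solve 4 (λ z x y u → z :+ (y :* x :+ u) := (con 0 :+ y) :* x :+ (z :+ u))
      ≈-refl (c * φ β) (φ α) (coeff p α) (L (remove α p) φ))

  L-null : ∀ k p → length p ℕ.≤ k → (∀ α → coeff p α ≈ 0#) → ∀ φ → L p φ ≈ 0#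
  L-null k       []                _         h φ = ≈-refl
  L-null (suc k) p@((c , α) ∷ p′) (ℕ.s≤s l) h φ = drop-α (remove α p) short refl
    where
    short : length (remove α p) ℕ.≤ k
    short with α ≟ᵉ α
    ... | yes _ = ℕ.≤-trans (remove-length α p′) l
    ... | no ¬e = contradiction refl ¬e
    vanish : ∀ φ → coeff p α * φ α ≈ 0#
    vanish φ = ≈-trans (*-congʳ (h α)) (zeroˡ _)
    split : ∀ φ → L p φ ≈ L (remove α p) φ
    split φ = ≈-trans (L-split α p φ) (≈-trans (+-congʳ (vanish φ)) (+-identityˡ _))
    drop-α : ∀ q → length q ℕ.≤ k → q ≡ remove α p → L p φ ≈ 0#
    drop-α q l refl = ≈-trans (split φ) (L-null k q l h′ φ)
      where
      h′ : ∀ β → coeff q β ≈ 0#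
      h′ β = ≈-trans (coeff-L q β)
        (≈-trans (≈-sym (split (δ β))) (≈-trans (≈-sym (coeff-L p β)) (h β)))

  ≈ᴾ⇒L : ∀ {p q} → p ≈ᴾ q → ∀ φ → L p φ ≈ L q φ
  ≈ᴾ⇒L {p} {q} (mk≈ᴾ e) φ = x∙y⁻¹≈ε⇒x≈y _ _
    (≈-trans (≈-sym (difference φ)) (L-null _ (p +ᴾ (-ᴾ q)) ℕ.≤-refl h φ))
    where
    difference : ∀ φ → L (p +ᴾ (-ᴾ q)) φ ≈ L p φ + - L q φ
    difference φ = ≈-trans (L-++ p (-ᴾ q) φ) (+-congˡ (L-neg q φ))
    h : ∀ β → coeff (p +ᴾ (-ᴾ q)) β ≈ 0#
    h β = begin
      coeff (p +ᴾ (-ᴾ q)) β      ≈⟨ coeff-L (p +ᴾ (-ᴾ q)) β ⟩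
      L (p +ᴾ (-ᴾ q)) (δ β)      ≈⟨ difference (δ β) ⟩
      L p (δ β) + - L q (δ β)    ≈⟨ +-cong (coeff-L p β) (-‿cong (coeff-L q β)) ⟨
      coeff p β + - coeff q β    ≈⟨ +-congʳ (e β) ⟩
      coeff q β + - coeff q β    ≈⟨ -‿inverseʳ _ ⟩
      0#                         ∎

  L⇒≈ᴾ : ∀ {p q} → (∀ φ → L p φ ≈ L q φ) → p ≈ᴾ q
  L⇒≈ᴾ {p} {q} e = mk≈ᴾ λ β → ≈-trans (coeff-L p β) (≈-trans (e (δ β)) (≈-sym (coeff-L q β)))

  *ᴾ-cong : ∀ {p p′ q q′} → p ≈ᴾ p′ → q ≈ᴾ q′ → (p *ᴾ q) ≈ᴾ (p′ *ᴾ q′)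
  *ᴾ-cong {p} {p′} {q} {q′} e e′ = L⇒≈ᴾ λ φ →
    ≈-trans (L-*ᴾ p q φ)
      (≈-trans (L-cong p (λ α → ≈ᴾ⇒L {q} {q′} e′ _))
        (≈-trans (≈ᴾ⇒L e _) (≈-sym (L-*ᴾ p′ q′ φ))))

  +ᴾ-cong : ∀ {p p′ q q′} → p ≈ᴾ p′ → q ≈ᴾ q′ → (p +ᴾ q) ≈ᴾ (p′ +ᴾ q′)
  +ᴾ-cong {p} {p′} {q} {q′} e e′ = L⇒≈ᴾ λ φ →
    ≈-trans (L-++ p q φ)
      (≈-trans (+-cong (≈ᴾ⇒L e φ) (≈ᴾ⇒L e′ φ)) (≈-sym (L-++ p′ q′ φ)))

  -ᴾ-cong : ∀ {p q} → p ≈ᴾ q → (-ᴾ p) ≈ᴾ (-ᴾ q)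
  -ᴾ-cong {p} {q} e = L⇒≈ᴾ λ φ →
    ≈-trans (L-neg p φ) (≈-trans (-‿cong (≈ᴾ⇒L e φ)) (≈-sym (L-neg q φ)))

  +ᴾ-comm : ∀ p q → (p +ᴾ q) ≈ᴾ (q +ᴾ p)
  +ᴾ-comm p q = L⇒≈ᴾ λ φ →
    ≈-trans (L-++ p q φ) (≈-trans (+-comm _ _) (≈-sym (L-++ q p φ)))

  +ᴾ-assoc : ∀ p q s → ((p +ᴾ q) +ᴾ s) ≈ᴾ (p +ᴾ (q +ᴾ s))
  +ᴾ-assoc p q s = mk≈ᴾ λ β →
    ≈-reflexive (cong (λ t → coeff t β) (List.++-assoc p q s))

  -ᴾ-inverseʳ : ∀ p → (p +ᴾ (-ᴾ p)) ≈ᴾ []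
  -ᴾ-inverseʳ p = L⇒≈ᴾ λ φ →
    ≈-trans (L-++ p (-ᴾ p) φ) (≈-trans (+-congˡ (L-neg p φ)) (-‿inverseʳ _))

  +ᵉ-comm : ∀ α β → α +ᵉ β ≡ β +ᵉ α
  +ᵉ-comm = Vec.zipWith-comm ℕ.+-comm

  *ᴾ-comm : ∀ p q → (p *ᴾ q) ≈ᴾ (q *ᴾ p)
  *ᴾ-comm p q = L⇒≈ᴾ λ φ → begin
    L (p *ᴾ q) φ                          ≈⟨ L-*ᴾ p q φ ⟩
    L p (λ α → L q (λ β → φ (α +ᵉ β)))    ≈⟨ L-swap p q (λ α β → φ (α +ᵉ β)) ⟩
    L q (λ β → L p (λ α → φ (α +ᵉ β)))    ≈⟨ L-cong q (λ β → L-cong p λ α → ≈-reflexive (cong φ (+ᵉ-comm α β))) ⟩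
    L q (λ β → L p (λ α → φ (β +ᵉ α)))    ≈⟨ L-*ᴾ q p φ ⟨
    L (q *ᴾ p) φ                          ∎

  *ᴾ-assoc : ∀ p q s → ((p *ᴾ q) *ᴾ s) ≈ᴾ (p *ᴾ (q *ᴾ s))
  *ᴾ-assoc p q s = L⇒≈ᴾ λ φ → begin
    L ((p *ᴾ q) *ᴾ s) φ
      ≈⟨ L-*ᴾ (p *ᴾ q) s φ ⟩
    L (p *ᴾ q) (λ α → L s (λ γ → φ (α +ᵉ γ)))
      ≈⟨ L-*ᴾ p q _ ⟩
    L p (λ α → L q (λ β → L s (λ γ → φ (α +ᵉ β +ᵉ γ))))
      ≈⟨ L-cong p (λ α → L-cong q λ β → L-cong s λ γ →
           ≈-reflexive (cong φ (Vec.zipWith-assoc ℕ.+-assoc α β γ))) ⟩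
    L p (λ α → L q (λ β → L s (λ γ → φ (α +ᵉ (β +ᵉ γ)))))
      ≈⟨ L-cong p (λ α → ≈-sym (L-*ᴾ q s _)) ⟩
    L p (λ α → L (q *ᴾ s) (λ β → φ (α +ᵉ β)))
      ≈⟨ L-*ᴾ p (q *ᴾ s) φ ⟨
    L (p *ᴾ (q *ᴾ s)) φ ∎

  *ᴾ-identityˡ : ∀ p → (C 1# *ᴾ p) ≈ᴾ p
  *ᴾ-identityˡ p = L⇒≈ᴾ λ φ → begin
    L (C 1# *ᴾ p) φ                             ≈⟨ L-*ᴾ (C 1#) p φ ⟩
    1# * L p (λ β → φ (0ᵉ +ᵉ β)) + 0#           ≈⟨ ≈-trans (+-identityʳ _) (*-identityˡ _) ⟩
    L p (λ β → φ (0ᵉ +ᵉ β))                     ≈⟨ L-cong p (λ β → ≈-reflexive (cong φ (Vec.zipWith-identityˡ ℕ.+-identityˡ β))) ⟩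
    L p φ                                       ∎

  *ᴾ-distribʳ : ∀ p q s → ((q +ᴾ s) *ᴾ p) ≈ᴾ ((q *ᴾ p) +ᴾ (s *ᴾ p))
  *ᴾ-distribʳ p q s = L⇒≈ᴾ λ φ → begin
    L ((q +ᴾ s) *ᴾ p) φ              ≈⟨ L-*ᴾ (q +ᴾ s) p φ ⟩
    L (q +ᴾ s) _                     ≈⟨ L-++ q s _ ⟩
    L q _ + L s _                    ≈⟨ +-cong (L-*ᴾ q p φ) (L-*ᴾ s p φ) ⟨
    L (q *ᴾ p) φ + L (s *ᴾ p) φ      ≈⟨ L-++ (q *ᴾ p) (s *ᴾ p) φ ⟨
    L ((q *ᴾ p) +ᴾ (s *ᴾ p)) φ       ∎

  ≈ᴾ-trans : ∀ {p q s} → p ≈ᴾ q → q ≈ᴾ s → p ≈ᴾ s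
  ≈ᴾ-trans (mk≈ᴾ e) (mk≈ᴾ e′) = mk≈ᴾ λ β → ≈-trans (e β) (e′ β)

  polynomialRing : CommutativeRing r ℓr
  polynomialRing = record
    { Carrier = Poly
    ; _≈_ = _≈ᴾ_
    ; _+_ = _+ᴾ_
    ; _*_ = _*ᴾ_
    ; -_ = -ᴾ_
    ; 0# = []
    ; 1# = C 1#
    ; isCommutativeRing = record
      { isRing = record
        { +-isAbelianGroup = record
          { isGroup = record
            { isMonoid = record
              { isSemigroup = record
                { isMagma = record
                  { isEquivalence = record
                    { refl = mk≈ᴾ λ _ → ≈-refl
                    ; sym = λ (mk≈ᴾ e) → mk≈ᴾ λ β → ≈-sym (e β)
                    ; trans = ≈ᴾ-trans
                    }
                  ; ∙-cong = +ᴾ-cong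
                  }
                ; assoc = +ᴾ-assoc
                }
              ; identity = (λ _ → mk≈ᴾ λ _ → ≈-refl) , λ p → +ᴾ-comm p []
              }
            ; inverse = (λ p → ≈ᴾ-trans (+ᴾ-comm (-ᴾ p) p) (-ᴾ-inverseʳ p))
                      , -ᴾ-inverseʳ
            ; ⁻¹-cong = -ᴾ-cong
            }
          ; comm = +ᴾ-comm
          }
        ; *-cong = *ᴾ-cong
        ; *-assoc = *ᴾ-assoc
        ; *-identity = *ᴾ-identityˡ
                     , λ p → ≈ᴾ-trans (*ᴾ-comm p (C 1#)) (*ᴾ-identityˡ p)
        ; distrib = (λ p q s → ≈ᴾ-trans (*ᴾ-comm p (q +ᴾ s))
                      (≈ᴾ-trans (*ᴾ-distribʳ p q s) (+ᴾ-cong (*ᴾ-comm q p) (*ᴾ-comm s p))))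
                  , *ᴾ-distribʳ
        }
      ; *-comm = *ᴾ-comm
      }
    }

  -- The value at u, with scalars read in A through ι.
  evaluate : ∀ {a ℓa} (A : CommutativeRing a ℓa) → (Carrier → CommutativeRing.Carrier A) →
             Poly → Vec (CommutativeRing.Carrier A) n → CommutativeRing.Carrier A
  evaluate A ι []            u = CommutativeRing.0# A
  evaluate A ι ((c , α) ∷ p) u = ι c A.* Vec.foldr′ A._*_ A.1# (Vec.zipWith _^_ u α) A.+ evaluate A ι p u
    where
    module A = CommutativeRing A
    open import Algebra.Properties.Semiring.Exp A.semiring using (_^_)

module SubmoduleBases {r ℓr m ℓm} {R : CommutativeRing r ℓr} (M : Module R m ℓm) where
  open CommutativeRing R using (Carrier; _≈_; 0#)
  open Module M
  open import Algebra.Definitions.RawMonoid +ᴹ-rawMonoid using (sum)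

  linearCombination : (bs : List Carrierᴹ) → (Fin (length bs) → Carrier) → Carrierᴹ
  linearCombination bs c = sum λ i → c i *ₗ List.lookup bs i

  record IsBasis {p} (P : Carrierᴹ → Set p) (bs : List Carrierᴹ) :
                 Set (r ⊔ ℓr ⊔ m ⊔ ℓm ⊔ p) where
    field
      members     : All P bs
      spans       : ∀ θ → P θ → ∃ λ c → θ ≈ᴹ linearCombination bs c
      independent : ∀ c → linearCombination bs c ≈ᴹ 0ᴹ → ∀ i → c i ≈ 0#

-- The quotient (a^p b^q - a^q b^p) / (a - b), by recursion on the exponents.
module AntisymmetricQuotient {r ℓr} (R : CommutativeRing r ℓr) where
  open CommutativeRing R hiding (zero)
    renaming (refl to ≈-refl; sym to ≈-sym; trans to ≈-trans)
  open import Algebra.Properties.Semiring.Exp semiring using (_^_; ^-assocʳ; ^-homo-*)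
  open import Algebra.Properties.Ring ring
    using (-‿distribˡ-*; x[y-z]≈xy-xz; ⁻¹-anti-homo‿-)
  open import Algebra.Solver.Ring.NaturalCoefficients.Default commutativeSemiring
    using (solve; _:+_; _:*_; _:=_)
  open import Relation.Binary.Reasoning.Setoid setoid

  -- g p = (a^p - b^p) / (a - b)
  g : Carrier → Carrier → ℕ → Carrier
  g a b zero    = 0#
  g a b (suc p) = a * g a b p + b ^ p

  h : Carrier → Carrier → ℕ → ℕ → Carrier
  h a b p       zero    = g a b p
  h a b zero    (suc q) = - g a b (suc q)
  h a b (suc p) (suc q) = (a * b) * h a b p q

  g-spec : ∀ a b p → g a b p * (a - b) ≈ a ^ p - b ^ p
  g-spec a b zero    = ≈-trans (zeroˡ _) (≈-sym (-‿inverseʳ _))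
  g-spec a b (suc p) = begin
    (a * x + y) * (a - b)                    ≈⟨ distribʳ _ _ _ ⟩
    (a * x) * (a - b) + y * (a - b)          ≈⟨ +-cong (*-assoc _ _ _) (x[y-z]≈xy-xz _ _ _) ⟩
    a * (x * (a - b)) + (y * a - y * b)      ≈⟨ +-congʳ (*-congˡ (g-spec a b p)) ⟩
    a * (a ^ p - y) + (y * a - y * b)        ≈⟨ +-cong (x[y-z]≈xy-xz _ _ _) (+-cong (*-comm _ _) (-‿cong (*-comm _ _))) ⟩
    (a * a ^ p - a * y) + (a * y - b * y)    ≈⟨ x-y+[y-z]≈x-z _ _ _ ⟩
    a * a ^ p - b * y                        ∎
    where
    x = g a b p
    y = b ^ p
    x-y+[y-z]≈x-z : ∀ x y z → (x - y) + (y - z) ≈ x - z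
    x-y+[y-z]≈x-z x y z = begin
      (x + - y) + (y + - z)    ≈⟨ solve 4 (λ x w y z → (x :+ w) :+ (y :+ z) := (x :+ z) :+ (y :+ w)) ≈-refl x (- y) y (- z) ⟩
      (x + - z) + (y + - y)    ≈⟨ +-congˡ (-‿inverseʳ y) ⟩
      (x + - z) + 0#           ≈⟨ +-identityʳ _ ⟩
      x + - z                  ∎

  h-spec : ∀ a b p q → h a b p q * (a - b) ≈ a ^ p * b ^ q - a ^ q * b ^ p
  h-spec a b p       zero    = ≈-trans (g-spec a b p)
    (+-cong (≈-sym (*-identityʳ _)) (-‿cong (≈-sym (*-identityˡ _))))
  h-spec a b zero    (suc q) = begin
    - g a b (suc q) * (a - b)                 ≈⟨ -‿distribˡ-* _ _ ⟨
    - (g a b (suc q) * (a - b))               ≈⟨ -‿cong (g-spec a b (suc q)) ⟩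
    - (a ^ suc q - b ^ suc q)                 ≈⟨ ⁻¹-anti-homo‿- _ _ ⟩
    b ^ suc q - a ^ suc q                     ≈⟨ +-cong (*-identityˡ _) (-‿cong (*-identityʳ _)) ⟨
    1# * b ^ suc q - a ^ suc q * 1#           ∎
  h-spec a b (suc p) (suc q) = begin
    (a * b) * h a b p q * (a - b)                          ≈⟨ *-assoc _ _ _ ⟩
    (a * b) * (h a b p q * (a - b))                        ≈⟨ *-congˡ (h-spec a b p q) ⟩
    (a * b) * (a ^ p * b ^ q - a ^ q * b ^ p)              ≈⟨ x[y-z]≈xy-xz _ _ _ ⟩
    (a * b) * (a ^ p * b ^ q) - (a * b) * (a ^ q * b ^ p)  ≈⟨ +-cong (lemma a b _ _) (-‿cong (lemma a b _ _)) ⟩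
    a ^ suc p * b ^ suc q - a ^ suc q * b ^ suc p          ∎
    where
    lemma : ∀ a b x y → (a * b) * (x * y) ≈ (a * x) * (b * y)
    lemma = solve 4 (λ a b x y → (a :* b) :* (x :* y) := (a :* x) :* (b :* y)) ≈-refl

  quotientᴬ : ∀ a b p q →
    ∃ λ s → s * (a ^ 1 * b ^ 0 - a ^ 0 * b ^ 1) ≈ a ^ p * b ^ q - a ^ q * b ^ p
  quotientᴬ a b p q = h a b p q , ≈-trans
    (*-congˡ (+-cong (≈-trans (*-identityʳ _) (*-identityʳ _))
                     (-‿cong (≈-trans (*-identityˡ _) (*-identityʳ _)))))
    (h-spec a b p q)

  quotientᴮ : ∀ a b p q →
    ∃ λ s → s * (a ^ 2 * b ^ 0 - a ^ 0 * b ^ 2) ≈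
            a ^ (2 ℕ.* p ℕ.+ 1) * b ^ (2 ℕ.* q ℕ.+ 1) - a ^ (2 ℕ.* q ℕ.+ 1) * b ^ (2 ℕ.* p ℕ.+ 1)
  quotientᴮ a b p q = (a * b) * h (a ^ 2) (b ^ 2) p q , (begin
    (a * b) * h A B p q * (A * 1# - 1# * B)
      ≈⟨ *-congˡ (+-cong (*-identityʳ _) (-‿cong (*-identityˡ _))) ⟩
    (a * b) * h A B p q * (A - B)
      ≈⟨ *-assoc _ _ _ ⟩
    (a * b) * (h A B p q * (A - B))
      ≈⟨ *-congˡ (h-spec A B p q) ⟩
    (a * b) * (A ^ p * B ^ q - A ^ q * B ^ p)
      ≈⟨ x[y-z]≈xy-xz _ _ _ ⟩
    (a * b) * (A ^ p * B ^ q) - (a * b) * (A ^ q * B ^ p)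
      ≈⟨ +-cong (rearrange p q) (-‿cong (rearrange q p)) ⟩
    a ^ (2 ℕ.* p ℕ.+ 1) * b ^ (2 ℕ.* q ℕ.+ 1) - a ^ (2 ℕ.* q ℕ.+ 1) * b ^ (2 ℕ.* p ℕ.+ 1) ∎)
    where
    A = a ^ 2
    B = b ^ 2
    odd : ∀ x k → (x ^ 2) ^ k * x ≈ x ^ (2 ℕ.* k ℕ.+ 1)
    odd x k = ≈-trans (*-cong (^-assocʳ x 2 k) (≈-sym (*-identityʳ x))) (≈-sym (^-homo-* x (2 ℕ.* k) 1))
    rearrange : ∀ k l → (a * b) * (A ^ k * B ^ l) ≈ a ^ (2 ℕ.* k ℕ.+ 1) * b ^ (2 ℕ.* l ℕ.+ 1)
    rearrange k l = ≈-trans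
      (solve 4 (λ a b x y → (a :* b) :* (x :* y) := (x :* a) :* (y :* b)) ≈-refl a b (A ^ k) (B ^ l))
      (*-cong (odd a k) (odd b l))

open Reals using (ℝ; fromℚ; ℝ-commutativeRing)

_!ᵛ : ∀ {n} → Vec ℕ n → ℕ
[]      !ᵛ = 1
(a ∷ α) !ᵛ = a ! ℕ.* α !ᵛ

!ᵛ≢0 : ∀ {n} (α : Vec ℕ n) → ℕ.NonZero (α !ᵛ)
!ᵛ≢0 []      = _
!ᵛ≢0 (a ∷ α) = ℕ.m*n≢0 (a !) (α !ᵛ) {{a ℕ.!≢0}} {{ !ᵛ≢0 α }}

record MultiIndex (ℓ m : ℕ) : Set where
  constructor mkMultiIndex
  field
    exponents : Vec ℕ ℓ
    .size     : Vec.sum exponents ≡ m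
open MultiIndex public

-- Every multi-index of length ℓ and size m, once.
multiIndices : ∀ ℓ m → List (MultiIndex ℓ m)
multiIndices zero    zero    = mkMultiIndex [] refl ∷ []
multiIndices zero    (suc m) = []
multiIndices (suc ℓ) m       = List.concatMap (λ a → List.map (cons a) (multiIndices ℓ (m ∸ toℕ a)))
                                              (List.allFin (suc m))
  where
  cons : (a : Fin (suc m)) → MultiIndex ℓ (m ∸ toℕ a) → MultiIndex (suc ℓ) m
  cons a (mkMultiIndex α e) = mkMultiIndex (toℕ a ∷ α)
    (trans (cong (toℕ a ℕ.+_) e) (ℕ.m+[n∸m]≡n (Fin.toℕ≤pred[n] a)))

-- Each position i of α, repeated αᵢ times, in increasing order.
repeated : ∀ {ℓ} (α : Vec ℕ ℓ) → Vec (Fin ℓ) (Vec.sum α)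
repeated []      = []
repeated (a ∷ α) = Vec.replicate a zero Vec.++ Vec.map suc (repeated α)

-- The pairs of integers with ℓ - 2 ≥ λ₁ ≥ λ₂ ≥ 0, for ℓ ≥ 2.
Λ : ℕ → List (Vec ℕ 2)
Λ ℓ = List.concatMap (λ λ₁ → List.map (λ λ₂ → λ₁ ∷ λ₂ ∷ []) (List.upTo (suc λ₁))) (List.upTo (ℓ ∸ 1))

module Schur where
  open Polynomials ℝ-commutativeRing 2
  open CommutativeRing polynomialRing using (_≈_; _*_; _-_; semiring)
  open import Algebra.Properties.Semiring.Exp semiring using (_^_)
  open AntisymmetricQuotient polynomialRing using (quotientᴬ; quotientᴮ)

  det : (Fin 2 → Fin 2 → Poly) → Poly
  det M = M zero zero * M (suc zero) (suc zero) - M zero (suc zero) * M (suc zero) zero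

  -- m - j, for the column j = suc (toℕ k) of a determinant of size m = 2
  m-j : Fin 2 → ℕ
  m-j k = 2 ∸ suc (toℕ k)

  numeratorᴬ numeratorᴮ : Vec ℕ 2 → Poly
  numeratorᴬ μ = det λ i j → X i ^ (Vec.lookup μ j ℕ.+ m-j j)
  numeratorᴮ μ = det λ i j → X i ^ (2 ℕ.* (Vec.lookup μ j ℕ.+ m-j j) ℕ.+ 1)

  denominatorᴬ denominatorᴮ : Poly
  denominatorᴬ = det λ i j → X i ^ m-j j
  denominatorᴮ = det λ i j → X i ^ (2 ℕ.* m-j j)

  existsᴬ : ∀ μ → ∃ λ s → s * denominatorᴬ ≈ numeratorᴬ μ
  existsᴬ (λ₁ ∷ λ₂ ∷ []) = quotientᴬ (X zero) (X (suc zero)) (λ₁ ℕ.+ 1) (λ₂ ℕ.+ 0)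

  existsᴮ : ∀ μ → ∃ λ s → s * denominatorᴮ ≈ numeratorᴮ μ
  existsᴮ (λ₁ ∷ λ₂ ∷ []) = quotientᴮ (X zero) (X (suc zero)) (λ₁ ℕ.+ 1) (λ₂ ℕ.+ 0)

  -- The quotients of determinants; unique because the denominators are
  -- non-zero-divisors.
  sᴬ sᴮ : Vec ℕ 2 → Poly
  sᴬ μ = proj₁ (existsᴬ μ)
  sᴮ μ = proj₁ (existsᴮ μ)

module Operators (ℓ : ℕ) where
  open Polynomials ℝ-commutativeRing ℓ public
  open CommutativeRing polynomialRing hiding (zero)
    renaming (refl to ≈-refl; sym to ≈-sym; trans to ≈-trans)
  open import Algebra.Properties.Semiring.Exp semiring using (_^_)

  ∑ ∏ : ∀ {a} {A : Set a} → List A → (A → Poly) → Poly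
  ∑ xs f = List.foldr (λ x p → f x + p) 0# xs
  ∏ xs f = List.foldr (λ x p → f x * p) 1# xs

  -- θ = Σ_α θ(α) ∂^α is given by its coefficients.
  DiffOp : ℕ → Set
  DiffOp m = MultiIndex ℓ m → Poly

  diffOpModule : ℕ → Module polynomialRing 0ℓ 0ℓ
  diffOpModule m = record
    { Carrierᴹ = DiffOp m
    ; _≈ᴹ_ = λ θ φ → ∀ α → θ α ≈ φ α
    ; _+ᴹ_ = λ θ φ α → θ α + φ α
    ; _*ₗ_ = λ f θ α → f * θ α
    ; _*ᵣ_ = λ θ f α → f * θ α
    ; 0ᴹ = λ _ → 0#
    ; -ᴹ_ = λ θ α → - θ α
    ; isModule = IsModuleFromLeft.isModule {commutativeRing = polynomialRing} record
      { isLeftModule = record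
        { isLeftSemimodule = record
          { +ᴹ-isCommutativeMonoid = record
            { isMonoid = record
              { isSemigroup = record
                { isMagma = record
                  { isEquivalence = record
                    { refl = λ α → ≈-refl
                    ; sym = λ e α → ≈-sym (e α)
                    ; trans = λ e e′ α → ≈-trans (e α) (e′ α)
                    }
                  ; ∙-cong = λ e e′ α → +-cong (e α) (e′ α)
                  }
                ; assoc = λ θ φ ψ α → +-assoc (θ α) (φ α) (ψ α)
                }
              ; identity = (λ θ α → +-identityˡ (θ α)) , λ θ α → +-identityʳ (θ α)
              }
            ; comm = λ θ φ α → +-comm (θ α) (φ α)
            }
          ; isPreleftSemimodule = record
            { *ₗ-cong = λ e e′ α → *-cong e (e′ α)
            ; *ₗ-zeroˡ = λ θ α → zeroˡ (θ α)
            ; *ₗ-distribʳ = λ θ f g α → distribʳ (θ α) f g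
            ; *ₗ-identityˡ = λ θ α → *-identityˡ (θ α)
            ; *ₗ-assoc = λ f g θ α → *-assoc f g (θ α)
            ; *ₗ-zeroʳ = λ f α → zeroʳ f
            ; *ₗ-distribˡ = λ f θ φ α → distribˡ f (θ α) (φ α)
            }
          }
        ; -ᴹ‿cong = λ e α → -‿cong (e α)
        ; -ᴹ‿inverse = (λ θ α → -‿inverseˡ (θ α)) , λ θ α → -‿inverseʳ (θ α)
        }
      }
    }

  module _ {m : ℕ} where
    open Module (diffOpModule m) public using (_≈ᴹ_; 0ᴹ)
    open SubmoduleBases (diffOpModule m) public

  ∂^ : Vec ℕ ℓ → Poly → Poly
  ∂^ α f = List.foldr (λ i g → fold g (∂ i) (Vec.lookup α i)) f (List.allFin ℓ)

  -- θ(f), for the action of differential operators on S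
  apply : ∀ {m} → DiffOp m → Poly → Poly
  apply {m} θ f = ∑ (multiIndices ℓ m) λ α → θ α * ∂^ (exponents α) f

  -- D^(m) of the arrangement with defining polynomial Q, as a predicate on D^(m)(S)
  D : ∀ m → Poly → DiffOp m → Set
  D m Q θ = ∀ f → ∃ λ g → apply θ (Q * f) ≈ Q * g

  IsHomogeneous : ∀ {m} → DiffOp m → ℕ → Set
  IsHomogeneous θ d = ¬ (θ ≈ᴹ 0ᴹ) × ∀ α → Homogeneous d (θ α)

  record HomogeneousBasis {m} (P : DiffOp m → Set) : Set where
    field
      elements    : List (DiffOp m)
      degrees     : List ℕ
      isBasis     : IsBasis P elements
      homogeneous : Pointwise IsHomogeneous elements degrees

  -- exp P = E: the module P is free with a homogeneous basis, and every
  -- homogeneous basis has E as its multiset of degrees.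
  IsExp : ∀ {m} → (DiffOp m → Set) → List ℕ → Set
  IsExp P E = HomogeneousBasis P × ∀ (B : HomogeneousBasis P) → HomogeneousBasis.degrees B ↭ E

  i<j : List (Fin ℓ × Fin ℓ)
  i<j = List.filter (λ (i , j) → i Fin.<? j) (List.cartesianProduct (List.allFin ℓ) (List.allFin ℓ))

  others : Fin ℓ → List (Fin ℓ)
  others k = List.filter (λ i → ¬? (i Fin.≟ k)) (List.allFin ℓ)

  Qᴬ Qᴮ : Poly
  Qᴬ = ∏ i<j λ (i , j) → X i - X j
  Qᴮ = ∏ (List.allFin ℓ) X * ∏ i<j λ (i , j) → X i ^ 2 - X j ^ 2

  _at_ : ∀ {m} → Polynomials.Poly ℝ-commutativeRing m → Vec Poly m → Poly
  _at_ {m} = Polynomials.evaluate ℝ-commutativeRing m polynomialRing C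

  xᵅ : ∀ {m} → MultiIndex ℓ m → Vec Poly m
  xᵅ (mkMultiIndex α e) = Vec.map X (Vec.cast e (repeated α))

  1/ᶜ : (n : ℕ) → .{{ℕ.NonZero n}} → Poly
  1/ᶜ n = C (fromℚ ((+ 1) ℚ./ n))

  θ[_] : ∀ {m} → Polynomials.Poly ℝ-commutativeRing m → DiffOp m
  θ[ s ] α = (s at xᵅ α) * 1/ᶜ (exponents α !ᵛ) {{ !ᵛ≢0 (exponents α) }}

  -- The operator f (1 / m!) ∂ₖ^m.
  η[_,_] : ∀ {m} → Poly → Fin ℓ → DiffOp m
  η[_,_] {m} f k α =
    if does (exponents α ≟ᵉ 0ᵉ Vec.[ k ]≔ m) then f * 1/ᶜ (m !) {{m ℕ.!≢0}} else 0#

  θᴬ θᴮ : Vec ℕ 2 → DiffOp 2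
  θᴬ μ = θ[ Schur.sᴬ μ ]
  θᴮ μ = θ[ Schur.sᴮ μ ]

  ηᴬ ηᴮ : Fin ℓ → DiffOp 2
  ηᴬ k = η[ (∏ (others k) λ i → X k - X i) , k ]
  ηᴮ k = η[ X k * (∏ (others k) λ i → X k ^ 2 - X i ^ 2) , k ]

  Cᴬ Cᴮ : List (DiffOp 2)
  Cᴬ = List.map ηᴬ (List.allFin ℓ) ++ List.map θᴬ (Λ ℓ)
  Cᴮ = List.map ηᴮ (List.allFin ℓ) ++ List.map θᴮ (Λ ℓ)

{-# OPTIONS --safe #-}
module Submission where

-- An operator θ of order two is determined by the symmetric matrix M of the values θ(x_a x_b).
-- As B(f, g) = θ(f g) - θ(f) g - f θ(g) is a biderivation, θ preserves Q S exactly when L divides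
-- B(L, x_j) for every linear factor L of Q and every j; for L = x_a - x_b this says M_aj ≡ M_bj
-- modulo x_a - x_b.
-- Then g_ab = (x_a - x_b) M_ab is an antisymmetric matrix to which Newton interpolation applies
-- twice, giving g = V G Vᵗ for the Vandermonde matrix V and a unique antisymmetric G over S, and
-- the entries of G below the diagonal are the coefficients of the Schur polynomials s_λ(x_a, x_b)
-- in M_ab for a ≠ b.  What is left over is a diagonal matrix whose a-th entry is divisible by
-- ∏_{i ≠ a} (x_a - x_i).  For type B the same is done at the nodes x_a², after division of M_ab by
-- x_a x_b.
--
-- Only linear forms with a unit coefficient are ever cancelled, so equality in ℝ need not be
-- decided.
--
-- Two homogeneous bases have the same degrees: at the origin the two transition matrices are
-- mutually inverse and vanish between different degrees, so the traces of the products of their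
-- blocks of degree k, computed in both orders, count the elements of degree k in either basis.

open import Algebra.Bundles using (CommutativeRing; RawRing)
import Algebra.Definitions.RawMonoid as RawMonoid
open import Algebra.Module.Bundles using (Module)
open import Data.Bool.Base using (Bool; true; false; if_then_else_)
open import Data.Fin.Base as Fin using (Fin; zero; suc; toℕ)
import Data.Fin.Properties as Fin
import Data.Integer.Base as ℤ
open import Data.List.Base as List using (List; []; _∷_; _++_; length)
open import Data.List.Membership.Propositional using (_∈_)
import Data.List.Membership.Propositional.Properties as Membership
import Data.List.Properties as List
open import Data.List.Relation.Binary.Disjoint.Propositional using (Disjoint)
open import Data.List.Relation.Binary.Permutation.Propositional as Perm using (_↭_)
import Data.List.Relation.Binary.Permutation.Propositional.Properties as Perm
open import Data.List.Relation.Binary.Pointwise.Base using (Pointwise; []; _∷_)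
open import Data.List.Relation.Unary.All as All using (All; []; _∷_)
import Data.List.Relation.Unary.All.Properties as All
open import Data.List.Relation.Unary.AllPairs as AllPairs using (AllPairs; []; _∷_)
import Data.List.Relation.Unary.AllPairs.Properties as AllPairs
open import Data.List.Relation.Unary.Any using (here; there; index)
import Data.List.Relation.Unary.Any.Properties as Any
open import Data.List.Relation.Unary.Unique.Propositional using (Unique)
import Data.List.Relation.Unary.Unique.Propositional.Properties as Unique
open import Data.Maybe.Base using (Maybe; just; nothing)
open import Data.Nat.Base as ℕ using (ℕ; zero; suc)
open import Data.Nat.GeneralisedArithmetic using (fold)
import Data.Nat.Properties as ℕ
open import Data.Product using (∃; _×_; _,_; proj₁; proj₂)
open import Data.Rational.Base as ℚ using (ℚ; 0ℚ; 1ℚ)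
import Data.Rational.Properties as ℚ
open import Data.Sum.Base using (_⊎_; inj₁; inj₂; [_,_]′)
import Data.Sum.Properties as Sum
open import Data.Vec.Base as Vec using (Vec; []; _∷_)
import Data.Vec.Properties as Vec
open import Level using (_⊔_)
open import Relation.Binary.Definitions using (DecidableEquality; tri<; tri≈; tri>)
open import Relation.Binary.PropositionalEquality as ≡ using (_≡_; _≢_)
open import Relation.Nullary using (¬_; Dec; does; yes; no; contradiction)
open import Relation.Nullary.Decidable using (_×-dec_; ¬?; dec-true; dec-false; recompute)
open import Defs

-- Spanning is the existence of an interpolant, independence its uniqueness. The factor x_a - x_b in
-- g_ab serves two ends: the diagonal of g vanishes whatever M_aa is, and the congruence between
-- g_aj and g_bj becomes automatic at j = a and j = b. Those two congruences of M are thus left over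
-- to control the diagonal: as M_ia equals its Schur part S_ia for i ≠ a, the difference M_aa - S_aa
-- is congruent to M_ia - S_ia = 0 modulo x_a - x_i. The obstacle is the second interpolation. Its
-- values are the coefficients found by the first, of which the hypotheses do not speak. Their
-- compatibility is deduced by interpolating the quotients (g_ia - g_ib) / (x_a - x_b) too and
-- comparing coefficients, which are unique. In type B, division by x_a x_b turns the conditions at
-- x_a - x_b and at x_a + x_b into divisibility of one and the same difference, hence into
-- divisibility by x_a² - x_b².

-- The coefficients of the solver are reduced formal differences of naturals.
module IntegerRingSolver {c ℓ} (S : CommutativeRing c ℓ) where
  open CommutativeRing S hiding (zero)
  open import Algebra.Properties.Ring ring using (-0#≈0#; -‿+-comm; -‿distribˡ-*; -‿distribʳ-*; -‿involutive)
  open import Algebra.Properties.Semiring.Mult.TCOptimised semiring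
    using (×-homo-+; ×1-homo-*; 1+×) renaming (_×_ to _·_)
  open import Algebra.Solver.Ring.AlmostCommutativeRing
    using (_-Raw-AlmostCommutative⟶_; fromCommutativeRing)
  import Algebra.Solver.Ring.NaturalCoefficients.Default commutativeSemiring as ℕ-Solver
  open import Relation.Binary.Reasoning.Setoid setoid

  private
    -- The separate clause for `zero` lets the constants `:0` and `:1` evaluate to `0#` and `1#`
    -- themselves rather than to differences.
    ⟦_⟧ : ℕ × ℕ → Carrier
    ⟦ m , zero ⟧ = m · 1#
    ⟦ m , n@(suc _) ⟧ = m · 1# - n · 1#

    ⟦⟧-difference : ∀ m n → ⟦ m , n ⟧ ≈ m · 1# - n · 1#
    ⟦⟧-difference m zero    = sym (trans (+-congˡ -0#≈0#) (+-identityʳ _))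
    ⟦⟧-difference m (suc n) = refl

    reduce : ℕ → ℕ → ℕ × ℕ
    reduce (suc m) (suc n) = reduce m n
    reduce m       n       = m , n

    coefficients : RawRing _ _
    coefficients = record
      { Carrier = ℕ × ℕ
      ; _≈_ = _≡_
      ; _+_ = λ (a , b) (c , d) → reduce (a ℕ.+ c) (b ℕ.+ d)
      ; _*_ = λ (a , b) (c , d) → reduce (a ℕ.* c ℕ.+ b ℕ.* d) (a ℕ.* d ℕ.+ b ℕ.* c)
      ; -_ = λ (a , b) → b , a
      ; 0# = 0 , 0
      ; 1# = 1 , 0
      }

    [a+b]-[c+d] : ∀ a b c d → (a + b) - (c + d) ≈ (a - c) + (b - d)
    [a+b]-[c+d] a b c d = trans (+-congˡ (sym (-‿+-comm c d)))
      (solve 4 (λ a b c d → (a :+ b) :+ (c :+ d) := (a :+ c) :+ (b :+ d)) refl a b (- c) (- d))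
      where open ℕ-Solver

    [a-b][c-d] : ∀ a b c d → (a - b) * (c - d) ≈ (a * c + b * d) - (a * d + b * c)
    [a-b][c-d] a b c d = begin
      (a - b) * (c - d)
        ≈⟨ solve 4 (λ a b c d → (a :+ b) :* (c :+ d) := (a :* c :+ b :* d) :+ (a :* d :+ b :* c)) refl a (- b) c
          (- d) ⟩
      (a * c + - b * - d) + (a * - d + - b * c)
        ≈⟨ +-cong (+-congˡ (trans (sym (-‿distribˡ-* b (- d)))
          (trans (-‿cong (sym (-‿distribʳ-* b d))) (-‿involutive _))))
                  (+-cong (sym (-‿distribʳ-* a d)) (sym (-‿distribˡ-* b c))) ⟩
      (a * c + b * d) + (- (a * d) + - (b * c))
        ≈⟨ +-congˡ (-‿+-comm _ _) ⟩
      (a * c + b * d) - (a * d + b * c) ∎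
      where open ℕ-Solver

    cancel : ∀ x y z → (x + z) - (y + z) ≈ x - y
    cancel x y z = trans ([a+b]-[c+d] x z y z) (trans (+-congˡ (-‿inverseʳ z)) (+-identityʳ _))

    reduce-difference : ∀ m n → ⟦ reduce m n ⟧ ≈ m · 1# - n · 1#
    reduce-difference zero    n       = ⟦⟧-difference zero n
    reduce-difference (suc m) zero    = ⟦⟧-difference (suc m) zero
    reduce-difference (suc m) (suc n) = trans (reduce-difference m n) (sym (trans
      (+-cong (trans (1+× m 1#) (+-comm _ _)) (-‿cong (trans (1+× n 1#) (+-comm _ _)))) (cancel _ _ _)))

    homomorphism : coefficients -Raw-AlmostCommutative⟶ fromCommutativeRing S
    homomorphism = record
      { ⟦_⟧ = ⟦_⟧
      ; +-homo = λ (a , b) (c , d) → begin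
          ⟦ reduce (a ℕ.+ c) (b ℕ.+ d) ⟧  ≈⟨ reduce-difference (a ℕ.+ c) (b ℕ.+ d) ⟩
          (a ℕ.+ c) · 1# - (b ℕ.+ d) · 1#  ≈⟨ +-cong (×-homo-+ 1# a c) (-‿cong (×-homo-+ 1# b d)) ⟩
          (a · 1# + c · 1#) - (b · 1# + d · 1#)  ≈⟨ [a+b]-[c+d] _ _ _ _ ⟩
          (a · 1# - b · 1#) + (c · 1# - d · 1#)  ≈⟨ +-cong (⟦⟧-difference a b) (⟦⟧-difference c d) ⟨
          ⟦ a , b ⟧ + ⟦ c , d ⟧                              ∎
      ; *-homo = λ (a , b) (c , d) → begin
          ⟦ reduce (a ℕ.* c ℕ.+ b ℕ.* d) (a ℕ.* d ℕ.+ b ℕ.* c) ⟧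
            ≈⟨ reduce-difference (a ℕ.* c ℕ.+ b ℕ.* d) (a ℕ.* d ℕ.+ b ℕ.* c) ⟩
          (a ℕ.* c ℕ.+ b ℕ.* d) · 1# - (a ℕ.* d ℕ.+ b ℕ.* c) · 1#
            ≈⟨ +-cong (*+* a c b d) (-‿cong (*+* a d b c)) ⟩
          (a · 1# * c · 1# + b · 1# * d · 1#) - (a · 1# * d · 1# + b · 1# * c · 1#)
            ≈⟨ [a-b][c-d] _ _ _ _ ⟨
          (a · 1# - b · 1#) * (c · 1# - d · 1#)
            ≈⟨ *-cong (⟦⟧-difference a b) (⟦⟧-difference c d) ⟨
          ⟦ a , b ⟧ * ⟦ c , d ⟧ ∎
      ; -‿homo = λ (a , b) → begin
          ⟦ b , a ⟧  ≈⟨ ⟦⟧-difference b a ⟩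
          b · 1# - a · 1#  ≈⟨ +-comm _ _ ⟩
          - (a · 1#) + b · 1#  ≈⟨ +-congˡ (-‿involutive _) ⟨
          - (a · 1#) + - - (b · 1#)  ≈⟨ -‿+-comm _ _ ⟩
          - (a · 1# - b · 1#)  ≈⟨ -‿cong (⟦⟧-difference a b) ⟨
          - ⟦ a , b ⟧                ∎
      ; 0-homo = refl
      ; 1-homo = refl
      }
      where
      *+* : ∀ a c b d → (a ℕ.* c ℕ.+ b ℕ.* d) · 1# ≈ a · 1# * c · 1# + b · 1# * d · 1#
      *+* a c b d = trans (×-homo-+ 1# (a ℕ.* c) (b ℕ.* d)) (+-cong (×1-homo-* a c) (×1-homo-* b d))

    same-difference : ∀ p q → Maybe (⟦ p ⟧ ≈ ⟦ q ⟧)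
    same-difference (a , b) (c , d) with a ℕ.+ d ℕ.≟ c ℕ.+ b
    ... | no  _ = nothing
    ... | yes e = just (begin
      ⟦ a , b ⟧  ≈⟨ ⟦⟧-difference a b ⟩
      a · 1# - b · 1#  ≈⟨ cancel _ _ _ ⟨
      (a · 1# + d · 1#) - (b · 1# + d · 1#)  ≈⟨ +-cong (×-homo-+ 1# a d) (-‿cong (+-comm _ _)) ⟨
      (a ℕ.+ d) · 1# - (d · 1# + b · 1#)  ≡⟨ ≡.cong (λ n → n · 1# - (d · 1# + b · 1#)) e ⟩
      (c ℕ.+ b) · 1# - (d · 1# + b · 1#)  ≈⟨ +-congʳ (×-homo-+ 1# c b) ⟩
      (c · 1# + b · 1#) - (d · 1# + b · 1#)  ≈⟨ cancel _ _ _ ⟩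
      c · 1# - d · 1#  ≈⟨ ⟦⟧-difference c d ⟨
      ⟦ c , d ⟧                                      ∎)

  open import Algebra.Solver.Ring coefficients (fromCommutativeRing S) homomorphism same-difference public
    using (Polynomial; solve; _:=_; _:+_; _:*_; _:-_; :-_; con)

  :0 :1 : ∀ {n} → Polynomial n
  :0 = con (0 , 0)
  :1 = con (1 , 0)

-- Divisibility, non-zero-divisors and coprimality

module Divisibility {c ℓ} (S : CommutativeRing c ℓ) where
  open CommutativeRing S hiding (zero)
  open IntegerRingSolver S
  open import Algebra.Properties.Ring ring using (-0#≈0#; x∙y⁻¹≈ε⇒x≈y)
  open import Relation.Binary.Reasoning.Setoid setoid

  infix 4 _∣_
  record _∣_ (d x : Carrier) : Set (c ⊔ ℓ) where
    constructor _,_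
    field
      cofactor : Carrier
      equation : x ≈ d * cofactor
  open _∣_ public

  ∣-resp : ∀ {d e x y} → d ≈ e → x ≈ y → d ∣ x → e ∣ y
  ∣-resp d≈e x≈y (q , eq) = q , trans (sym x≈y) (trans eq (*-congʳ d≈e))

  ∣-respʳ : ∀ {d x y} → x ≈ y → d ∣ x → d ∣ y
  ∣-respʳ = ∣-resp refl

  ∣0 : ∀ d → d ∣ 0#
  ∣0 d = 0# , sym (zeroʳ d)

  ∣-refl : ∀ {d} → d ∣ d
  ∣-refl {d} = 1# , sym (*-identityʳ d)

  ∣-trans : ∀ {d e x} → d ∣ e → e ∣ x → d ∣ x
  ∣-trans {d} (q , eq) (r , eq′) = q * r , trans eq′ (trans (*-congʳ eq) (*-assoc d q r))

  ∣+ : ∀ {d x y} → d ∣ x → d ∣ y → d ∣ x + y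
  ∣+ {d} (q , eq) (r , eq′) = q + r , trans (+-cong eq eq′) (sym (distribˡ d q r))

  ∣*ˡ : ∀ {d x} y → d ∣ x → d ∣ y * x
  ∣*ˡ {d} y (q , eq) = y * q , trans (*-congˡ eq)
    (solve 3 (λ y d q → y :* (d :* q) := d :* (y :* q)) refl y d q)

  ∣*ʳ : ∀ {d x} y → d ∣ x → d ∣ x * y
  ∣*ʳ y h = ∣-respʳ (*-comm y _) (∣*ˡ y h)

  ∣- : ∀ {d x} → d ∣ x → d ∣ - x
  ∣- {d} {x} h = ∣-respʳ (solve 1 (λ x → :- :1 :* x := :- x) refl x) (∣*ˡ (- 1#) h)

  ∣-double : ∀ {d x} → d ∣ x → d + d ∣ x + x
  ∣-double {d} (q , eq) = q , trans (+-cong eq eq) (sym (distribʳ q d d))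

  ∣-difference : ∀ {d x y} → d ∣ x → d ∣ y → d ∣ x - y
  ∣-difference h k = ∣+ h (∣- k)

  NonZeroDivisor : Carrier → Set _
  NonZeroDivisor d = ∀ x → d * x ≈ 0# → x ≈ 0#

  nzd-resp : ∀ {d e} → d ≈ e → NonZeroDivisor d → NonZeroDivisor e
  nzd-resp d≈e nz x eq = nz x (trans (*-congʳ d≈e) eq)

  nzd-1 : NonZeroDivisor 1#
  nzd-1 x eq = trans (sym (*-identityˡ x)) eq

  nzd-* : ∀ {d e} → NonZeroDivisor d → NonZeroDivisor e → NonZeroDivisor (d * e)
  nzd-* nz nz′ x eq = nz′ x (nz _ (trans (sym (*-assoc _ _ x)) eq))

  nzd-neg : ∀ {d} → NonZeroDivisor d → NonZeroDivisor (- d)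
  nzd-neg {d} nz x eq = nz x (begin
    d * x  ≈⟨ solve 2 (λ d x → d :* x := :- (:- d :* x)) refl d x ⟩
    - (- d * x)   ≈⟨ -‿cong eq ⟩
    - 0#  ≈⟨ -0#≈0# ⟩
    0#            ∎)

  nzd-cancel : ∀ {d x y} → NonZeroDivisor d → d * x ≈ d * y → x ≈ y
  nzd-cancel {d} {x} {y} nz eq = x∙y⁻¹≈ε⇒x≈y x y (nz (x - y) (begin
    d * (x - y)      ≈⟨ solve 3 (λ d x y → d :* (x :- y) := d :* x :- d :* y) refl d x y ⟩
    d * x - d * y    ≈⟨ +-congʳ eq ⟩
    d * y - d * y    ≈⟨ -‿inverseʳ _ ⟩
    0#               ∎))

  -- Multiplication by `e` is injective on the quotient by `d`. This form of coprimality asks for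
  -- neither gcds nor factorisation, and it is symmetric once `d` is a non-zero-divisor.
  Coprime : Carrier → Carrier → Set _
  Coprime d e = ∀ x → d ∣ e * x → d ∣ x

  coprime-resp : ∀ {d d′ e e′} → d ≈ d′ → e ≈ e′ → Coprime d e → Coprime d′ e′
  coprime-resp d≈ e≈ co x h = ∣-resp d≈ refl (co x (∣-resp (sym d≈) (*-congʳ (sym e≈)) h))

  -- If d x = e q, then d divides e q, so q = d r, and d cancels from d x = e d r.
  coprime-sym : ∀ {d e} → NonZeroDivisor d → Coprime d e → Coprime e d
  coprime-sym {d} {e} nz co x (q , eq) with co q (x , sym eq)
  ... | r , eq′ = r , nzd-cancel nz (begin
    d * x  ≈⟨ eq ⟩
    e * q  ≈⟨ *-congˡ eq′ ⟩
    e * (d * r)    ≈⟨ solve 3 (λ d e r → e :* (d :* r) := d :* (e :* r)) refl d e r ⟩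
    d * (e * r)    ∎)

  coprime-1 : ∀ {d} → Coprime d 1#
  coprime-1 x = ∣-respʳ (*-identityˡ x)

  coprime-*ʳ : ∀ {d e f} → Coprime d e → Coprime d f → Coprime d (e * f)
  coprime-*ʳ co co′ x h = co′ x (co _ (∣-respʳ (*-assoc _ _ x) h))

  coprime-∣* : ∀ {d e x} → Coprime e d → d ∣ x → e ∣ x → d * e ∣ x
  coprime-∣* {d} {e} co (q , eq) e∣x with co q (∣-respʳ eq e∣x)
  ... | r , eq′ = r , trans eq (trans (*-congˡ eq′) (sym (*-assoc d e r)))

  coprime-*ˡ : ∀ {d e x} → Coprime d x → Coprime e x → Coprime e d → Coprime (d * e) x
  coprime-*ˡ {d} {e} co co′ co″ y h =
    coprime-∣* co″ (co y (∣-trans (e , refl) h)) (co′ y (∣-trans (d , *-comm d e) h))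

  product : List Carrier → Carrier
  product = List.foldr _*_ 1#

  nzd-product : ∀ {xs} → All NonZeroDivisor xs → NonZeroDivisor (product xs)
  nzd-product []         = nzd-1
  nzd-product (nz ∷ nzs) = nzd-* nz (nzd-product nzs)

  coprime-product : ∀ {d xs} → All (Coprime d) xs → Coprime d (product xs)
  coprime-product []         = coprime-1
  coprime-product (co ∷ cos) = coprime-*ʳ co (coprime-product cos)

  product∣ : ∀ {xs x} → All NonZeroDivisor xs → AllPairs Coprime xs → All (_∣ x) xs → product xs ∣ x
  product∣ []         []         []       = _ , sym (*-identityˡ _)
  product∣ (nz ∷ nzs) (co ∷ cos) (h ∷ hs) =
    coprime-∣* (coprime-sym nz (coprime-product co)) h (product∣ nzs cos hs)

  -- Splits a product at each factor in turn, with the rest coprime to that factor; this is the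
  -- passage between the ideal of Q and the ideals of the single hyperplanes.
  cofactors : ∀ {xs} → All NonZeroDivisor xs → AllPairs Coprime xs →
              All (λ d → ∃ λ e → product xs ≈ d * e × Coprime d e) xs
  cofactors []         []         = []
  cofactors {x ∷ xs} (nz ∷ nzs) (co ∷ cos) = (product xs , refl , coprime-product co) ∷
    All.zipWith (λ { {d} (co′ , e , eq , co″) → x * e ,
      trans (*-congˡ eq) (solve 3 (λ x d e → x :* (d :* e) := d :* (x :* e)) refl x d e) ,
      coprime-*ʳ (coprime-sym nz co′) co″ }) (co , cofactors nzs cos)

-- Newton interpolation over a commutative ring

module Interpolation {c ℓ} (S : CommutativeRing c ℓ) where
  open CommutativeRing S hiding (zero)
  open IntegerRingSolver S
  open Divisibility S
  open import Algebra.Properties.Semiring.Exp semiring using (_^_)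
  open import Algebra.Properties.Ring ring using (x∙y⁻¹≈ε⇒x≈y)
  open import Relation.Binary.Reasoning.Setoid setoid

  ∑< : ℕ → (ℕ → Carrier) → Carrier
  ∑< zero    f = 0#
  ∑< (suc n) f = f 0 + ∑< n (λ p → f (suc p))

  ∑<-cong : ∀ n {f g} → (∀ p → p ℕ.< n → f p ≈ g p) → ∑< n f ≈ ∑< n g
  ∑<-cong zero    e = refl
  ∑<-cong (suc n) e = +-cong (e 0 (ℕ.s≤s ℕ.z≤n)) (∑<-cong n (λ p l → e (suc p) (ℕ.s≤s l)))

  ∑<-zero : ∀ n {f} → (∀ p → p ℕ.< n → f p ≈ 0#) → ∑< n f ≈ 0#
  ∑<-zero zero    e = refl
  ∑<-zero (suc n) e = trans (+-cong (e 0 (ℕ.s≤s ℕ.z≤n)) (∑<-zero n (λ p l → e (suc p) (ℕ.s≤s l)))) (+-identityˡ 0#)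

  ∑<-+ : ∀ n f g → ∑< n (λ p → f p + g p) ≈ ∑< n f + ∑< n g
  ∑<-+ zero    f g = sym (+-identityˡ 0#)
  ∑<-+ (suc n) f g = trans (+-congˡ (∑<-+ n _ _))
    (solve 4 (λ a b c d → (a :+ b) :+ (c :+ d) := (a :+ c) :+ (b :+ d)) refl _ _ _ _)

  ∑<-* : ∀ n x f → ∑< n (λ p → x * f p) ≈ x * ∑< n f
  ∑<-* zero    x f = sym (zeroʳ x)
  ∑<-* (suc n) x f = trans (+-congˡ (∑<-* n x _)) (sym (distribˡ x _ _))

  ∑<-last : ∀ n f → ∑< (suc n) f ≈ ∑< n f + f n
  ∑<-last zero    f = +-comm _ _
  ∑<-last (suc n) f = trans (+-congˡ (∑<-last n (λ p → f (suc p)))) (sym (+-assoc _ _ _))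

  ∑<-swap : ∀ m n (f : ℕ → ℕ → Carrier) → ∑< m (λ p → ∑< n (f p)) ≈ ∑< n (λ q → ∑< m (λ p → f p q))
  ∑<-swap zero    n f = sym (∑<-zero n (λ _ _ → refl))
  ∑<-swap (suc m) n f = trans (+-congˡ (∑<-swap m n (λ p → f (suc p)))) (sym (∑<-+ n _ _))

  ∑<-square : ∀ n (f : ℕ → ℕ → Carrier) →
    ∑< n (λ p → ∑< n (f p)) ≈ ∑< n (λ p → ∑< p (λ q → f p q + f q p)) + ∑< n (λ p → f p p)
  ∑<-square zero    f = sym (+-identityˡ 0#)
  ∑<-square (suc n) f = begin
    ∑< (suc n) (λ p → ∑< (suc n) (f p))
      ≈⟨ ∑<-last n _ ⟩
    ∑< n (λ p → ∑< (suc n) (f p)) + ∑< (suc n) (f n)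
      ≈⟨ +-cong (trans (∑<-cong n (λ p _ → ∑<-last n (f p))) (∑<-+ n _ _)) (∑<-last n _) ⟩
    (∑< n (λ p → ∑< n (f p)) + ∑< n (λ p → f p n)) + (∑< n (f n) + f n n)
      ≈⟨ +-congʳ (+-congʳ (∑<-square n f)) ⟩
    ((T + D) + ∑< n (λ p → f p n)) + (∑< n (f n) + f n n)
      ≈⟨ solve 5 (λ t d a b e → ((t :+ d) :+ a) :+ (b :+ e) := (t :+ (b :+ a)) :+ (d :+ e)) refl T D _ _ _ ⟩
    (T + (∑< n (f n) + ∑< n (λ p → f p n))) + (D + f n n)
      ≈⟨ +-cong (+-congˡ (∑<-+ n _ _)) refl ⟨
    (T + ∑< n (λ q → f n q + f q n)) + (D + f n n)
      ≈⟨ +-cong (∑<-last n _) (∑<-last n _) ⟨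
    _ ∎
    where
    T = ∑< n (λ p → ∑< p (λ q → f p q + f q p))
    D = ∑< n (λ p → f p p)

  polynomial : ℕ → (ℕ → Carrier) → Carrier → Carrier
  polynomial n h t = ∑< n (λ p → h p * t ^ p)

  polynomial-cong : ∀ n {h k} t → (∀ p → p ℕ.< n → h p ≈ k p) → polynomial n h t ≈ polynomial n k t
  polynomial-cong n t e = ∑<-cong n (λ p l → *-congʳ (e p l))

  polynomial-suc : ∀ n h t → polynomial (suc n) h t ≈ h 0 + t * polynomial n (λ p → h (suc p)) t
  polynomial-suc n h t = +-cong (*-identityʳ _) (trans
    (∑<-cong n (λ p _ → solve 3 (λ h t x → h :* (t :* x) := t :* (h :* x)) refl (h (suc p)) t (t ^ p)))
    (∑<-* n t _))

  polynomial-+ : ∀ n h k t → polynomial n (λ p → h p + k p) t ≈ polynomial n h t + polynomial n k t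
  polynomial-+ n h k t = trans (∑<-cong n (λ p _ → distribʳ _ _ _)) (∑<-+ n _ _)

  polynomial-* : ∀ n x h t → polynomial n (λ p → x * h p) t ≈ x * polynomial n h t
  polynomial-* n x h t = trans (∑<-cong n (λ p _ → *-assoc _ _ _)) (∑<-* n x _)

  polynomial-difference : ∀ n h k t → polynomial n (λ p → h p - k p) t ≈ polynomial n h t - polynomial n k t
  polynomial-difference n h k t = begin
    polynomial n (λ p → h p - k p) t
      ≈⟨ polynomial-cong n t (λ p _ → solve 2 (λ x y → x :- y := x :+ (:- :1) :* y) refl (h p) (k p)) ⟩
    polynomial n (λ p → h p + - 1# * k p) t
      ≈⟨ polynomial-+ n h _ t ⟩
    polynomial n h t + polynomial n (λ p → - 1# * k p) t
      ≈⟨ +-congˡ (polynomial-* n (- 1#) k t) ⟩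
    polynomial n h t + - 1# * polynomial n k t
      ≈⟨ solve 2 (λ x y → x :- y := x :+ (:- :1) :* y) refl _ _ ⟨
    polynomial n h t - polynomial n k t ∎

  -- The coefficients of v + (t - c) h(t).
  extend : ℕ → Carrier → Carrier → (ℕ → Carrier) → ℕ → Carrier
  extend zero    v c h p       = v
  extend (suc n) v c h zero    = v - c * h 0
  extend (suc n) v c h (suc p) = extend n (h 0) c (λ q → h (suc q)) p

  extend-spec : ∀ n v c h t → polynomial (suc n) (extend n v c h) t ≈ v + (t - c) * polynomial n h t
  extend-spec zero    v c h t = begin
    v * 1# + 0#  ≈⟨ solve 3 (λ v t c → v :* :1 :+ :0 := v :+ (t :- c) :* :0) refl v t c ⟩
    v + (t - c) * 0#    ∎
  extend-spec (suc n) v c h t = begin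
    polynomial (suc (suc n)) (extend (suc n) v c h) t
      ≈⟨ polynomial-suc (suc n) (extend (suc n) v c h) t ⟩
    (v - c * h 0) + t * polynomial (suc n) (extend n (h 0) c h′) t
      ≈⟨ +-congˡ (*-congˡ (extend-spec n (h 0) c h′ t)) ⟩
    (v - c * h 0) + t * (h 0 + (t - c) * P)
      ≈⟨ solve 5 (λ v c h t P → (v :- c :* h) :+ t :* (h :+ (t :- c) :* P) := v :+ (t :- c) :* (h :+ t :* P))
        refl v c (h 0) t P ⟩
    v + (t - c) * (h 0 + t * P)
      ≈⟨ +-congˡ (*-congˡ (polynomial-suc n h t)) ⟨
    v + (t - c) * polynomial (suc n) h t ∎
    where
    h′ = λ q → h (suc q)
    P = polynomial n h′ t

  -- The coefficients of (h(t) - h(c)) / (t - c).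
  quotient : ℕ → Carrier → (ℕ → Carrier) → ℕ → Carrier
  quotient zero    c h p       = 0#
  quotient (suc n) c h zero    = polynomial (suc n) (λ q → h (suc q)) c
  quotient (suc n) c h (suc p) = quotient n c (λ q → h (suc q)) p

  quotient-spec : ∀ n c h t → polynomial (suc n) h t ≈ polynomial (suc n) h c + (t - c) * polynomial n
    (quotient n c h) t
  quotient-spec zero    c h t = solve 3 (λ h t c → h :* :1 :+ :0 := (h :* :1 :+ :0) :+ (t :- c) :* :0) refl (h 0) t c
  quotient-spec (suc n) c h t = begin
    polynomial (suc (suc n)) h t
      ≈⟨ polynomial-suc (suc n) h t ⟩
    h 0 + t * polynomial (suc n) h′ t
      ≈⟨ +-congˡ (*-congˡ (quotient-spec n c h′ t)) ⟩
    h 0 + t * (A + (t - c) * B)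
      ≈⟨ solve 5 (λ h t c A B → h :+ t :* (A :+ (t :- c) :* B) := (h :+ c :* A) :+ (t :- c) :* (A :+ t :* B))
        refl (h 0) t c A B ⟩
    (h 0 + c * A) + (t - c) * (A + t * B)
      ≈⟨ +-cong (polynomial-suc (suc n) h c) (*-congˡ (polynomial-suc n (quotient (suc n) c h) t)) ⟨
    polynomial (suc (suc n)) h c + (t - c) * polynomial (suc n) (quotient (suc n) c h) t ∎
    where
    h′ = λ q → h (suc q)
    A = polynomial (suc n) h′ c
    B = polynomial n (quotient n c h′) t

  -- With h(t) = h 0 + t h′(t), the constant term of the quotient is h′(c). Its vanishing is the
  -- root that the induction on h′ asks for, and the root of h itself then leaves h 0 = 0.
  quotient-injective : ∀ n c h → polynomial (suc n) h c ≈ 0# → (∀ p → p ℕ.< n → quotient n c h p ≈ 0#) →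
                       ∀ p → p ℕ.< suc n → h p ≈ 0#
  quotient-injective zero    c h root q≈0 zero l = trans (solve 1 (λ h → h := h :* :1 :+ :0) refl (h 0)) root
  quotient-injective zero    c h root q≈0 (suc p) (ℕ.s≤s ())
  quotient-injective (suc n) c h root q≈0 = λ where
      zero    l         → h0≈0
      (suc p) (ℕ.s≤s l) → h′≈0 p l
    where
    h′ = λ q → h (suc q)
    h′≈0 : ∀ p → p ℕ.< suc n → h′ p ≈ 0#
    h′≈0 = quotient-injective n c h′ (q≈0 0 (ℕ.s≤s ℕ.z≤n)) (λ p l → q≈0 (suc p) (ℕ.s≤s l))
    h0≈0 : h 0 ≈ 0#
    h0≈0 = begin
      h 0  ≈⟨ solve 2 (λ h c → h := h :+ c :* :0) refl (h 0) c ⟩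
      h 0 + c * 0#  ≈⟨ +-congˡ (*-congˡ (q≈0 0 (ℕ.s≤s ℕ.z≤n))) ⟨
      h 0 + c * polynomial (suc n) h′ c     ≈⟨ polynomial-suc (suc n) h c ⟨
      polynomial (suc (suc n)) h c  ≈⟨ root ⟩
      0#                                    ∎

  module _ {n : ℕ} (y : Fin n → Carrier) where

    Separated : Set _
    Separated = ∀ {a b} → a ≢ b → NonZeroDivisor (y a - y b)

    Compatible : (Fin n → Carrier) → Set _
    Compatible v = ∀ a b → y a - y b ∣ v a - v b

    -- The pair `(a , b)` is excluded in both orders, as only a unit is coprime to itself. Pairs
    -- that share just one index are included; Newton's scheme divides by exactly such differences.
    IndependentDifferences : Set _
    IndependentDifferences = ∀ {a b i j} → a ≢ b → i ≢ j → ¬ (i ≡ a × j ≡ b) → ¬ (i ≡ b × j ≡ a) →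
                             Coprime (y i - y j) (y a - y b)

  -- For the divided differences w at node 0, (y_a - y_0)(w_a - w_b) = (v_a - v_b) - (y_a - y_b)
  -- w_b. Since y_a - y_b is coprime to y_a - y_0, it divides w_a - w_b, so w is compatible at the
  -- remaining nodes.
  interpolate : ∀ {n} (y : Fin n → Carrier) → IndependentDifferences y →
                ∀ v → Compatible y v → ∃ λ h → ∀ a → v a ≈ polynomial n h (y a)
  interpolate {zero}  y ind v comp = (λ _ → 0#) , λ ()
  interpolate {suc n} y ind v comp = extend n (v zero) (y zero) h , λ a →
      trans (at a) (sym (extend-spec n (v zero) (y zero) h (y a)))
    where
    y′ : Fin n → Carrier
    y′ a = y (suc a)
    w : Fin n → Carrier
    w a = cofactor (comp (suc a) zero)
    w-eq : ∀ a → v (suc a) ≈ v zero + (y′ a - y zero) * w a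
    w-eq a = begin
      v (suc a)  ≈⟨ solve 2 (λ x z → x := z :+ (x :- z)) refl _ _ ⟩
      v zero + (v (suc a) - v zero)     ≈⟨ +-congˡ (equation (comp (suc a) zero)) ⟩
      v zero + (y′ a - y zero) * w a    ∎
    compatible′ : Compatible y′ w
    compatible′ a b with a Fin.≟ b
    ... | yes ≡.refl = ∣-respʳ (sym (-‿inverseʳ _)) (∣0 _)
    ... | no a≢b = ind (λ ()) (λ e → a≢b (Fin.suc-injective e)) (λ ()) (λ ()) (w a - w b)
      (∣-respʳ eq (∣-difference (comp (suc a) (suc b)) (w b , refl)))
      where
      eq : (v (suc a) - v (suc b)) - (y′ a - y′ b) * w b ≈ (y′ a - y zero) * (w a - w b)
      eq = trans (+-congʳ (+-cong (w-eq a) (-‿cong (w-eq b))))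
        (solve 6 (λ v a b z x y → ((v :+ (a :- z) :* x) :- (v :+ (b :- z) :* y)) :- (a :- b) :* y
                                    := (a :- z) :* (x :- y)) refl (v zero) (y′ a) (y′ b) (y zero) (w a) (w b))
    ih = interpolate y′ (λ a≢b i≢j ne ne′ → ind (λ e → a≢b (Fin.suc-injective e)) (λ e → i≢j (Fin.suc-injective e))
           (λ (e , f) → ne (Fin.suc-injective e , Fin.suc-injective f))
           (λ (e , f) → ne′ (Fin.suc-injective e , Fin.suc-injective f))) w compatible′
    h = proj₁ ih
    at : ∀ a → v a ≈ v zero + (y a - y zero) * polynomial n h (y a)
    at zero    = solve 3 (λ v y p → v := v :+ (y :- y) :* p) refl _ _ _
    at (suc a) = trans (w-eq a) (+-congˡ (*-congˡ (proj₂ ih a)))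

  -- Node 0 is a root and is divided out; at any other node y_a the factor y_a - y_0 cancels, so y_a
  -- is a root of the quotient.
  vandermonde-injective : ∀ {n} (y : Fin n → Carrier) → Separated y →
    ∀ h → (∀ a → polynomial n h (y a) ≈ 0#) → ∀ p → p ℕ.< n → h p ≈ 0#
  vandermonde-injective {suc n} y sep h roots = quotient-injective n (y zero) h (roots zero)
    (vandermonde-injective (λ a → y (suc a)) (λ a≢b → sep (λ e → a≢b (Fin.suc-injective e)))
      (quotient n (y zero) h) λ a → sep {suc a} {zero} (λ ()) _ (begin
        (y (suc a) - y zero) * polynomial n (quotient n (y zero) h) (y (suc a))
          ≈⟨ +-identityˡ _ ⟨
        0# + (y (suc a) - y zero) * polynomial n (quotient n (y zero) h) (y (suc a))
          ≈⟨ +-congʳ (roots zero) ⟨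
        polynomial (suc n) h (y zero) + (y (suc a) - y zero) * polynomial n (quotient n (y zero) h) (y (suc a))
          ≈⟨ quotient-spec n (y zero) h (y (suc a)) ⟨
        polynomial (suc n) h (y (suc a))
          ≈⟨ roots (suc a) ⟩
        0# ∎))

  bipolynomial : ℕ → (ℕ → ℕ → Carrier) → Carrier → Carrier → Carrier
  bipolynomial n G s t = ∑< n (λ p → ∑< n (λ q → G p q * (s ^ p * t ^ q)))

  bipolynomial-nested : ∀ n G s t → bipolynomial n G s t ≈ polynomial n (λ p → polynomial n (G p) t) s
  bipolynomial-nested n G s t = ∑<-cong n λ p _ → trans
    (trans (∑<-cong n (λ q _ → solve 3 (λ g x y → g :* (x :* y) := x :* (g :* y)) refl (G p q) (s ^ p) (t ^ q)))
           (∑<-* n _ _))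
    (*-comm _ _)

  module _ {n : ℕ} {y : Fin n → Carrier} (sep : Separated y) where

    bipolynomial-injective : ∀ G → (∀ a b → bipolynomial n G (y a) (y b) ≈ 0#) →
                             ∀ p q → p ℕ.< n → q ℕ.< n → G p q ≈ 0#
    bipolynomial-injective G zeros p q p<n q<n = vandermonde-injective y sep (G p)
      (λ b → vandermonde-injective y sep (λ p → polynomial n (G p) (y b))
        (λ a → trans (sym (bipolynomial-nested n G (y a) (y b))) (zeros a b)) p p<n) q q<n

    module _ (2-nzd : NonZeroDivisor (1# + 1#)) (ind : IndependentDifferences y) where

      antisymmetric-interpolation : (g : Fin n → Fin n → Carrier) →
        (∀ a b → g a b ≈ - g b a) → (∀ a → g a a ≈ 0#) → (∀ j → Compatible y (λ a → g a j)) →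
        ∃ λ G → (∀ a b → g a b ≈ bipolynomial n G (y a) (y b)) ×
                (∀ p q → p ℕ.< n → q ℕ.< n → G p q + G q p ≈ 0#) × (∀ p → p ℕ.< n → G p p ≈ 0#)
      antisymmetric-interpolation g anti diag comp = G , g-eq , G-anti , G-diag
        where
        H : Fin n → ℕ → Carrier
        H j = proj₁ (interpolate y ind (λ a → g a j) (comp j))
        H-eq : ∀ a j → g a j ≈ polynomial n (H j) (y a)
        H-eq a j = proj₂ (interpolate y ind (λ a → g a j) (comp j)) a
        -- The polynomial with coefficients H_a - H_b takes the value g_ia - g_ib = d k_i at y_i.
        -- With K interpolating k, the coefficients H_a - H_b - d K give zero at all nodes and hence
        -- vanish, so d divides H_a - H_b coefficient by coefficient.
        columns : ∀ a b p → p ℕ.< n → y a - y b ∣ H a p - H b p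
        columns a b with a Fin.≟ b
        ... | yes ≡.refl = λ p _ → ∣-respʳ (sym (-‿inverseʳ _)) (∣0 _)
        ... | no a≢b = λ p p<n → K p , x∙y⁻¹≈ε⇒x≈y _ _ (residual≈0 p p<n)
          where
          d = y a - y b
          transposed : ∀ i → g i a - g i b ≈ - (g a i - g b i)
          transposed i = trans (+-cong (anti i a) (-‿cong (anti i b)))
            (solve 2 (λ x y → :- x :- :- y := :- (x :- y)) refl _ _)
          row : ∀ i → d ∣ g i a - g i b
          row i = ∣-respʳ (sym (transposed i)) (∣- (comp i a b))
          k : Fin n → Carrier
          k i = cofactor (row i)
          k-eq : ∀ i → g i a - g i b ≈ d * k i
          k-eq i = equation (row i)
          ka≈kb : k a - k b ≈ 0#
          ka≈kb = sep a≢b _ (begin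
            d * (k a - k b)  ≈⟨ solve 3 (λ d x y → d :* (x :- y) := d :* x :- d :* y) refl d (k a) (k b) ⟩
            d * k a - d * k b  ≈⟨ +-cong (k-eq a) (-‿cong (k-eq b)) ⟨
            (g a a - g a b) - (g b a - g b b)    ≈⟨ +-cong (+-congʳ (diag a))
              (-‿cong (+-cong (anti b a) (-‿cong (diag b)))) ⟩
            (0# - g a b) - (- g a b - 0#)  ≈⟨ solve 1 (λ x → (:0 :- x) :- (:- x :- :0) := :0) refl (g a b) ⟩
            0#                                   ∎)
          -- Coprimality is of no use at the pair (a , b) itself, where antisymmetry gives k a ≈ k b.
          k-comp : Compatible y k
          k-comp i j with i Fin.≟ j | (i Fin.≟ a ×-dec j Fin.≟ b) | (i Fin.≟ b ×-dec j Fin.≟ a)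
          ... | yes ≡.refl | _ | _ = ∣-respʳ (sym (-‿inverseʳ _)) (∣0 _)
          ... | no _ | yes (≡.refl , ≡.refl) | _ = ∣-respʳ (sym ka≈kb) (∣0 _)
          ... | no _ | no _ | yes (≡.refl , ≡.refl) =
            ∣-respʳ (trans (-‿cong (sym ka≈kb)) (solve 2 (λ x y → :- (x :- y) := y :- x) refl _ _)) (∣- (∣0 _))
          ... | no i≢j | no ne | no ne′ = ind a≢b i≢j ne ne′ _ (∣-respʳ
            (begin
              (g i a - g j a) - (g i b - g j b)
                ≈⟨ solve 4 (λ p q r s → (p :- q) :- (r :- s) := (p :- r) :- (q :- s)) refl _ _ _ _ ⟩
              (g i a - g i b) - (g j a - g j b)
                ≈⟨ +-cong (k-eq i) (-‿cong (k-eq j)) ⟩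
              d * k i - d * k j
                ≈⟨ solve 3 (λ d x y → d :* (x :- y) := d :* x :- d :* y) refl d (k i) (k j) ⟨
              d * (k i - k j) ∎)
            (∣-difference (comp a i j) (comp b i j)))
          K : ∀ p → Carrier
          K = proj₁ (interpolate y ind k k-comp)
          residual≈0 : ∀ p → p ℕ.< n → (H a p - H b p) - d * K p ≈ 0#
          residual≈0 = vandermonde-injective y sep _ λ i → begin
            polynomial n (λ p → (H a p - H b p) - d * K p) (y i)
              ≈⟨ polynomial-difference n (λ p → H a p - H b p) (λ p → d * K p) (y i) ⟩
            polynomial n (λ p → H a p - H b p) (y i) - polynomial n (λ p → d * K p) (y i)
              ≈⟨ +-cong (polynomial-difference n (H a) (H b) (y i)) (-‿cong (polynomial-* n d K (y i))) ⟩
            (polynomial n (H a) (y i) - polynomial n (H b) (y i)) - d * polynomial n K (y i)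
              ≈⟨ +-cong (+-cong (H-eq i a) (-‿cong (H-eq i b)))
                (-‿cong (*-congˡ (proj₂ (interpolate y ind k k-comp) i))) ⟨
            (g i a - g i b) - d * k i
              ≈⟨ +-congʳ (k-eq i) ⟩
            d * k i - d * k i
              ≈⟨ -‿inverseʳ _ ⟩
            0# ∎
        -- `columns` speaks only of p < n. Beyond that bound zero is a harmless default, since no
        -- sum reaches it.
        coefficient : ∀ p → ∃ λ h → p ℕ.< n → ∀ a → H a p ≈ polynomial n h (y a)
        coefficient p with p ℕ.<? n
        ... | no p≮n = (λ _ → 0#) , λ p<n → contradiction p<n p≮n
        ... | yes p<n with interpolate y ind (λ a → H a p) (λ a b → columns a b p p<n)
        ... | h , eq = h , λ _ → eq
        G : ℕ → ℕ → Carrier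
        G p = proj₁ (coefficient p)
        g-eq : ∀ a b → g a b ≈ bipolynomial n G (y a) (y b)
        g-eq a b = trans (H-eq a b) (trans (polynomial-cong n (y a) (λ p p<n → proj₂ (coefficient p) p<n b))
          (sym (bipolynomial-nested n G (y a) (y b))))
        -- G plus its transpose represents g_ab + g_ba = 0 at every pair of nodes, and the values at
        -- the nodes determine the coefficients.
        G-anti : ∀ p q → p ℕ.< n → q ℕ.< n → G p q + G q p ≈ 0#
        G-anti = bipolynomial-injective _ λ a b → begin
          bipolynomial n (λ p q → G p q + G q p) (y a) (y b)
            ≈⟨ ∑<-cong n (λ p _ → trans (∑<-cong n (λ q _ → distribʳ _ _ _)) (∑<-+ n _ _)) ⟩
          ∑< n (λ p → ∑< n (λ q → G p q * (y a ^ p * y b ^ q)) + ∑< n (λ q → G q p * (y a ^ p * y b ^ q)))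
            ≈⟨ ∑<-+ n _ _ ⟩
          bipolynomial n G (y a) (y b) + ∑< n (λ p → ∑< n (λ q → G q p * (y a ^ p * y b ^ q)))
            ≈⟨ +-congˡ (trans (∑<-swap n n _) (∑<-cong n (λ q _ → ∑<-cong n λ p _ → *-congˡ (*-comm _ _)))) ⟩
          bipolynomial n G (y a) (y b) + bipolynomial n G (y b) (y a)
            ≈⟨ +-cong (g-eq a b) (g-eq b a) ⟨
          g a b + g b a
            ≈⟨ +-congʳ (anti a b) ⟩
          - g b a + g b a
            ≈⟨ -‿inverseˡ _ ⟩
          0# ∎
        -- On the diagonal, antisymmetry says only 2 G_pp = 0.
        G-diag : ∀ p → p ℕ.< n → G p p ≈ 0#
        G-diag p p<n = 2-nzd _ (trans (solve 1 (λ x → (:1 :+ :1) :* x := x :+ x) refl (G p p)) (G-anti p p p<n p<n))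

-- Sums and products over lists

module ListSums {c ℓ} (S : CommutativeRing c ℓ) where
  open CommutativeRing S hiding (zero)
  open IntegerRingSolver S

  -- The same folds as in `Operators`, over any ring, so that the lemmas apply definitionally to Q,
  -- to the generators and to the action of operators.
  ∑ ∏ : ∀ {a} {A : Set a} → List A → (A → Carrier) → Carrier
  ∑ xs f = List.foldr (λ x p → f x + p) 0# xs
  ∏ xs f = List.foldr (λ x p → f x * p) 1# xs

  module _ {a} {A : Set a} where

    ∑-cong-∈ : ∀ (xs : List A) {f g} → (∀ x → x ∈ xs → f x ≈ g x) → ∑ xs f ≈ ∑ xs g
    ∑-cong-∈ []       e = refl
    ∑-cong-∈ (x ∷ xs) e = +-cong (e x (here ≡.refl)) (∑-cong-∈ xs λ x x∈ → e x (there x∈))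

    ∑-cong : ∀ (xs : List A) {f g} → (∀ x → f x ≈ g x) → ∑ xs f ≈ ∑ xs g
    ∑-cong xs e = ∑-cong-∈ xs λ x _ → e x

    ∑-zero : ∀ (xs : List A) {f} → (∀ x → f x ≈ 0#) → ∑ xs f ≈ 0#
    ∑-zero []       e = refl
    ∑-zero (x ∷ xs) e = trans (+-cong (e x) (∑-zero xs e)) (+-identityˡ 0#)

    ∑-+ : ∀ (xs : List A) f g → ∑ xs (λ x → f x + g x) ≈ ∑ xs f + ∑ xs g
    ∑-+ []       f g = sym (+-identityˡ 0#)
    ∑-+ (x ∷ xs) f g = trans (+-congˡ (∑-+ xs f g))
      (solve 4 (λ a b c d → (a :+ b) :+ (c :+ d) := (a :+ c) :+ (b :+ d)) refl _ _ _ _)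

    ∑-* : ∀ (xs : List A) x f → ∑ xs (λ z → x * f z) ≈ x * ∑ xs f
    ∑-* []       x f = sym (zeroʳ x)
    ∑-* (z ∷ xs) x f = trans (+-congˡ (∑-* xs x f)) (sym (distribˡ x _ _))

    ∑-*ʳ : ∀ (xs : List A) x f → ∑ xs (λ z → f z * x) ≈ ∑ xs f * x
    ∑-*ʳ xs x f = trans (∑-cong xs λ z → *-comm (f z) x) (trans (∑-* xs x f) (*-comm x _))

    ∑-*-swap : ∀ (xs : List A) x (k f : A → Carrier) → x * ∑ xs (λ z → k z * f z) ≈ ∑ xs (λ z → k z * (x * f z))
    ∑-*-swap xs x k f = trans (sym (∑-* xs x _))
      (∑-cong xs λ z → solve 3 (λ x k f → x :* (k :* f) := k :* (x :* f)) refl x (k z) (f z))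

    ∑-++ : ∀ (xs ys : List A) f → ∑ (xs ++ ys) f ≈ ∑ xs f + ∑ ys f
    ∑-++ []       ys f = sym (+-identityˡ _)
    ∑-++ (x ∷ xs) ys f = trans (+-congˡ (∑-++ xs ys f)) (sym (+-assoc _ _ _))

    ∏-cong : ∀ (xs : List A) {f g} → (∀ x → f x ≈ g x) → ∏ xs f ≈ ∏ xs g
    ∏-cong []       e = refl
    ∏-cong (x ∷ xs) e = *-cong (e x) (∏-cong xs e)

    ∏-* : ∀ (xs : List A) f g → ∏ xs (λ x → f x * g x) ≈ ∏ xs f * ∏ xs g
    ∏-* []       f g = sym (*-identityˡ _)
    ∏-* (x ∷ xs) f g = trans (*-congˡ (∏-* xs f g))
      (solve 4 (λ a b c d → (a :* b) :* (c :* d) := (a :* c) :* (b :* d)) refl _ _ _ _)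

  module _ {a b} {A : Set a} {B : Set b} where

    ∑-map : ∀ (k : A → B) xs f → ∑ (List.map k xs) f ≡ ∑ xs (λ x → f (k x))
    ∑-map k []       f = ≡.refl
    ∑-map k (x ∷ xs) f = ≡.cong (f (k x) +_) (∑-map k xs f)

    ∑-concatMap : ∀ (k : A → List B) xs f → ∑ (List.concatMap k xs) f ≈ ∑ xs (λ x → ∑ (k x) f)
    ∑-concatMap k []       f = refl
    ∑-concatMap k (x ∷ xs) f = trans (∑-++ (k x) _ f) (+-congˡ (∑-concatMap k xs f))

  ∑-tabulate-single : ∀ {a} {A : Set a} {n} (k : Fin n → A) i {f} → (∀ j → j ≢ i → f (k j) ≈ 0#) →
                      ∑ (List.tabulate k) f ≈ f (k i)
  ∑-tabulate-single k zero    {f} e = trans (+-congˡ (rest _ λ j → e (suc j) λ ())) (+-identityʳ _)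
    where
    rest : ∀ {n} (k′ : Fin n → _) → (∀ j → f (k′ j) ≈ 0#) → ∑ (List.tabulate k′) f ≈ 0#
    rest {zero}  k′ e′ = refl
    rest {suc n} k′ e′ = trans (+-cong (e′ zero) (rest (λ j → k′ (suc j)) λ j → e′ (suc j))) (+-identityˡ 0#)
  ∑-tabulate-single k (suc i) e = trans
    (+-cong (e zero λ ()) (∑-tabulate-single (λ j → k (suc j)) i λ j j≢i → e (suc j) λ eq → j≢i
      (Fin.suc-injective eq)))
    (+-identityˡ _)

  ∑-allFin-single : ∀ {n} (i : Fin n) {f} → (∀ j → j ≢ i → f j ≈ 0#) → ∑ (List.allFin n) f ≈ f i
  ∑-allFin-single i e = ∑-tabulate-single (λ j → j) i e

  open Interpolation S using (∑<)

  ∑-applyUpTo : ∀ {a} {A : Set a} (k : ℕ → A) n f → ∑ (List.applyUpTo k n) f ≡ ∑< n (λ p → f (k p))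
  ∑-applyUpTo k zero    f = ≡.refl
  ∑-applyUpTo k (suc n) f = ≡.cong (f (k 0) +_) (∑-applyUpTo (λ p → k (suc p)) n f)

-- Schur polynomials in two variables as interpolants

pairsBelow : ℕ → List (Vec ℕ 2)
pairsBelow λ₁ = List.map (λ λ₂ → λ₁ ∷ λ₂ ∷ []) (List.upTo (suc λ₁))

∈Λ⁻ : ∀ {ℓ λ₁ λ₂} → (λ₁ ∷ λ₂ ∷ []) ∈ Λ ℓ → suc λ₁ ℕ.< ℓ × λ₂ ℕ.≤ λ₁
∈Λ⁻ {ℓ} μ∈ with Membership.∈-concat⁻′ (List.map pairsBelow (List.upTo (ℓ ℕ.∸ 1))) μ∈
... | _ , μ∈row , row∈ with Membership.∈-map⁻ pairsBelow row∈
... | λ₁ , λ₁∈ , ≡.refl with Membership.∈-map⁻ (λ λ₂ → λ₁ ∷ λ₂ ∷ []) μ∈row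
... | λ₂ , λ₂∈ , ≡.refl = suc< ℓ (Membership.∈-upTo⁻ λ₁∈) , ℕ.s≤s⁻¹ (Membership.∈-upTo⁻ λ₂∈)
  where
  suc< : ∀ ℓ {i} → i ℕ.< ℓ ℕ.∸ 1 → suc i ℕ.< ℓ
  suc< (suc ℓ) l = ℕ.s≤s l

module SchurInterpolation {c ℓ} (S : CommutativeRing c ℓ) where
  open CommutativeRing S hiding (zero)
  open IntegerRingSolver S
  open Divisibility S
  open Interpolation S
  open ListSums S
  open AntisymmetricQuotient S using (h; h-spec) renaming (g to dividedPower)
  open import Algebra.Properties.Ring ring using (-0#≈0#)
  open import Algebra.Properties.Semiring.Exp semiring using (_^_)
  open import Relation.Binary.Reasoning.Setoid setoid

  -- The summands 1 and 0 are the shifts m - j for m = 2, left unsimplified so that this agrees with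
  -- the quotient chosen in `Schur.existsᴬ`, read over another ring.
  schur : Carrier → Carrier → Vec ℕ 2 → Carrier
  schur s t (λ₁ ∷ λ₂ ∷ []) = h s t (λ₁ ℕ.+ 1) (λ₂ ℕ.+ 0)

  ∑-Λ : ∀ n f → ∑ (Λ n) f ≈ ∑< (n ℕ.∸ 1) (λ λ₁ → ∑< (suc λ₁) (λ λ₂ → f (λ₁ ∷ λ₂ ∷ [])))
  ∑-Λ n f = begin
    ∑ (Λ n) f
      ≈⟨ ∑-concatMap pairsBelow (List.upTo (n ℕ.∸ 1)) f ⟩
    ∑ (List.upTo (n ℕ.∸ 1)) (λ λ₁ → ∑ (pairsBelow λ₁) f)
      ≈⟨ ∑-cong (List.upTo (n ℕ.∸ 1)) (λ λ₁ → reflexive (≡.trans (∑-map _ (List.upTo (suc λ₁)) f)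
        (∑-applyUpTo (λ z → z) (suc λ₁) _))) ⟩
    ∑ (List.upTo (n ℕ.∸ 1)) (λ λ₁ → ∑< (suc λ₁) (λ λ₂ → f (λ₁ ∷ λ₂ ∷ [])))
      ≡⟨ ∑-applyUpTo (λ z → z) (n ℕ.∸ 1) _ ⟩
    ∑< (n ℕ.∸ 1) (λ λ₁ → ∑< (suc λ₁) (λ λ₂ → f (λ₁ ∷ λ₂ ∷ []))) ∎

  -- The substitution p = λ₁ + 1, q = λ₂ identifies `Λ n` with the strict triangle n > p > q.
  coefficientΛ : (ℕ → ℕ → Carrier) → Vec ℕ 2 → Carrier
  coefficientΛ K (λ₁ ∷ λ₂ ∷ []) = K (suc λ₁) λ₂

  triangle : ∀ n K s t →
    ∑< n (λ p → ∑< p (λ q → K p q * (s ^ p * t ^ q - s ^ q * t ^ p))) ≈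
    ∑ (Λ n) (λ μ → coefficientΛ K μ * schur s t μ) * (s - t)
  triangle n K s t = sym (begin
    ∑ (Λ n) (λ μ → coefficientΛ K μ * schur s t μ) * (s - t)
      ≈⟨ ∑-*ʳ (Λ n) (s - t) _ ⟨
    ∑ (Λ n) (λ μ → coefficientΛ K μ * schur s t μ * (s - t))
      ≈⟨ ∑-Λ n _ ⟩
    ∑< (n ℕ.∸ 1) (λ λ₁ → ∑< (suc λ₁) (λ λ₂ → K (suc λ₁) λ₂ * h s t (λ₁ ℕ.+ 1) (λ₂ ℕ.+ 0) * (s - t)))
      ≈⟨ ∑<-cong (n ℕ.∸ 1) (λ λ₁ _ → ∑<-cong (suc λ₁) λ λ₂ _ → trans (*-assoc (K (suc λ₁) λ₂) _ _)
        (*-congˡ {K (suc λ₁) λ₂} (term λ₁ λ₂))) ⟩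
    ∑< (n ℕ.∸ 1) (λ λ₁ → ∑< (suc λ₁) (λ λ₂ → φ (suc λ₁) λ₂))
      ≈⟨ shift n ⟩
    ∑< n (λ p → ∑< p (φ p)) ∎)
    where
    φ : ℕ → ℕ → Carrier
    φ p q = K p q * (s ^ p * t ^ q - s ^ q * t ^ p)
    term : ∀ λ₁ λ₂ → h s t (λ₁ ℕ.+ 1) (λ₂ ℕ.+ 0) * (s - t) ≈ s ^ suc λ₁ * t ^ λ₂ - s ^ λ₂ * t ^ suc λ₁
    term λ₁ λ₂ = trans (h-spec s t (λ₁ ℕ.+ 1) (λ₂ ℕ.+ 0))
      (reflexive (≡.cong₂ (λ p q → s ^ p * t ^ q - s ^ q * t ^ p) (ℕ.+-comm λ₁ 1) (ℕ.+-identityʳ λ₂)))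
    -- Row p = 0 of the strict triangle is empty, which accounts for `n ∸ 1` rows, also when n = 0.
    shift : ∀ n → ∑< (n ℕ.∸ 1) (λ λ₁ → ∑< (suc λ₁) (φ (suc λ₁))) ≈ ∑< n (λ p → ∑< p (φ p))
    shift zero    = refl
    shift (suc n) = sym (+-identityˡ _)

  -- Antisymmetry joins the monomials s^p t^q and s^q t^p into a 2 × 2 determinant, the numerator of
  -- a Schur polynomial.
  alternating : ∀ n G s t → (∀ p q → p ℕ.< n → q ℕ.< n → G p q + G q p ≈ 0#) → (∀ p → p ℕ.< n → G p p ≈ 0#) →
    bipolynomial n G s t ≈ ∑ (Λ n) (λ μ → coefficientΛ G μ * schur s t μ) * (s - t)
  alternating n G s t anti diag = begin
    bipolynomial n G s t
      ≈⟨ ∑<-square n (λ p q → G p q * (s ^ p * t ^ q)) ⟩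
    ∑< n (λ p → ∑< p (λ q → G p q * (s ^ p * t ^ q) + G q p * (s ^ q * t ^ p))) + ∑< n (λ p → G p p * (s ^ p * t ^ p))
      ≈⟨ +-cong (∑<-cong n λ p p<n → ∑<-cong p λ q q<p → pair p q (anti p q p<n (ℕ.<-trans q<p p<n)))
                (∑<-zero n λ p p<n → trans (*-congʳ (diag p p<n)) (zeroˡ _)) ⟩
    ∑< n (λ p → ∑< p (λ q → G p q * (s ^ p * t ^ q - s ^ q * t ^ p))) + 0#
      ≈⟨ trans (+-identityʳ _) (triangle n G s t) ⟩
    ∑ (Λ n) (λ μ → coefficientΛ G μ * schur s t μ) * (s - t) ∎
    where
    pair : ∀ p q → G p q + G q p ≈ 0# →
           G p q * (s ^ p * t ^ q) + G q p * (s ^ q * t ^ p) ≈ G p q * (s ^ p * t ^ q - s ^ q * t ^ p)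
    pair p q e = begin
      G p q * (s ^ p * t ^ q) + G q p * (s ^ q * t ^ p)
        ≈⟨ solve 4 (λ g g′ x y → g :* x :+ g′ :* y := g :* (x :- y) :+ (g :+ g′) :* y) refl (G p q) (G q p) _ _ ⟩
      G p q * (s ^ p * t ^ q - s ^ q * t ^ p) + (G p q + G q p) * (s ^ q * t ^ p)
        ≈⟨ +-congˡ (trans (*-congʳ e) (zeroˡ _)) ⟩
      G p q * (s ^ p * t ^ q - s ^ q * t ^ p) + 0#
        ≈⟨ +-identityʳ _ ⟩
      G p q * (s ^ p * t ^ q - s ^ q * t ^ p) ∎

  module _ {n : ℕ} {y : Fin n → Carrier} (sep : Separated y) where

    -- The conditions on f avoid the diagonal, since (y_a - y_b) f_ab vanishes there and the
    -- compatibility at j = a or j = b is automatic. This leaves type B free to choose f_aa, where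
    -- its division is impossible.
    schur-spans : NonZeroDivisor (1# + 1#) → IndependentDifferences y →
      (f : Fin n → Fin n → Carrier) → (∀ {a b} → a ≢ b → f a b ≈ f b a) →
      (∀ {a b j} → a ≢ b → a ≢ j → b ≢ j → y a - y b ∣ f a j - f b j) →
      ∃ λ k → ∀ {a b} → a ≢ b → f a b ≈ ∑ (Λ n) (λ μ → k μ * schur (y a) (y b) μ)
    schur-spans 2-nzd ind f f-sym rows = coefficientΛ G , λ {a} {b} a≢b → nzd-cancel (sep a≢b) (begin
      (y a - y b) * f a b
        ≈⟨ proj₁ (proj₂ result) a b ⟩
      bipolynomial n G (y a) (y b)
        ≈⟨ alternating n G (y a) (y b) (proj₁ (proj₂ (proj₂ result))) (proj₂ (proj₂ (proj₂ result))) ⟩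
      ∑ (Λ n) (λ μ → coefficientΛ G μ * schur (y a) (y b) μ) * (y a - y b)
        ≈⟨ *-comm _ _ ⟩
      (y a - y b) * ∑ (Λ n) (λ μ → coefficientΛ G μ * schur (y a) (y b) μ) ∎)
      where
      g : Fin n → Fin n → Carrier
      g a b = (y a - y b) * f a b
      diag : ∀ a → g a a ≈ 0#
      diag a = solve 2 (λ y x → (y :- y) :* x := :0) refl (y a) (f a a)
      anti : ∀ a b → g a b ≈ - g b a
      anti a b with a Fin.≟ b
      ... | yes ≡.refl = trans (diag a) (trans (sym -0#≈0#) (-‿cong (sym (diag a))))
      ... | no a≢b = trans (*-congˡ (f-sym a≢b))
        (solve 3 (λ y z x → (y :- z) :* x := :- ((z :- y) :* x)) refl (y a) (y b) (f b a))
      compatible : ∀ j → Compatible y (λ a → g a j)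
      compatible j a b with a Fin.≟ b | a Fin.≟ j | b Fin.≟ j
      ... | yes ≡.refl | _ | _ = ∣-respʳ (sym (-‿inverseʳ _)) (∣0 _)
      ... | no _ | yes ≡.refl | _ = f b a ,
        solve 4 (λ y z x w → (y :- y) :* x :- (z :- y) :* w := (y :- z) :* w) refl (y a) (y b) (f a a) (f b a)
      ... | no _ | no _ | yes ≡.refl = f a b ,
        solve 4 (λ y z x w → (y :- z) :* x :- (z :- z) :* w := (y :- z) :* x) refl (y a) (y b) (f a b) (f b b)
      ... | no a≢b | no a≢j | no b≢j = ∣-respʳ
        (solve 5 (λ y z w u v → (y :- w) :* (u :- v) :+ (y :- z) :* v := (y :- w) :* u :- (z :- w) :* v)
          refl (y a) (y b) (y j) (f a j) (f b j))
        (∣+ (∣*ˡ _ (rows a≢b a≢j b≢j)) (f b j , refl))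
      result = antisymmetric-interpolation sep 2-nzd ind g anti diag compatible
      G = proj₁ result

    -- The family k is extended antisymmetrically to a full coefficient matrix. Its two-variable
    -- polynomial vanishes at all pairs of nodes, those with a = b included because of the factor
    -- y_a - y_b, so the matrix is zero.
    schur-independent : ∀ (k : Vec ℕ 2 → Carrier) → (∀ {a b} → a ≢ b → ∑ (Λ n) (λ μ → k μ * schur (y a) (y b) μ)
      ≈ 0#) →
                        ∀ μ → μ ∈ Λ n → k μ ≈ 0#
    schur-independent k zeros μ@(λ₁ ∷ λ₂ ∷ []) μ∈ = begin
      k μ  ≈⟨ G-below (suc λ₁) λ₂ (ℕ.s≤s λ₂≤λ₁) ⟨
      G (suc λ₁) λ₂    ≈⟨ bipolynomial-injective sep G vanishes (suc λ₁) λ₂ λ₁<n (ℕ.<-trans (ℕ.s≤s λ₂≤λ₁) λ₁<n) ⟩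
      0#               ∎
      where
      λ₁<n = proj₁ (∈Λ⁻ {n} μ∈)
      λ₂≤λ₁ = proj₂ (∈Λ⁻ {n} μ∈)
      -- `pred` undoes the shift p = λ₁ + 1; K is read only where q < p, so its value at p = 0 does
      -- not matter.
      K : ℕ → ℕ → Carrier
      K p q = k (ℕ.pred p ∷ q ∷ [])
      G : ℕ → ℕ → Carrier
      G p q with q ℕ.<? p | p ℕ.<? q
      ... | yes _ | _     = K p q
      ... | no  _ | yes _ = - K q p
      ... | no  _ | no  _ = 0#
      G-below : ∀ p q → q ℕ.< p → G p q ≈ K p q
      G-below p q q<p with q ℕ.<? p
      ... | yes _ = refl
      ... | no q≮p = contradiction q<p q≮p
      G-anti : ∀ p q → G p q + G q p ≈ 0#
      G-anti p q with q ℕ.<? p | p ℕ.<? q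
      ... | yes l | yes l′ = contradiction l (ℕ.<-asym l′)
      ... | yes _ | no  _ = -‿inverseʳ _
      ... | no  _ | yes _ = -‿inverseˡ _
      ... | no  _ | no  _ = +-identityˡ _
      G-diag : ∀ p → G p p ≈ 0#
      G-diag p with p ℕ.<? p
      ... | yes l = contradiction l (ℕ.<-irrefl ≡.refl)
      ... | no  _ = refl
      coefficient-G : ∀ μ → μ ∈ Λ n → coefficientΛ G μ ≈ k μ
      coefficient-G (λ₁ ∷ λ₂ ∷ []) μ∈ = G-below (suc λ₁) λ₂ (ℕ.s≤s (proj₂ (∈Λ⁻ {n} μ∈)))
      vanishes : ∀ a b → bipolynomial n G (y a) (y b) ≈ 0#
      vanishes a b = trans (alternating n G (y a) (y b) (λ p q _ _ → G-anti p q) (λ p _ → G-diag p)) at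
        where
        at : ∑ (Λ n) (λ μ → coefficientΛ G μ * schur (y a) (y b) μ) * (y a - y b) ≈ 0#
        at with a Fin.≟ b
        ... | yes ≡.refl = trans (*-congˡ (-‿inverseʳ _)) (zeroʳ _)
        ... | no a≢b = trans (*-congʳ (trans
          (∑-cong-∈ (Λ n) λ μ μ∈ → *-congʳ (coefficient-G μ μ∈)) (zeros a≢b))) (zeroˡ _)

  -- Exchanging s and t changes the sign of both the numerator and the denominator.
  h-sym : ∀ {s t} p q → NonZeroDivisor (s - t) → h s t p q ≈ h t s p q
  h-sym {s} {t} p q nz = nzd-cancel nz (begin
    (s - t) * h s t p q  ≈⟨ trans (*-comm _ _) (h-spec s t p q) ⟩
    s ^ p * t ^ q - s ^ q * t ^ p  ≈⟨ solve 4 (λ x y z w → x :* y :- z :* w := :- (w :* z :- y :* x)) refl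
      (s ^ p) (t ^ q) (s ^ q) (t ^ p) ⟩
    - (t ^ p * s ^ q - t ^ q * s ^ p)    ≈⟨ -‿cong (h-spec t s p q) ⟨
    - (h t s p q * (t - s))  ≈⟨ solve 3 (λ x s t → :- (x :* (t :- s)) := (s :- t) :* x) refl (h t s p q) s t ⟩
    (s - t) * h t s p q                  ∎)

  schur-sym : ∀ {s t} μ → NonZeroDivisor (s - t) → schur s t μ ≈ schur t s μ
  schur-sym (λ₁ ∷ λ₂ ∷ []) = h-sym (λ₁ ℕ.+ 1) (λ₂ ℕ.+ 0)

  dividedPower-difference : ∀ s t u p → s - t ∣ dividedPower s u p - dividedPower t u p
  dividedPower-difference s t u zero    = ∣-respʳ (sym (-‿inverseʳ 0#)) (∣0 _)
  dividedPower-difference s t u (suc p) = ∣-respʳ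
    (solve 5 (λ s t a b v → s :* (a :- b) :+ (s :- t) :* b := (s :* a :+ v) :- (t :* b :+ v)) refl s t
      (dividedPower s u p) (dividedPower t u p) (u ^ p))
    (∣+ (∣*ˡ s (dividedPower-difference s t u p)) (dividedPower t u p , refl))

  h-difference : ∀ s t u p q → s - t ∣ h s u p q - h t u p q
  h-difference s t u p       zero    = dividedPower-difference s t u p
  h-difference s t u zero    (suc q) = ∣-respʳ (solve 2 (λ a b → :- (a :- b) := :- a :- :- b) refl _ _)
    (∣- (dividedPower-difference s t u (suc q)))
  h-difference s t u (suc p) (suc q) = ∣-respʳ
    (solve 5 (λ s t u a b → s :* u :* (a :- b) :+ (s :- t) :* (u :* b) := s :* u :* a :- t :* u :* b) refl s t u
      (h s u p q) (h t u p q))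
    (∣+ (∣*ˡ (s * u) (h-difference s t u p q)) (u * h t u p q , refl))

  -- A polynomial takes congruent values at arguments congruent modulo s - t; this puts the
  -- operators θ_λ into the module.
  schur-difference : ∀ s t u μ → s - t ∣ schur s u μ - schur t u μ
  schur-difference s t u (λ₁ ∷ λ₂ ∷ []) = h-difference s t u (λ₁ ℕ.+ 1) (λ₂ ℕ.+ 0)

-- Polynomial rings: coefficients, derivatives, linear forms

unit : ∀ {n} → Fin n → Vec ℕ n
unit {n} i = Vec.replicate n 0 Vec.[ i ]≔ 1

lookup-unit : ∀ {n} (i : Fin n) → Vec.lookup (unit i) i ≡ 1
lookup-unit {n} i = Vec.lookup∘updateAt i (Vec.replicate n 0)

lookup-unit-≢ : ∀ {n} {i j : Fin n} → i ≢ j → Vec.lookup (unit j) i ≡ 0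
lookup-unit-≢ {n} {i} {j} i≢j = ≡.trans (Vec.lookup∘update′ i≢j (Vec.replicate n 0) 1) (Vec.lookup-replicate i 0)

split-unit : ∀ {n} (α : Vec ℕ n) (i : Fin n) m → Vec.lookup α i ≡ suc m →
  ∃ λ β → α ≡ Vec.zipWith ℕ._+_ (unit i) β × Vec.lookup β i ≡ m × Vec.sum α ≡ suc (Vec.sum β)
split-unit (a ∷ α) zero    m ≡.refl = m ∷ α ,
  ≡.cong (_∷_ (suc m)) (≡.sym (Vec.zipWith-identityˡ ℕ.+-identityˡ α)) , ≡.refl , ≡.refl
split-unit (a ∷ α) (suc i) m e with split-unit α i m e
... | β , eq , eq′ , eq″ = a ∷ β , ≡.cong (a ∷_) eq , eq′ , ≡.trans (≡.cong (a ℕ.+_) eq″) (ℕ.+-suc a _)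

0ᵉ⊎positive : ∀ {n} (α : Vec ℕ n) → α ≡ Vec.replicate n 0 ⊎ ∃ λ i → ∃ λ m → Vec.lookup α i ≡ suc m
0ᵉ⊎positive []          = inj₁ ≡.refl
0ᵉ⊎positive (suc a ∷ α) = inj₂ (zero , a , ≡.refl)
0ᵉ⊎positive (zero ∷ α) with 0ᵉ⊎positive α
... | inj₁ eq          = inj₁ (≡.cong (0 ∷_) eq)
... | inj₂ (i , m , e) = inj₂ (suc i , m , e)

lookup-+ : ∀ {n} (α β : Vec ℕ n) i → Vec.lookup (Vec.zipWith ℕ._+_ α β) i ≡ Vec.lookup α i ℕ.+ Vec.lookup β i
lookup-+ α β i = Vec.lookup-zipWith ℕ._+_ i α β

+ᵛ-cancelˡ : ∀ {n} (α β γ : Vec ℕ n) → Vec.zipWith ℕ._+_ α β ≡ Vec.zipWith ℕ._+_ α γ → β ≡ γ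
+ᵛ-cancelˡ []      []      []      e = ≡.refl
+ᵛ-cancelˡ (a ∷ α) (b ∷ β) (c ∷ γ) e = ≡.cong₂ _∷_
  (ℕ.+-cancelˡ-≡ a b c (Vec.∷-injectiveˡ e)) (+ᵛ-cancelˡ α β γ (Vec.∷-injectiveʳ e))

module PolynomialProperties {r ℓr} (R : CommutativeRing r ℓr) (n : ℕ) where
  open Polynomials R n
  private
    module R where
      open CommutativeRing R public
      open import Algebra.Properties.Semiring.Mult (CommutativeRing.semiring R) public
        using (×-homo-+; ×-comm-*; ×-assoc-*; ×-homo-1) renaming (_×_ to _·_)
      open IntegerRingSolver R public
  open CommutativeRing polynomialRing hiding (zero)
  open IntegerRingSolver polynomialRing
  open Divisibility polynomialRing

  coeff-+ : ∀ f g β → coeff (f + g) β R.≈ coeff f β R.+ coeff g β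
  coeff-+ f g β = R.trans (coeff-L (f + g) β) (R.trans (L-++ f g (δ β))
    (R.+-cong (R.sym (coeff-L f β)) (R.sym (coeff-L g β))))

  term-cong : ∀ {c d α} → c R.≈ d → List.[ c , α ] ≈ List.[ d , α ]
  term-cong {c} {d} {α} e = mk≈ᴾ λ β → R.+-congʳ (cong-if (does (α ≟ᵉ β)))
    where
    cong-if : ∀ b → (if b then c else R.0#) R.≈ (if b then d else R.0#)
    cong-if true  = e
    cong-if false = R.refl

  C-cong : ∀ {c d} → c R.≈ d → C c ≈ C d
  C-cong = term-cong

  C-0 : C R.0# ≈ 0#
  C-0 = L⇒≈ᴾ λ φ → R.trans (R.+-congʳ (R.zeroˡ _)) (R.+-identityˡ _)

  C-+ : ∀ c d → C (c R.+ d) ≈ C c + C d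
  C-+ c d = L⇒≈ᴾ λ φ → R.solve 3 (λ c d x → (c R.:+ d) R.:* x R.:+ R.:0 R.:= c R.:* x R.:+ (d R.:* x R.:+ R.:0))
    R.refl c d (φ 0ᵉ)

  0ᵉ-+ : ∀ α → 0ᵉ +ᵉ α ≡ α
  0ᵉ-+ = Vec.zipWith-identityˡ ℕ.+-identityˡ

  C-* : ∀ c d → C (c R.* d) ≈ C c * C d
  C-* c d = reflexive (≡.cong (λ α → List.[ c R.* d , α ]) (≡.sym (0ᵉ-+ 0ᵉ)))

  C-neg : ∀ c → C (R.- c) ≈ - C c
  C-neg c = refl

  nzd-C : ∀ {u v} → u R.* v R.≈ R.1# → NonZeroDivisor (C u)
  nzd-C {u} {v} uv≈1 x eq = trans (sym (*-identityˡ x)) (trans (*-congʳ (trans (C-cong (R.sym uv≈1)) (C-* u v)))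
    (trans (solve 3 (λ u v x → (u :* v) :* x := v :* (u :* x)) refl (C u) (C v) x)
      (trans (*-congˡ {C v} eq) (zeroʳ (C v)))))

  module _ {p} (P : Poly → Set p) (P-resp : ∀ {f g} → f ≈ g → P f → P g) (P-C : ∀ c → P (C c)) (P-X : ∀ i → P (X i))
           (P-+ : ∀ {f g} → P f → P g → P (f + g)) (P-* : ∀ {f g} → P f → P g → P (f * g)) where

    private
      monomial : ∀ k c α → Vec.sum α ≡ k → P List.[ c , α ]
      monomial k c α e with 0ᵉ⊎positive α
      ... | inj₁ ≡.refl = P-C c
      monomial zero c α e | inj₂ (i , m , e′) with split-unit α i m e′
      ... | β , _ , _ , e″ with () ← ≡.trans (≡.sym e) e″
      monomial (suc k) c α e | inj₂ (i , m , e′) with split-unit α i m e′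
      ... | β , ≡.refl , _ , e″ = P-resp (term-cong (R.*-identityˡ c))
        (P-* (P-X i) (monomial k c β (ℕ.suc-injective (≡.trans (≡.sym e″) e))))

    polynomial-induction : ∀ f → P f
    polynomial-induction []            = P-resp C-0 (P-C R.0#)
    polynomial-induction ((c , α) ∷ f) = P-+ {List.[ c , α ]} {f} (monomial (Vec.sum α) c α ≡.refl)
      (polynomial-induction f)

  -- Derivatives

  L-∂ : ∀ i f φ → L (∂ i f) φ R.≈ L f (λ α → Vec.lookup α i R.· φ (α Vec.[ i ]%= ℕ.pred))
  L-∂ i []            φ = R.refl
  L-∂ i ((c , α) ∷ f) φ = R.+-cong
    (R.trans (R.×-assoc-* (Vec.lookup α i) c _) (R.sym (R.×-comm-* (Vec.lookup α i) c _))) (L-∂ i f φ)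

  ∂-cong : ∀ i {f g} → f ≈ g → ∂ i f ≈ ∂ i g
  ∂-cong i {f} {g} e = L⇒≈ᴾ λ φ → R.trans (L-∂ i f φ) (R.trans (≈ᴾ⇒L e _) (R.sym (L-∂ i g φ)))

  ∂-+ : ∀ i f g → ∂ i (f + g) ≈ ∂ i f + ∂ i g
  ∂-+ i f g = L⇒≈ᴾ λ φ → R.trans (L-∂ i (f + g) φ) (R.trans (L-++ f g _)
    (R.trans (R.+-cong (R.sym (L-∂ i f φ)) (R.sym (L-∂ i g φ))) (R.sym (L-++ (∂ i f) (∂ i g) φ))))

  -- When α_i = 0 the truncated predecessor lowers different summands on the two sides, but then
  -- both sides are the zeroth multiple.
  ·-pred-+ᵉ : ∀ {m} (φ : Vec ℕ m → R.Carrier) (i : Fin m) α β →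
    Vec.lookup α i R.· φ (Vec.zipWith ℕ._+_ α β Vec.[ i ]%= ℕ.pred) R.≈
    Vec.lookup α i R.· φ (Vec.zipWith ℕ._+_ (α Vec.[ i ]%= ℕ.pred) β)
  ·-pred-+ᵉ φ zero    (zero  ∷ α) (b ∷ β) = R.refl
  ·-pred-+ᵉ φ zero    (suc a ∷ α) (b ∷ β) = R.refl
  ·-pred-+ᵉ φ (suc i) (a ∷ α)     (b ∷ β) = ·-pred-+ᵉ (λ γ → φ (a ℕ.+ b ∷ γ)) i α β

  -- Tested against every functional `L _ φ`, the rule is the splitting of the exponent (α + β)_i
  -- into α_i and β_i.
  leibniz : ∀ i f g → ∂ i (f * g) ≈ ∂ i f * g + f * ∂ i g
  leibniz i f g = L⇒≈ᴾ λ φ → begin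
    L (∂ i (f * g)) φ
      ≈⟨ L-∂ i (f * g) φ ⟩
    L (f * g) (λ γ → Vec.lookup γ i R.· φ (γ Vec.[ i ]%= ℕ.pred))
      ≈⟨ L-*ᴾ f g _ ⟩
    L f (λ α → L g (λ β → Vec.lookup (α +ᵉ β) i R.· φ ((α +ᵉ β) Vec.[ i ]%= ℕ.pred)))
      ≈⟨ L-cong f (λ α → R.trans (L-cong g λ β → split φ α β) (L-+ g _ _)) ⟩
    L f (λ α → L g (λ β → Vec.lookup α i R.· φ ((α Vec.[ i ]%= ℕ.pred) +ᵉ β)) R.+
               L g (λ β → Vec.lookup β i R.· φ (α +ᵉ (β Vec.[ i ]%= ℕ.pred))))
      ≈⟨ L-+ f _ _ ⟩
    L f (λ α → L g (λ β → Vec.lookup α i R.· φ ((α Vec.[ i ]%= ℕ.pred) +ᵉ β))) R.+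
    L f (λ α → L g (λ β → Vec.lookup β i R.· φ (α +ᵉ (β Vec.[ i ]%= ℕ.pred))))
      ≈⟨ R.+-cong (L-cong f λ α → L-· g (Vec.lookup α i) _) (L-cong f λ α → R.sym (L-∂ i g _)) ⟩
    L f (λ α → Vec.lookup α i R.· L g (λ β → φ ((α Vec.[ i ]%= ℕ.pred) +ᵉ β))) R.+
    L f (λ α → L (∂ i g) (λ β → φ (α +ᵉ β)))
      ≈⟨ R.+-cong (R.trans (L-*ᴾ (∂ i f) g φ) (L-∂ i f _)) (L-*ᴾ f (∂ i g) φ) ⟨
    L (∂ i f * g) φ R.+ L (f * ∂ i g) φ
      ≈⟨ L-++ (∂ i f * g) (f * ∂ i g) φ ⟨
    L (∂ i f * g + f * ∂ i g) φ ∎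
    where
    open import Relation.Binary.Reasoning.Setoid R.setoid
    L-· : ∀ g k φ → L g (λ β → k R.· φ β) R.≈ k R.· L g φ
    L-· g zero    φ = L-zero g
    L-· g (suc k) φ = R.trans (L-+ g φ _) (R.+-congˡ (L-· g k φ))
    split : ∀ φ α β → Vec.lookup (α +ᵉ β) i R.· φ ((α +ᵉ β) Vec.[ i ]%= ℕ.pred) R.≈
      Vec.lookup α i R.· φ ((α Vec.[ i ]%= ℕ.pred) +ᵉ β) R.+ Vec.lookup β i R.· φ (α +ᵉ (β Vec.[ i ]%= ℕ.pred))
    split φ α β = begin
      Vec.lookup (α +ᵉ β) i R.· x
        ≡⟨ ≡.cong (R._· x) (lookup-+ α β i) ⟩
      (Vec.lookup α i ℕ.+ Vec.lookup β i) R.· x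
        ≈⟨ R.×-homo-+ x (Vec.lookup α i) (Vec.lookup β i) ⟩
      Vec.lookup α i R.· x R.+ Vec.lookup β i R.· x
        ≈⟨ R.+-cong (·-pred-+ᵉ φ i α β) (R.trans
             (R.reflexive (≡.cong (λ γ → Vec.lookup β i R.· φ (γ Vec.[ i ]%= ℕ.pred)) (+ᵉ-comm α β)))
             (R.trans (·-pred-+ᵉ φ i β α)
               (R.reflexive (≡.cong (λ γ → Vec.lookup β i R.· φ γ) (+ᵉ-comm (β Vec.[ i ]%= ℕ.pred) α))))) ⟩
      Vec.lookup α i R.· φ ((α Vec.[ i ]%= ℕ.pred) +ᵉ β) R.+ Vec.lookup β i R.· φ (α +ᵉ (β Vec.[ i ]%= ℕ.pred)) ∎
      where x = φ ((α +ᵉ β) Vec.[ i ]%= ℕ.pred)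

  ∂-C : ∀ i c → ∂ i (C c) ≈ 0#
  ∂-C i c = L⇒≈ᴾ λ φ → R.trans (L-∂ i (C c) φ) (R.trans (R.+-congʳ
    (R.trans (R.*-congˡ (R.reflexive (≡.cong (R._· φ (0ᵉ Vec.[ i ]%= ℕ.pred)) (Vec.lookup-replicate i 0))))
      (R.zeroʳ c)))
    (R.+-identityˡ _))

  ∂-X : ∀ i → ∂ i (X i) ≈ 1#
  ∂-X i = trans (term-cong (R.trans (R.reflexive (≡.cong (R._· R.1#) (lookup-unit i))) (R.×-homo-1 _)))
    (reflexive (≡.cong (λ α → List.[ R.1# , α ]) (≡.trans (Vec.updateAt-updateAt i 0ᵉ)
      (≡.trans (Vec.updateAt-cong i (λ _ → ≡.refl) 0ᵉ) (Vec.updateAt-id-local i 0ᵉ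
        (≡.sym (Vec.lookup-replicate i 0)))))))

  ∂-X-≢ : ∀ {i j} → i ≢ j → ∂ i (X j) ≈ 0#
  ∂-X-≢ {i} {j} i≢j = trans (term-cong (R.reflexive (≡.cong (R._· R.1#) (lookup-unit-≢ i≢j)))) C-0′
    where
    C-0′ : ∀ {α} → List.[ R.0# , α ] ≈ 0#
    C-0′ = L⇒≈ᴾ λ φ → R.trans (R.+-congʳ (R.zeroˡ _)) (R.+-identityˡ _)

  -- Linear forms with a unit coefficient

  L-X* : ∀ i f φ → L (X i * f) φ R.≈ L f (λ γ → φ (unit i +ᵉ γ))
  L-X* i f φ = R.trans (L-*ᴾ (X i) f φ) (R.trans (R.+-identityʳ _) (R.*-identityˡ _))

  coeff-C* : ∀ c f β → coeff (C c * f) β R.≈ c R.* coeff f β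
  coeff-C* c f β = R.trans (coeff-L (C c * f) β) (R.trans (L-*ᴾ (C c) f (δ β)) (R.trans (R.+-identityʳ _)
    (R.*-congˡ (R.trans (L-cong f λ γ → R.reflexive (≡.cong (δ β) (0ᵉ-+ γ))) (R.sym (coeff-L f β))))))

  coeff-X*-unit : ∀ i f β → coeff (X i * f) (unit i +ᵉ β) R.≈ coeff f β
  coeff-X*-unit i f β = R.trans (coeff-L (X i * f) _) (R.trans (L-X* i f (δ (unit i +ᵉ β))) (R.trans
    (L-cong f λ γ → R.reflexive (δ-shift γ)) (R.sym (coeff-L f β))))
    where
    δ-shift : ∀ γ → δ (unit i +ᵉ β) (unit i +ᵉ γ) ≡ δ β γ
    δ-shift γ with γ ≟ᵉ β
    ... | yes ≡.refl = ≡.cong (if_then R.1# else R.0#) (dec-true ((unit i +ᵉ γ) ≟ᵉ (unit i +ᵉ γ)) ≡.refl)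
    ... | no ¬e = ≡.cong (if_then R.1# else R.0#) (dec-false (_ ≟ᵉ _) (λ e → ¬e (+ᵛ-cancelˡ (unit i) γ β e)))

  coeff-X*-0 : ∀ i f β → Vec.lookup β i ≡ 0 → coeff (X i * f) β R.≈ R.0#
  coeff-X*-0 i f β e = R.trans (coeff-L (X i * f) β) (R.trans (L-X* i f (δ β)) (R.trans
    (L-cong f λ γ → R.reflexive (≡.cong (if_then R.1# else R.0#) (dec-false (_ ≟ᵉ _) (differ γ)))) (L-zero f)))
    where
    differ : ∀ γ → unit i +ᵉ γ ≢ β
    differ γ ≡.refl with () ← ≡.trans (≡.sym (≡.trans (lookup-+ (unit i) γ i)
      (≡.cong (ℕ._+ Vec.lookup γ i) (lookup-unit i)))) e

  -- The coefficient of x_p x^γ in (u x_p + v x_q) f is u f_γ plus v times a coefficient of f at an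
  -- exponent which contains x_q one time less.
  nzd-linear : ∀ {u u′ v p q} → u R.* u′ R.≈ R.1# → p ≢ q → NonZeroDivisor (C u * X p + C v * X q)
  nzd-linear {u} {u′} {v} {p} {q} uu′ p≢q f eq = mk≈ᴾ λ γ → vanish (Vec.lookup γ q) γ ≡.refl
    where
    open import Relation.Binary.Reasoning.Setoid R.setoid
    at : ∀ β → u R.* coeff (X p * f) β R.+ v R.* coeff (X q * f) β R.≈ R.0#
    at β = begin
      u R.* coeff (X p * f) β R.+ v R.* coeff (X q * f) β
        ≈⟨ R.+-cong (coeff-C* u (X p * f) β) (coeff-C* v (X q * f) β) ⟨
      coeff (C u * (X p * f)) β R.+ coeff (C v * (X q * f)) β
        ≈⟨ coeff-+ (C u * (X p * f)) (C v * (X q * f)) β ⟨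
      coeff (C u * (X p * f) + C v * (X q * f)) β
        ≈⟨ _≈ᴾ_.coeff-≈ (trans (solve 5 (λ u v x y f → u :* (x :* f) :+ v :* (y :* f) := (u :* x :+ v :* y) :* f)
             refl (C u) (C v) (X p) (X q) f) eq) β ⟩
      R.0# ∎
    reduce : ∀ γ → coeff (X q * f) (unit p +ᵉ γ) R.≈ R.0# → coeff f γ R.≈ R.0#
    reduce γ e = begin
      coeff f γ  ≈⟨ R.*-identityˡ _ ⟨
      R.1# R.* coeff f γ  ≈⟨ R.*-congʳ uu′ ⟨
      u R.* u′ R.* coeff f γ  ≈⟨ R.solve 4 (λ u u′ v c → u R.:* u′ R.:* c R.:= u′ R.:*
        (u R.:* c R.:+ v R.:* R.:0)) R.refl u u′ v (coeff f γ) ⟩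
      u′ R.* (u R.* coeff f γ R.+ v R.* R.0#)  ≈⟨ R.*-congˡ
        (R.+-cong (R.*-congˡ (coeff-X*-unit p f γ)) (R.*-congˡ e)) ⟨
      u′ R.* (u R.* coeff (X p * f) (unit p +ᵉ γ) R.+ v R.* coeff (X q * f) (unit p +ᵉ γ))
                                                    ≈⟨ R.*-congˡ (at (unit p +ᵉ γ)) ⟩
      u′ R.* R.0#  ≈⟨ R.zeroʳ u′ ⟩
      R.0#                                          ∎
    lookup-q : ∀ γ → Vec.lookup (unit p +ᵉ γ) q ≡ Vec.lookup γ q
    lookup-q γ = ≡.trans (lookup-+ (unit p) γ q) (≡.cong (ℕ._+ Vec.lookup γ q) (lookup-unit-≢ (λ e → p≢q (≡.sym e))))
    vanish : ∀ m γ → Vec.lookup γ q ≡ m → coeff f γ R.≈ R.0#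
    vanish zero γ e = reduce γ (coeff-X*-0 q f (unit p +ᵉ γ) (≡.trans (lookup-q γ) e))
    vanish (suc m) γ e with split-unit γ q m e
    ... | γ′ , ≡.refl , e′ , _ = reduce (unit q +ᵉ γ′) (R.trans
      (R.reflexive (≡.cong (coeff (X q * f)) swap)) (R.trans (coeff-X*-unit q f (unit p +ᵉ γ′))
        (vanish m (unit p +ᵉ γ′) (≡.trans (lookup-q γ′) e′))))
      where
      swap : unit p +ᵉ (unit q +ᵉ γ′) ≡ unit q +ᵉ (unit p +ᵉ γ′)
      swap = ≡.trans (≡.sym (Vec.zipWith-assoc ℕ.+-assoc (unit p) (unit q) γ′))
        (≡.trans (≡.cong (_+ᵉ γ′) (+ᵉ-comm (unit p) (unit q))) (Vec.zipWith-assoc ℕ.+-assoc (unit q) (unit p) γ′))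

  nzd-X : ∀ p → NonZeroDivisor (X p)
  nzd-X p f eq = mk≈ᴾ λ γ → R.trans (R.sym (coeff-X*-unit p f γ)) (_≈ᴾ_.coeff-≈ eq (unit p +ᵉ γ))

-- Substitution and the coprimality of linear forms

module Evaluation {r ℓr a ℓa} (R : CommutativeRing r ℓr) (n : ℕ) (A : CommutativeRing a ℓa)
                  (ι : CommutativeRing.Carrier R → CommutativeRing.Carrier A)
                  (ι-1 : CommutativeRing._≈_ A (ι (CommutativeRing.1# R)) (CommutativeRing.1# A))
                  (ι-* : ∀ c d → CommutativeRing._≈_ A (ι (CommutativeRing._*_ R c d))
                    (CommutativeRing._*_ A (ι c) (ι d)))
                  (ι-neg : ∀ c → CommutativeRing._≈_ A (ι (CommutativeRing.-_ R c)) (CommutativeRing.-_ A (ι c)))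
                  (u : Vec (CommutativeRing.Carrier A) n) where
  open Polynomials R n
  private module R = CommutativeRing R
  open CommutativeRing A hiding (zero)
  open IntegerRingSolver A
  open import Algebra.Properties.Semiring.Exp semiring using (_^_; ^-homo-*)

  power : ∀ {m} → Vec Carrier m → Vec ℕ m → Carrier
  power u α = Vec.foldr′ _*_ 1# (Vec.zipWith _^_ u α)

  power-+ : ∀ {m} (u : Vec Carrier m) α β → power u (Vec.zipWith ℕ._+_ α β) ≈ power u α * power u β
  power-+ []      []      []      = sym (*-identityˡ 1#)
  power-+ (x ∷ u) (a ∷ α) (b ∷ β) = trans (*-cong (^-homo-* x a b) (power-+ u α β))
    (solve 4 (λ x y z w → (x :* y) :* (z :* w) := (x :* z) :* (y :* w)) refl _ _ _ _)

  power-0 : ∀ {m} (u : Vec Carrier m) → power u (Vec.replicate m 0) ≈ 1#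
  power-0 []      = refl
  power-0 (x ∷ u) = trans (*-identityˡ _) (power-0 u)

  power-unit : ∀ {m} (u : Vec Carrier m) i → power u (unit i) ≈ Vec.lookup u i
  power-unit (x ∷ u) zero    = trans (*-cong (*-identityʳ x) (power-0 u)) (*-identityʳ x)
  power-unit (x ∷ u) (suc i) = trans (*-identityˡ _) (power-unit u i)

  eval : Poly → Carrier
  eval p = evaluate A ι p u

  eval-+ : ∀ p q → eval (p +ᴾ q) ≈ eval p + eval q
  eval-+ []      q = sym (+-identityˡ _)
  eval-+ (t ∷ p) q = trans (+-congˡ (eval-+ p q)) (sym (+-assoc _ _ _))

  eval-neg : ∀ p → eval (-ᴾ p) ≈ - eval p
  eval-neg []            = solve 0 (:0 := :- :0) refl
  eval-neg ((c , α) ∷ p) = trans (+-cong (*-congʳ (ι-neg c)) (eval-neg p))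
    (solve 3 (λ c x y → :- c :* x :+ :- y := :- (c :* x :+ y)) refl _ _ _)

  eval-* : ∀ p q → eval (p *ᴾ q) ≈ eval p * eval q
  eval-* []            q = sym (zeroˡ _)
  eval-* ((c , α) ∷ p) q = trans (eval-+ (List.map (λ (d , β) → c R.* d , α +ᵉ β) q) (p *ᴾ q))
    (trans (+-cong (row q) (eval-* p q)) (sym (distribʳ _ _ _)))
    where
    row : ∀ q → eval (List.map (λ (d , β) → c R.* d , α +ᵉ β) q) ≈ ι c * power u α * eval q
    row []            = sym (zeroʳ _)
    row ((d , β) ∷ q) = trans (+-cong (*-cong (ι-* c d) (power-+ u α β)) (row q))
      (solve 5 (λ c d x y z → (c :* d) :* (x :* y) :+ (c :* x) :* z := (c :* x) :* (d :* y :+ z)) refl _ _ _ _ _)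

  eval-C : ∀ c → eval (C c) ≈ ι c
  eval-C c = trans (+-identityʳ _) (trans (*-congˡ (power-0 u)) (*-identityʳ _))

  eval-1 : eval (C R.1#) ≈ 1#
  eval-1 = trans (eval-C R.1#) ι-1

  eval-X : ∀ i → eval (X i) ≈ Vec.lookup u i
  eval-X i = trans (+-identityʳ _) (trans (*-cong ι-1 (power-unit u i)) (*-identityˡ _))

module Substitution {r ℓr} (R : CommutativeRing r ℓr) (n : ℕ) where
  open Polynomials R n
  private
    module R where
      open CommutativeRing R public
      open IntegerRingSolver R public
  open CommutativeRing polynomialRing hiding (zero)
  open IntegerRingSolver polynomialRing
  open Divisibility polynomialRing
  open PolynomialProperties R n

  module _ (i : Fin n) (w : Poly) where

    private
      images : Vec Poly n
      images = Vec.tabulate X Vec.[ i ]≔ w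
    open Evaluation R n polynomialRing C refl C-* C-neg images
      renaming (eval to substitute; eval-+ to substitute-+; eval-neg to substitute-neg; eval-* to substitute-*;
                eval-C to substitute-C) public

    substitute-X : substitute (X i) ≈ w
    substitute-X = trans (eval-X i) (reflexive (Vec.lookup∘updateAt i (Vec.tabulate X)))

    substitute-X-≢ : ∀ {j} → j ≢ i → substitute (X j) ≈ X j
    substitute-X-≢ {j} j≢i = trans (eval-X j) (reflexive
      (≡.trans (Vec.lookup∘update′ j≢i (Vec.tabulate X) w) (Vec.lookup∘tabulate X j)))

    -- Substitution is defined on formal sums. It respects equality of polynomials because each
    -- coefficient of the result is a functional `L f` of the argument.
    substitute-cong : ∀ {f g} → f ≈ g → substitute f ≈ substitute g
    substitute-cong {f} {g} e = mk≈ᴾ λ β → R.trans (coeff-substitute f β)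
      (R.trans (≈ᴾ⇒L e _) (R.sym (coeff-substitute g β)))
      where
      coeff-substitute : ∀ f β → coeff (substitute f) β R.≈ L f (λ α → coeff (power images α) β)
      coeff-substitute []            β = R.refl
      coeff-substitute ((c , α) ∷ f) β = R.trans (coeff-+ (C c * power images α) (substitute f) β)
        (R.+-cong (coeff-C* c (power images α) β) (coeff-substitute f β))

    -- The factor theorem: congruence modulo x_i - w is compatible with sums and products, so it is
    -- enough to check constants and variables.
    ∣-substitute : ∀ f → X i - w ∣ f - substitute f
    ∣-substitute = polynomial-induction (λ f → X i - w ∣ f - substitute f)
      (λ {f} {g} e → ∣-respʳ (+-cong e (-‿cong (substitute-cong e))))
      (λ c → ∣-respʳ (sym (trans (+-congˡ {C c} (-‿cong (substitute-C c))) (-‿inverseʳ (C c)))) (∣0 (X i - w)))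
      generator
      (λ {f} {g} h k → ∣-resp refl
        (trans (solve 4 (λ f f′ g g′ → (f :- f′) :+ (g :- g′) := (f :+ g) :- (f′ :+ g′)) refl f (substitute f) g
          (substitute g))
               (+-congˡ {f + g} (-‿cong (sym (substitute-+ f g)))))
        (∣+ h k))
      (λ {f} {g} h k → ∣-resp refl
        (trans (solve 4 (λ f f′ g g′ → g :* (f :- f′) :+ f′ :* (g :- g′) := f :* g :- f′ :* g′) refl f
          (substitute f) g (substitute g))
               (+-congˡ {f * g} (-‿cong (sym (substitute-* f g)))))
        (∣+ 
          (∣*ˡ g h) (∣*ˡ (substitute f) k)))
      where
      generator : ∀ j → X i - w ∣ X j - substitute (X j)
      generator j with j Fin.≟ i
      ... | yes ≡.refl = ∣-resp refl
        (+-congˡ {X i} (-‿cong (sym substitute-X))) (∣-refl )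
      ... | no j≢i = ∣-resp refl
        (sym (trans (+-congˡ {X j} (-‿cong (substitute-X-≢ j≢i))) (-‿inverseʳ (X j)))) (∣0 (X i - w))

    -- Substitution kills x_i - w because w is fixed. Applied to e x = (x_i - w) q it gives e′ σ(x)
    -- = 0, hence σ(x) = 0, and x is congruent to σ(x) modulo x_i - w.
    coprime-substitute : ∀ {e e′} → substitute w ≈ w → substitute e ≈ e′ → NonZeroDivisor e′ → Coprime (X i - w) e
    coprime-substitute {e} {e′} w-fixed e≈e′ nz x (q , eq) =
      ∣-resp refl
        (trans (+-congˡ {x} (trans (-‿cong vanishes) refl)) (solve 1 (λ x → x :- :0 := x) refl x)) (∣-substitute x)
      where
      vanishes : substitute x ≈ 0#
      vanishes = nz (substitute x) (begin
        e′ * substitute x  ≈⟨ *-congʳ {substitute x} e≈e′ ⟨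
        substitute e * substitute x  ≈⟨ substitute-* e x ⟨
        substitute (e * x)  ≈⟨ substitute-cong eq ⟩
        substitute ((X i - w) * q)  ≈⟨ substitute-* (X i - w) q ⟩
        substitute (X i - w) * substitute q  ≈⟨ *-congʳ {substitute q} (substitute-+ (X i) (- w)) ⟩
        (substitute (X i) + substitute (- w)) * substitute q    ≈⟨ *-congʳ {substitute q}
          (+-cong substitute-X (trans (substitute-neg w) (-‿cong w-fixed))) ⟩
        (w - w) * substitute q  ≈⟨ solve 2 (λ w q → (w :- w) :* q := :0) refl w (substitute q) ⟩
        0#                                                      ∎)
        where open import Relation.Binary.Reasoning.Setoid setoid

  -- The coefficient is arbitrary because substituting one form into another multiplies the signs.
  form : R.Carrier → Fin n → Fin n → Poly
  form ε a b = X a - C ε * X b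

  1·1≈1 : R.1# R.* R.1# R.≈ R.1#
  1·1≈1 = R.*-identityˡ R.1#

  nzd-form : ∀ ε {a b} → a ≢ b → NonZeroDivisor (form ε a b)
  nzd-form ε {a} {b} a≢b = nzd-resp
    (trans (+-congˡ {C R.1# * X a} (*-congʳ {X b} (C-neg ε)))
      (solve 3 (λ x e y → :1 :* x :+ (:- e) :* y := x :- e :* y) refl (X a) (C ε) (X b)))
    (nzd-linear {R.1#} {R.1#} {R.- ε} 1·1≈1 a≢b)

  private
    module _ (ε : R.Carrier) (a b : Fin n) where
      σ : Poly → Poly
      σ = substitute a (C ε * X b)

      σ-term : ∀ {ε′ c f} → σ (X c) ≈ f → σ (C ε′ * X c) ≈ C ε′ * f
      σ-term {ε′} {c} {f} e = trans (substitute-* a (C ε * X b) (C ε′) (X c))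
        (*-cong (substitute-C a (C ε * X b) ε′) e)

      σ-form : ∀ {ε′ c d f g} → σ (X c) ≈ f → σ (X d) ≈ g → σ (form ε′ c d) ≈ f - C ε′ * g
      σ-form {ε′} {c} {d} {f} {g} e e′ = trans (substitute-+ a (C ε * X b) (X c) (- (C ε′ * X d)))
        (+-cong e (trans (substitute-neg a (C ε * X b) (C ε′ * X d)) (-‿cong (σ-term e′))))

      coprime-σ : ∀ e e′ → a ≢ b → σ e ≈ e′ → NonZeroDivisor e′ → Coprime (form ε a b) e
      coprime-σ e e′ a≢b = coprime-substitute a (C ε * X b) {e} {e′}
        (σ-term (substitute-X-≢ a (C ε * X b) (λ e → a≢b (≡.sym e))))

  -- Putting x_a = ε x_b into the second form leaves a combination of two different variables with a
  -- unit coefficient, because the two pairs of variables differ as unordered pairs.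
  coprime-forms : ∀ {ε ε′ ε⁻¹ a b c d} → ε R.* ε⁻¹ R.≈ R.1# → a ≢ b → c ≢ d → ¬ (c ≡ a × d ≡ b) → ¬ (c ≡ b × d ≡ a) →
                  Coprime (form ε a b) (form ε′ c d)
  coprime-forms {ε} {ε′} {ε⁻¹} {a} {b} {c} {d} unit-ε a≢b c≢d ne ne′ with c Fin.≟ a | d Fin.≟ a
  ... | yes ≡.refl | yes ≡.refl = contradiction ≡.refl c≢d
  ... | yes ≡.refl | no d≢a = coprime-σ ε a b (form ε′ a d) (w - C ε′ * X d) a≢b
    (σ-form ε a b (substitute-X a w) (substitute-X-≢ a w d≢a))
    (nzd-resp (trans (+-congˡ {w} (*-congʳ {X d} (C-neg ε′)))
      (solve 3 (λ x e y → x :+ (:- e) :* y := x :- e :* y) refl w (C ε′) (X d)))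
      (nzd-linear {ε} {ε⁻¹} {R.- ε′} unit-ε (λ b≡d → ne (≡.refl , ≡.sym b≡d))))
    where w = C ε * X b
  ... | no c≢a | yes ≡.refl = coprime-σ ε a b (form ε′ c a) (X c - C ε′ * w) a≢b
    (σ-form ε a b (substitute-X-≢ a w c≢a) (substitute-X a w))
    (nzd-resp (+-congˡ {X c} (-‿cong (trans (*-congʳ {X b} (C-* ε′ ε)) (*-assoc (C ε′) (C ε) (X b)))))
      (nzd-form (ε′ R.* ε) (λ c≡b → ne′ (c≡b , ≡.refl))))
    where w = C ε * X b
  ... | no c≢a | no d≢a = coprime-σ ε a b (form ε′ c d) (form ε′ c d) a≢b
    (σ-form ε a b (substitute-X-≢ a w c≢a) (substitute-X-≢ a w d≢a)) (nzd-form ε′ c≢d)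
    where w = C ε * X b

  -- The substitution leaves (ε - ε′) x_b. For x_a - x_b and x_a + x_b this is 2 x_b, so 2 has to be
  -- invertible.
  coprime-same-variables : ∀ {ε ε′ δ⁻¹ a b} → (ε R.- ε′) R.* δ⁻¹ R.≈ R.1# → a ≢ b → Coprime (form ε a b) (form ε′ a b)
  coprime-same-variables {ε} {ε′} {δ⁻¹} {a} {b} unit-δ a≢b = coprime-σ ε a b (form ε′ a b) (w - C ε′ * X b) a≢b
    (σ-form ε a b (substitute-X a w) (substitute-X-≢ a w (λ e → a≢b (≡.sym e))))
    (nzd-resp (trans (*-congʳ {X b} (trans (C-+ ε (R.- ε′)) (+-congˡ {C ε} (C-neg ε′))))
      (solve 3 (λ e e′ x → (e :- e′) :* x := e :* x :- e′ :* x) refl (C ε) (C ε′) (X b)))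
      (nzd-* {C (ε R.- ε′)} {X b} (nzd-C unit-δ) (nzd-X b)))
    where w = C ε * X b

  -- Setting x_a to zero leaves either a unit multiple of one variable or the unchanged form.
  coprime-X-form : ∀ {a ε ε⁻¹ c d} → ε R.* ε⁻¹ R.≈ R.1# → c ≢ d → Coprime (X a) (form ε c d)
  coprime-X-form {a} {ε} {ε⁻¹} {c} {d} unit-ε c≢d = coprime-resp {X a - 0#} {X a} {form ε c d} {form ε c d}
    (solve 1 (λ x → x :- :0 := x) refl (X a)) refl (at (c Fin.≟ a) (d Fin.≟ a))
    where
    τ-form : ∀ {f g} → substitute a 0# (X c) ≈ f → substitute a 0# (X d) ≈ g → substitute a 0# (form ε c d) ≈ f
      - C ε * g
    τ-form {f} {g} e e′ = trans (substitute-+ a 0# (X c) (- (C ε * X d)))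
        (+-cong e (trans (substitute-neg a 0# (C ε * X d))
          (-‿cong (trans (substitute-* a 0# (C ε) (X d)) (*-cong (substitute-C a 0# ε) e′)))))
    at : Dec (c ≡ a) → Dec (d ≡ a) → Coprime (X a - 0#) (form ε c d)
    at (yes ≡.refl) (yes ≡.refl) = contradiction ≡.refl c≢d
    at (yes ≡.refl) (no d≢a) = coprime-substitute a 0# {form ε c d} {0# - C ε * X d} refl
      (τ-form (substitute-X a 0#) (substitute-X-≢ a 0# d≢a))
      (nzd-resp (solve 2 (λ e x → :- (e :* x) := :0 :- e :* x) refl (C ε) (X d))
        (nzd-neg {C ε * X d} (nzd-* {C ε} {X d} (nzd-C unit-ε) (nzd-X d))))
    at (no c≢a) (yes ≡.refl) = coprime-substitute a 0# {form ε c d} {X c - C ε * 0#} refl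
      (τ-form (substitute-X-≢ a 0# c≢a) (substitute-X a 0#))
      (nzd-resp (solve 2 (λ e x → x := x :- e :* :0) refl (C ε) (X c)) (nzd-X c))
    at (no c≢a) (no d≢a) = coprime-substitute a 0# {form ε c d} {form ε c d} refl
      (τ-form (substitute-X-≢ a 0# c≢a) (substitute-X-≢ a 0# d≢a))
      (nzd-form ε c≢d)

  coprime-X-X : ∀ {a b} → a ≢ b → Coprime (X a) (X b)
  coprime-X-X {a} {b} a≢b = coprime-resp {X a - 0#} {X a} {X b} {X b} (solve 1 (λ x → x :- :0 := x) refl (X a)) refl
    (coprime-substitute a 0# {X b} {X b} refl (substitute-X-≢ a 0# (λ e → a≢b (≡.sym e))) (nzd-X b))

-- Second-order operators and their polarisations

module SecondOrderOperators {c ℓ} (S : CommutativeRing c ℓ) where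
  open CommutativeRing S
  open IntegerRingSolver S
  open Divisibility S
  open ListSums S
  open import Algebra.Properties.Ring ring using (+-inverseʳ-unique)
  open import Relation.Binary.Reasoning.Setoid setoid

  -- A multi-index of size two enters only through the two derivations whose composite is ∂^α.
  module Action {j i} {J : Set j} (∂ : J → Carrier → Carrier) (∂-cong : ∀ k {f g} → f ≈ g → ∂ k f ≈ ∂ k g)
    (∂-+ : ∀ k f g → ∂ k (f + g) ≈ ∂ k f + ∂ k g) (leibniz : ∀ k f g → ∂ k (f * g) ≈ ∂ k f * g + f * ∂ k g)
    {I : Set i} (indices : List I) (p q : I → J) (∂² : I → Carrier → Carrier)
    (∂²-spec : ∀ α f → ∂² α f ≈ ∂ (p α) (∂ (q α) f)) where

    ∂-neg : ∀ k f → ∂ k (- f) ≈ - ∂ k f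
    ∂-neg k f = +-inverseʳ-unique _ _ (begin
      ∂ k f + ∂ k (- f)    ≈⟨ ∂-+ k f (- f) ⟨
      ∂ k (f - f)  ≈⟨ ∂-cong k (-‿inverseʳ f) ⟩
      ∂ k 0#  ≈⟨ ∂-0 ⟩
      0#                   ∎)
      where
      ∂-0 : ∂ k 0# ≈ 0#
      ∂-0 = trans (solve 1 (λ x → x := (x :+ x) :- x) refl (∂ k 0#))
        (trans (+-congʳ (trans (sym (∂-+ k 0# 0#)) (∂-cong k (+-identityˡ 0#)))) (-‿inverseʳ _))

    apply : (I → Carrier) → Carrier → Carrier
    apply θ f = ∑ indices λ α → θ α * ∂² α f

    apply-cong : ∀ θ {f g} → f ≈ g → apply θ f ≈ apply θ g
    apply-cong θ e = ∑-cong indices λ α → *-congˡ (trans (∂²-spec α _)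
      (trans (∂-cong (p α) (∂-cong (q α) e)) (sym (∂²-spec α _))))

    cross : I → Carrier → Carrier → Carrier
    cross α f g = ∂ (p α) f * ∂ (q α) g + ∂ (q α) f * ∂ (p α) g

    -- The polarisation θ(f g) - θ(f) g - f θ(g), a symmetric biderivation.
    polar : (I → Carrier) → Carrier → Carrier → Carrier
    polar θ f g = ∑ indices λ α → θ α * cross α f g

    apply-* : ∀ θ f g → apply θ (f * g) ≈ apply θ f * g + polar θ f g + f * apply θ g
    apply-* θ f g = sym (begin
      apply θ f * g + polar θ f g + f * apply θ g
        ≈⟨ +-cong (+-congʳ (∑-*ʳ indices g _)) (∑-* indices f _) ⟨
      ∑ indices (λ α → θ α * ∂² α f * g) + polar θ f g + ∑ indices (λ α → f * (θ α * ∂² α g))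
        ≈⟨ trans (+-congʳ (sym (∑-+ indices _ _))) (sym (∑-+ indices _ _)) ⟩
      ∑ indices (λ α → θ α * ∂² α f * g + θ α * cross α f g + f * (θ α * ∂² α g))
        ≈⟨ ∑-cong indices term ⟩
      apply θ (f * g) ∎)
      where
      term : ∀ α → θ α * ∂² α f * g + θ α * cross α f g + f * (θ α * ∂² α g) ≈ θ α * ∂² α (f * g)
      term α = begin
        θ α * ∂² α f * g + θ α * (pf * qg + qf * pg) + f * (θ α * ∂² α g)
          ≈⟨ +-cong (+-congʳ (*-congʳ (*-congˡ (∂²-spec α f)))) (*-congˡ (*-congˡ (∂²-spec α g))) ⟩
        θ α * pqf * g + θ α * (pf * qg + qf * pg) + f * (θ α * pqg)
          ≈⟨ solve 9 (λ t x g a b c d f y → t :* x :* g :+ t :* (a :* b :+ c :* d) :+ f :* (t :* y)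
                                           := t :* ((x :* g :+ c :* d) :+ (a :* b :+ f :* y))) refl (θ α) pqf g
                                             pf qg qf pg f pqg ⟩
        θ α * ((pqf * g + qf * pg) + (pf * qg + f * pqg))
          ≈⟨ *-congˡ (+-cong (leibniz (p α) qf g) (leibniz (p α) f qg)) ⟨
        θ α * (∂ (p α) (qf * g) + ∂ (p α) (f * qg))
          ≈⟨ *-congˡ (trans (∂²-spec α (f * g)) (trans (∂-cong (p α) (leibniz (q α) f g)) (∂-+ (p α) _ _))) ⟨
        θ α * ∂² α (f * g) ∎
        where
        pf = ∂ (p α) f
        qf = ∂ (q α) f
        pg = ∂ (p α) g
        qg = ∂ (q α) g
        pqf = ∂ (p α) qf
        pqg = ∂ (p α) qg

    module _ (θ : I → Carrier) where

      polar-sym : ∀ f g → polar θ f g ≈ polar θ g f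
      polar-sym f g = ∑-cong indices λ α → *-congˡ
        (solve 4 (λ a b c d → a :* b :+ c :* d := d :* c :+ b :* a) refl _ _ _ _)

      polar-congˡ : ∀ {f f′} g → f ≈ f′ → polar θ f g ≈ polar θ f′ g
      polar-congˡ g e = ∑-cong indices λ α → *-congˡ (+-cong (*-congʳ (∂-cong (p α) e)) (*-congʳ (∂-cong (q α) e)))

      polar-+ˡ : ∀ f f′ g → polar θ (f + f′) g ≈ polar θ f g + polar θ f′ g
      polar-+ˡ f f′ g = trans (∑-cong indices (λ α → trans
        (*-congˡ (+-cong (*-congʳ (∂-+ (p α) f f′)) (*-congʳ (∂-+ (q α) f f′))))
        (solve 7 (λ t a a′ b c c′ d → t :* ((a :+ a′) :* b :+ (c :+ c′) :* d) := t :* (a :* b :+ c :* d) :+ t :*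
          (a′ :* b :+ c′ :* d))
          refl (θ α) _ _ _ _ _ _))) (∑-+ indices _ _)

      polar-*ˡ : ∀ f f′ g → polar θ (f * f′) g ≈ f * polar θ f′ g + f′ * polar θ f g
      polar-*ˡ f f′ g = trans (∑-cong indices (λ α → trans
        (*-congˡ (+-cong (*-congʳ (leibniz (p α) f f′)) (*-congʳ (leibniz (q α) f f′))))
        (solve 9 (λ t a a′ b c c′ d f f′ → t :* ((a :* f′ :+ f :* a′) :* b :+ (c :* f′ :+ f :* c′) :* d)
                  := f :* (t :* (a′ :* b :+ c′ :* d)) :+ f′ :* (t :* (a :* b :+ c :* d)))
          refl (θ α) _ _ _ _ _ _ f f′)))
        (trans (∑-+ indices _ _) (+-cong (∑-* indices f _) (∑-* indices f′ _)))

      polar-negˡ : ∀ f g → polar θ (- f) g ≈ - polar θ f g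
      polar-negˡ f g = trans (∑-cong indices (λ α → trans
        (*-congˡ (+-cong (*-congʳ (∂-neg (p α) f)) (*-congʳ (∂-neg (q α) f))))
        (solve 5 (λ t a b c d → t :* (:- a :* b :+ :- c :* d) := (:- :1) :* (t :* (a :* b :+ c :* d))) refl
          (θ α) _ _ _ _)))
        (trans (∑-* indices (- 1#) _) (solve 1 (λ x → :- :1 :* x := :- x) refl _))

      polar-constantˡ : ∀ {f} g → (∀ k → ∂ k f ≈ 0#) → polar θ f g ≈ 0#
      polar-constantˡ g e = ∑-zero indices λ α → trans (*-congˡ (+-cong (*-congʳ (e (p α))) (*-congʳ (e (q α)))))
        (solve 3 (λ t a b → t :* (:0 :* a :+ :0 :* b) := :0) refl _ _ _)

      preserves : ∀ {d} → d ∣ apply θ d → (∀ f → d ∣ polar θ d f) → ∀ f → d ∣ apply θ (d * f)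
      preserves {d} d∣θd d∣polar f = ∣-respʳ (sym (apply-* θ d f))
        (∣+ (∣+ (∣*ʳ f d∣θd) (d∣polar f)) (apply θ f , refl))

      module _ {ds : List Carrier} (nzd : All NonZeroDivisor ds) (coprime : AllPairs Coprime ds) where

        -- An operator preserving each ideal d S preserves their intersection, which by coprimality
        -- is the ideal of the product.
        preserves-product : All (λ d → d ∣ apply θ d) ds → All (λ d → ∀ f → d ∣ polar θ d f) ds →
                            ∀ f → product ds ∣ apply θ (product ds * f)
        preserves-product hs ks f = product∣ nzd coprime
          (All.zipWith (λ { {d} ((h , k) , e , eq , _) → ∣-respʳ
            (apply-cong θ (trans (sym (*-assoc d e f)) (*-congʳ (sym eq)))) (preserves h k (e * f)) })
            (All.zip (hs , ks) , cofactors nzd coprime))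

        -- Preservation at x and at 1 puts the polarisation B(Q, x) into Q S. For Q = d e it equals
        -- d B(e, x) + e B(d, x), so d divides e B(d, x), and e is coprime to d.
        preserves-product⁻ : (∀ f → product ds ∣ apply θ (product ds * f)) → ∀ x → All (λ d → d ∣ polar θ d x) ds
        preserves-product⁻ h x = All.map (λ { {d} (e , eq , co) → co _
          (∣-respʳ (trans (+-congʳ (trans (polar-congˡ x eq) (polar-*ˡ d e x)))
              (solve 2 (λ a b → (a :+ b) :- a := b) refl _ _))
            (∣-difference (∣-trans (e , eq) Q∣polar) (polar θ e x , refl))) }) (cofactors nzd coprime)
          where
          Q = product ds
          Q∣polar : Q ∣ polar θ Q x
          Q∣polar = ∣-respʳ (trans (+-congʳ (+-congʳ (apply-* θ Q x)))
              (solve 3 (λ a b c → (a :+ b :+ c) :- a :- c := b) refl _ _ _))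
            (∣-difference (∣-difference (h x) (∣*ʳ x (∣-respʳ (apply-cong θ (*-identityʳ Q)) (h 1#))))
              (apply θ x , refl))

-- Symmetric matrices with logarithmic rows

otherIndices : ∀ {n} → Fin n → List (Fin n)
otherIndices {n} k = List.filter (λ i → ¬? (i Fin.≟ k)) (List.allFin n)

∈-otherIndices : ∀ {n} {i k : Fin n} → i ≢ k → i ∈ otherIndices k
∈-otherIndices {k = k} = Membership.∈-filter⁺ (λ i → ¬? (i Fin.≟ k)) (Membership.∈-allFin _)

unique⇒allPairs : ∀ {a p r} {A : Set a} {P : A → Set p} {R : A → A → Set r} {xs} →
  (∀ {x y} → P x → P y → x ≢ y → R x y) → All P xs → Unique xs → AllPairs R xs
unique⇒allPairs f []       []       = []
unique⇒allPairs f (p ∷ ps) (u ∷ us) = All.zipWith (λ (q , x≢y) → f p q x≢y) (ps , u) ∷ unique⇒allPairs f ps us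

module RowConditions {c ℓ} (S : CommutativeRing c ℓ) {n : ℕ} (X : Fin n → CommutativeRing.Carrier S) where
  open CommutativeRing S hiding (zero)
  open IntegerRingSolver S
  open Divisibility S
  open Interpolation S
  open ListSums S
  open SchurInterpolation S
  open import Algebra.Properties.Semiring.Exp semiring using (_^_)
  open import Relation.Binary.Reasoning.Setoid setoid

  Matrix : Set c
  Matrix = Fin n → Fin n → Carrier

  Symmetric : Matrix → Set ℓ
  Symmetric M = ∀ a b → M a b ≈ M b a

  linear : Bool → Fin n → Fin n → Carrier
  linear true  a b = X a - X b
  linear false a b = X a + X b

  -- All that the decomposition of matrices uses of the coordinates; it separates that argument from
  -- the polynomial ring, where these facts come from substitution.
  record CoprimeForms : Set (c ⊔ ℓ) where
    field
      nzd-2          : NonZeroDivisor (1# + 1#)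
      nzd-X          : ∀ a → NonZeroDivisor (X a)
      nzd-linear     : ∀ s {a b} → a ≢ b → NonZeroDivisor (linear s a b)
      coprime-X      : ∀ {a b} → a ≢ b → Coprime (X a) (X b)
      coprime-X-form : ∀ s a {b c} → b ≢ c → Coprime (X a) (linear s b c)
      coprime-signs  : ∀ {a b} → a ≢ b → Coprime (linear true a b) (linear false a b)
      coprime-forms  : ∀ s t {a b i j} → a ≢ b → i ≢ j → ¬ (i ≡ a × j ≡ b) → ¬ (i ≡ b × j ≡ a) →
                       Coprime (linear s i j) (linear t a b)

  -- That the rows of M are logarithmic derivations of the arrangement of type A or B.
  RowsA RowsB : Matrix → Set (c ⊔ ℓ)
  RowsA M = ∀ a b j → X a - X b ∣ M a j - M b j
  RowsB M = (∀ a j → X a ∣ M a j) × RowsA M × (∀ a b j → X a + X b ∣ M a j + M b j)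

  rowsA-resp : ∀ {M N : Matrix} → (∀ a b → M a b ≈ N a b) → RowsA M → RowsA N
  rowsA-resp e rows a b j = ∣-respʳ (+-cong (e a j) (-‿cong (e b j))) (rows a b j)

  rowsB-resp : ∀ {M N : Matrix} → (∀ a b → M a b ≈ N a b) → RowsB M → RowsB N
  rowsB-resp e (rows , rows⁻ , rows⁺) =
    (λ a j → ∣-respʳ (e a j) (rows a j)) , rowsA-resp e rows⁻ , λ a b j → ∣-respʳ (+-cong (e a j) (e b j))
      (rows⁺ a b j)

  -- For a suitable entry e this is the matrix of η_k.
  diagonal : Fin n → Carrier → Matrix
  diagonal k e a b = if does (a Fin.≟ k ×-dec b Fin.≟ k) then e else 0#

  diagonal-kk : ∀ k e → diagonal k e k k ≈ e
  diagonal-kk k e with k Fin.≟ k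
  ... | yes _ = refl
  ... | no k≢k = contradiction ≡.refl k≢k

  diagonal-row≢ : ∀ {k a} e b → a ≢ k → diagonal k e a b ≈ 0#
  diagonal-row≢ {k} {a} e b a≢k with a Fin.≟ k
  ... | yes a≡k = contradiction a≡k a≢k
  ... | no _ = refl

  ∣∏ : ∀ {a} {A : Set a} {x : A} {xs} f → x ∈ xs → f x ∣ ∏ xs f
  ∣∏ {xs = x ∷ xs} f (here ≡.refl) = ∏ xs f , refl
  ∣∏ {xs = x ∷ xs} f (there x∈)    = ∣*ˡ (f x) (∣∏ f x∈)

  product-map : ∀ {a} {A : Set a} (f : A → Carrier) xs → product (List.map f xs) ≡ ∏ xs f
  product-map f []       = ≡.refl
  product-map f (x ∷ xs) = ≡.cong (f x *_) (product-map f xs)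

  ∏∣ : ∀ {a} {A : Set a} {xs : List A} (f : A → Carrier) {d} → All (λ x → NonZeroDivisor (f x)) xs →
       AllPairs (λ x x′ → Coprime (f x) (f x′)) xs → All (λ x → f x ∣ d) xs → ∏ xs f ∣ d
  ∏∣ {xs = xs} f nz co hs = ∣-resp (reflexive (product-map f xs)) refl
    (product∣ (All.map⁺ nz) (AllPairs.map⁺ co) (All.map⁺ hs))

  nzd-∏ : ∀ {a} {A : Set a} {xs : List A} (f : A → Carrier) → All (λ x → NonZeroDivisor (f x)) xs →
    NonZeroDivisor (∏ xs f)
  nzd-∏ {xs = xs} f nz = nzd-resp (reflexive (product-map f xs)) (nzd-product (All.map⁺ nz))

  coprime-∏ : ∀ {a} {A : Set a} {xs : List A} (f : A → Carrier) {d} → All (λ x → Coprime d (f x)) xs → Coprime d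
    (∏ xs f)
  coprime-∏ {xs = xs} f co = coprime-resp refl (reflexive (product-map f xs)) (coprime-product (All.map⁺ co))

  -- Common to both types: w = 1 and y = x in type A, w = x and y = x² in type B, with E_a the
  -- nonzero entry in the matrix of η_a.
  module Weighted (w y E : Fin n → Carrier) (sep : Separated y) where

    Θ : Vec ℕ 2 → Matrix
    Θ μ a b = w a * w b * schur (y a) (y b) μ

    Θ-sym : ∀ μ → Symmetric (Θ μ)
    Θ-sym μ a b with a Fin.≟ b
    ... | yes ≡.refl = refl
    ... | no a≢b = *-cong (*-comm _ _) (schur-sym μ (sep a≢b))

    diagonalPart : (Fin n → Carrier) → Matrix
    diagonalPart e a b = ∑ (List.allFin n) (λ i → e i * diagonal i (E i) a b)

    symmetricPart : (Vec ℕ 2 → Carrier) → Matrix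
    symmetricPart k a b = ∑ (Λ n) (λ μ → k μ * Θ μ a b)

    diagonalPart-≢ : ∀ e {a b} → a ≢ b → diagonalPart e a b ≈ 0#
    diagonalPart-≢ e {a} {b} a≢b = ∑-zero (List.allFin n) λ i → trans (*-congˡ (off i)) (zeroʳ _)
      where
      off : ∀ i → diagonal i (E i) a b ≈ 0#
      off i with a Fin.≟ i
      ... | no a≢i = refl
      ... | yes ≡.refl with b Fin.≟ a
      ... | yes ≡.refl = contradiction ≡.refl a≢b
      ... | no _ = refl

    diagonalPart-≡ : ∀ e a → diagonalPart e a a ≈ e a * E a
    diagonalPart-≡ e a = trans (∑-allFin-single a λ i i≢a → trans
      (*-congˡ (diagonal-row≢ (E i) a (λ a≡i → i≢a (≡.sym a≡i)))) (zeroʳ _)) (*-congˡ (diagonal-kk a (E a)))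

    symmetricPart-schur : ∀ k a b → symmetricPart k a b ≈ w a * w b * ∑ (Λ n) (λ μ → k μ * schur (y a) (y b) μ)
    symmetricPart-schur k a b = trans
      (∑-cong (Λ n) λ μ → solve 3 (λ k x s → k :* (x :* s) := x :* (k :* s)) refl (k μ) (w a * w b)
        (schur (y a) (y b) μ))
      (∑-* (Λ n) _ _)

    -- Off the diagonal only the Schur part is visible and its coefficients vanish; what remains on
    -- the diagonal is e_a E_a.
    independent : (∀ a → NonZeroDivisor (w a)) → (∀ a → NonZeroDivisor (E a)) → ∀ e k →
      (∀ a b → diagonalPart e a b + symmetricPart k a b ≈ 0#) → (∀ a → e a ≈ 0#) × (∀ μ → μ ∈ Λ n → k μ ≈ 0#)
    independent nzd-w nzd-E e k zeros = e≈0 , k≈0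
      where
      k≈0 : ∀ μ → μ ∈ Λ n → k μ ≈ 0#
      k≈0 = schur-independent sep k λ {a} {b} a≢b → nzd-* (nzd-w a) (nzd-w b) _ (begin
        w a * w b * ∑ (Λ n) (λ μ → k μ * schur (y a) (y b) μ)    ≈⟨ symmetricPart-schur k a b ⟨
        symmetricPart k a b  ≈⟨ +-identityˡ _ ⟨
        0# + symmetricPart k a b  ≈⟨ +-congʳ (diagonalPart-≢ e a≢b) ⟨
        diagonalPart e a b + symmetricPart k a b  ≈⟨ zeros a b ⟩
        0#                                                       ∎)
      e≈0 : ∀ a → e a ≈ 0#
      e≈0 a = nzd-E a _ (begin
        E a * e a  ≈⟨ *-comm _ _ ⟩
        e a * E a  ≈⟨ diagonalPart-≡ e a ⟨
        diagonalPart e a a  ≈⟨ +-identityʳ _ ⟨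
        diagonalPart e a a + 0#  ≈⟨ +-congˡ (trans (∑-cong-∈ (Λ n) λ μ μ∈ → trans (*-congʳ (k≈0 μ μ∈))
          (zeroˡ _)) (∑-zero (Λ n) λ _ → refl)) ⟨
        diagonalPart e a a + symmetricPart k a a    ≈⟨ zeros a a ⟩
        0#                                          ∎)

    decompose : ∀ (M : Matrix) k → (∀ {a b} → a ≢ b → M a b ≈ symmetricPart k a b) →
      (∀ a → E a ∣ M a a - symmetricPart k a a) → ∃ λ e → ∀ a b → M a b ≈ diagonalPart e a b + symmetricPart k a b
    decompose M k off div = (λ a → cofactor (div a)) , at
      where
      at : ∀ a b → M a b ≈ diagonalPart (λ a → cofactor (div a)) a b + symmetricPart k a b
      at a b with a Fin.≟ b
      ... | no a≢b = trans (off a≢b) (trans (sym (+-identityˡ _)) (+-congʳ (sym (diagonalPart-≢ _ a≢b))))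
      ... | yes ≡.refl = begin
        M a a  ≈⟨ solve 2 (λ m s → m := (m :- s) :+ s) refl _ _ ⟩
        (M a a - symmetricPart k a a) + symmetricPart k a a    ≈⟨ +-congʳ (trans (equation (div a)) (*-comm _ _)) ⟩
        cofactor (div a) * E a + symmetricPart k a a  ≈⟨ +-congʳ (diagonalPart-≡ _ a) ⟨
        _                                                      ∎

    node-product∣ : IndependentDifferences y → ∀ a {d} → (∀ {i} → i ≢ a → y a - y i ∣ d) → ∏ (otherIndices a)
      (λ i → y a - y i) ∣ d
    node-product∣ ind a h = ∏∣ (λ i → y a - y i) (All.map (λ i≢a → sep (λ e → i≢a (≡.sym e))) ≢a)
      (unique⇒allPairs (λ {i} {j} i≢a j≢a i≢j → ind (λ e → j≢a (≡.sym e)) (λ e → i≢a (≡.sym e))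
        (λ (_ , e) → i≢j e) (λ (e , _) → j≢a (≡.sym e)))
        ≢a (Unique.filter⁺ (λ i → ¬? (i Fin.≟ a)) (Unique.allFin⁺ n)))
      (All.map h ≢a)
      where
      ≢a : All (_≢ a) (otherIndices a)
      ≢a = All.all-filter (λ i → ¬? (i Fin.≟ a)) (List.allFin n)

    nzd-node-product : ∀ a → NonZeroDivisor (∏ (otherIndices a) (λ i → y a - y i))
    nzd-node-product a = nzd-∏ (λ i → y a - y i) (All.map (λ i≢a → sep (λ e → i≢a (≡.sym e)))
      (All.all-filter (λ i → ¬? (i Fin.≟ a)) (List.allFin n)))

  ∣x-x : ∀ {d} x → d ∣ x - x
  ∣x-x x = ∣-respʳ (sym (-‿inverseʳ x)) (∣0 _)

  -∣ : ∀ {d x} → d ∣ x → - d ∣ x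
  -∣ {d} (q , eq) = - q , trans eq (solve 2 (λ d q → d :* q := :- d :* :- q) refl d q)

  ∣∑ : ∀ {a} {A : Set a} {d} (xs : List A) {f} → (∀ x → d ∣ f x) → d ∣ ∑ xs f
  ∣∑ []       h = ∣0 _
  ∣∑ (x ∷ xs) h = ∣+ (h x) (∣∑ xs h)

  ∑-difference : ∀ {a} {A : Set a} (xs : List A) f g → ∑ xs (λ x → f x - g x) ≈ ∑ xs f - ∑ xs g
  ∑-difference []       f g = solve 0 (:0 := :0 :- :0) refl
  ∑-difference (x ∷ xs) f g = trans (+-congˡ (∑-difference xs f g))
    (solve 4 (λ a b c d → (a :- b) :+ (c :- d) := (a :+ c) :- (b :+ d)) refl _ _ _ _)

  ∣diagonal : ∀ {d k} e a b → (a ≡ k → d ∣ e) → d ∣ diagonal k e a b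
  ∣diagonal {k = k} e a b h with a Fin.≟ k | b Fin.≟ k
  ... | no _    | _     = ∣0 _
  ... | yes a≡k | yes _ = h a≡k
  ... | yes _   | no _  = ∣0 _

  module _ (forms : CoprimeForms) where
    open CoprimeForms forms

    module TypeA where
      E : Fin n → Carrier
      E a = ∏ (otherIndices a) (λ i → X a - X i)

      open Weighted (λ _ → 1#) X E (nzd-linear true) public

      rows-Θ : ∀ μ → RowsA (Θ μ)
      rows-Θ μ a b j = ∣-respʳ (solve 2 (λ x y → x :- y := :1 :* :1 :* x :- :1 :* :1 :* y) refl _ _)
        (schur-difference (X a) (X b) (X j) μ)

      rows-diagonal : ∀ k → RowsA (diagonal k (E k))
      rows-diagonal k a b j with a Fin.≟ b
      ... | yes ≡.refl = ∣x-x _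
      ... | no a≢b = ∣-difference
        (∣diagonal (E k) a j λ { ≡.refl → ∣∏ (λ i → X a - X i) (∈-otherIndices λ b≡a → a≢b (≡.sym b≡a)) })
        (∣diagonal (E k) b j λ { ≡.refl → ∣-resp (solve 2 (λ x y → :- (x :- y) := y :- x) refl (X b) (X a)) refl
          (-∣ (∣∏ (λ i → X b - X i) (∈-otherIndices a≢b))) })

      spans : ∀ M → Symmetric M → RowsA M → ∃ λ e → ∃ λ k → ∀ a b → M a b ≈ diagonalPart e a b + symmetricPart k a b
      spans M M-sym rows = _ , k , proj₂ (decompose M k off λ a → node-product∣ independent-differences a λ {i}
        i≢a → divides a i i≢a)
        where
        independent-differences : IndependentDifferences X
        independent-differences = coprime-forms true true
        interpolation = schur-spans (nzd-linear true) nzd-2 independent-differences M (λ {a} {b} _ → M-sym a b)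
          (λ {a} {b} {j} _ _ _ → rows a b j)
        k = proj₁ interpolation
        off : ∀ {a b} → a ≢ b → M a b ≈ symmetricPart k a b
        off {a} {b} a≢b = trans (proj₂ interpolation a≢b)
          (trans (solve 1 (λ x → x := :1 :* :1 :* x) refl _) (sym (symmetricPart-schur k a b)))
        divides : ∀ a i → i ≢ a → X a - X i ∣ M a a - symmetricPart k a a
        divides a i i≢a = ∣-respʳ (trans (+-congʳ (+-congˡ (-‿cong (off i≢a))))
            (solve 3 (λ m s t → (m :- t) :- (s :- t) := m :- s) refl (M a a) (symmetricPart k a a)
              (symmetricPart k i a)))
          (∣-difference (rows a i a) (∣-respʳ (∑-difference (Λ n) _ _) (∣∑ (Λ n) λ μ →
            ∣-respʳ (solve 3 (λ k x y → k :* (x :- y) := k :* x :- k :* y) refl (k μ) (Θ μ a a) (Θ μ i a))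
              (∣*ˡ (k μ) (rows-Θ μ a i a)))))

      nzd-E : ∀ a → NonZeroDivisor (E a)
      nzd-E = nzd-node-product

    module TypeB where
      y E : Fin n → Carrier
      y a = X a ^ 2
      E a = X a * ∏ (otherIndices a) (λ i → X a ^ 2 - X i ^ 2)

      factors : ∀ a b → linear true a b * linear false a b ≈ y a - y b
      factors a b = solve 2 (λ x y → (x :- y) :* (x :+ y) := x :* (x :* :1) :- y :* (y :* :1)) refl (X a) (X b)

      minus∣y-y : ∀ a b → X a - X b ∣ y a - y b
      minus∣y-y a b = X a + X b , sym (factors a b)

      plus∣y-y : ∀ a b → X a + X b ∣ y a - y b
      plus∣y-y a b = X a - X b , trans (sym (factors a b)) (*-comm _ _)

      signs-coprime : ∀ {a b} → a ≢ b → Coprime (linear false a b) (linear true a b)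
      signs-coprime a≢b = coprime-sym (nzd-linear true a≢b) (coprime-signs a≢b)

      y-y∣ : ∀ {a b d} → a ≢ b → X a - X b ∣ d → X a + X b ∣ d → y a - y b ∣ d
      y-y∣ {a} {b} a≢b h k = ∣-resp (factors a b) refl (coprime-∣* (signs-coprime a≢b) h k)

      separated : Separated y
      separated {a} {b} a≢b = nzd-resp (factors a b) (nzd-* (nzd-linear true a≢b) (nzd-linear false a≢b))

      independent-differences : IndependentDifferences y
      independent-differences {a} {b} {i} {j} a≢b i≢j ne ne′ = coprime-resp (factors i j) (factors a b)
        (coprime-*ˡ (coprime-*ʳ (coprime-forms true true a≢b i≢j ne ne′) (coprime-forms true false a≢b i≢j ne ne′))
                    (coprime-*ʳ (coprime-forms false true a≢b i≢j ne ne′) (coprime-forms false false a≢b i≢j ne ne′))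
                    (signs-coprime i≢j))

      open Weighted X y E separated public

      -- With s and t the Schur values of rows a and b, x_a s ∓ x_b t = (x_a ∓ x_b) s ± x_b (s - t),
      -- and s - t is divisible by x_a² - x_b².
      rows-Θ : ∀ μ → RowsB (Θ μ)
      rows-Θ μ =
        (λ a j → X j * s a j , *-assoc _ _ _) ,
        (λ a b j → ∣-respʳ
          (solve 5 (λ x y z s t → z :* ((x :- y) :* s :+ y :* (s :- t)) := x :* z :* s :- y :* z :* t) refl
            (X a) (X b) (X j) (s a j) (s b j))
          (∣*ˡ (X j) (∣+ (s a j , refl) (∣*ˡ (X b) (∣-trans (minus∣y-y a b)
            (schur-difference (y a) (y b) (y j) μ)))))) ,
        (λ a b j → ∣-respʳ
          (solve 5 (λ x y z s t → z :* ((x :+ y) :* s :- y :* (s :- t)) := x :* z :* s :+ y :* z :* t) refl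
            (X a) (X b) (X j) (s a j) (s b j))
          (∣*ˡ (X j) (∣-difference (s a j , refl) (∣*ˡ (X b)
            (∣-trans (plus∣y-y a b) (schur-difference (y a) (y b) (y j) μ))))))
        where
        s : Matrix
        s a b = schur (y a) (y b) μ

      y-y∣E : ∀ {a b} → a ≢ b → y a - y b ∣ E a
      y-y∣E {a} {b} a≢b = ∣*ˡ (X a) (∣∏ (λ i → X a ^ 2 - X i ^ 2) (∈-otherIndices λ b≡a → a≢b (≡.sym b≡a)))

      y-y∣E′ : ∀ {a b} → a ≢ b → y a - y b ∣ E b
      y-y∣E′ {a} {b} a≢b = ∣-resp (solve 2 (λ x y → :- (x :- y) := y :- x) refl (y b) (y a)) refl
        (-∣ (y-y∣E λ b≡a → a≢b (≡.sym b≡a)))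

      rows-diagonal : ∀ k → RowsB (diagonal k (E k))
      rows-diagonal k =
        (λ a j → ∣diagonal (E k) a j λ { ≡.refl → _ , refl }) ,
        (λ a b j → minus a b j (a Fin.≟ b)) ,
        (λ a b j → plus a b j (a Fin.≟ b))
        where
        minus : ∀ a b j → Dec (a ≡ b) → X a - X b ∣ diagonal k (E k) a j - diagonal k (E k) b j
        minus a b j (yes ≡.refl) = ∣x-x _
        minus a b j (no a≢b) = ∣-difference
          (∣diagonal (E k) a j λ { ≡.refl → ∣-trans (minus∣y-y a b) (y-y∣E a≢b) })
          (∣diagonal (E k) b j λ { ≡.refl → ∣-trans (minus∣y-y a b) (y-y∣E′ a≢b) })
        plus : ∀ a b j → Dec (a ≡ b) → X a + X b ∣ diagonal k (E k) a j + diagonal k (E k) b j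
        -- At a = b the clause reads 2 x_a ∣ 2 M_aj, which is the condition at the coordinate
        -- hyperplane, doubled.
        plus a b j (yes ≡.refl) = ∣-double (∣diagonal (E k) a j λ { ≡.refl → _ , refl })
        plus a b j (no a≢b) = ∣+
          (∣diagonal (E k) a j λ { ≡.refl → ∣-trans (plus∣y-y a b) (y-y∣E a≢b) })
          (∣diagonal (E k) b j λ { ≡.refl → ∣-trans (plus∣y-y a b) (y-y∣E′ a≢b) })

      nzd-E : ∀ a → NonZeroDivisor (E a)
      nzd-E a = nzd-* (nzd-X a) (nzd-node-product a)

      spans : ∀ M → Symmetric M → RowsB M → ∃ λ e → ∃ λ k → ∀ a b → M a b ≈ diagonalPart e a b + symmetricPart k a b
      -- E_a is x_a times the product of the y_a - y_i. As x_a is coprime to every factor of each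
      -- y_a - y_i, divisibility by x_a and by that product can be shown separately.
      spans M M-sym (rows , rows⁻ , rows⁺) = _ , k , proj₂ (decompose M k off λ a → coprime-∣*
          (coprime-sym (nzd-X a) (coprime-∏ _ (All.map (λ {i} i≢a → coprime-resp refl (factors a i)
            (coprime-*ʳ (coprime-X-form true a λ e → i≢a (≡.sym e)) (coprime-X-form false a λ e → i≢a (≡.sym e))))
            (All.all-filter (λ i → ¬? (i Fin.≟ a)) (List.allFin n)))))
          (∣-difference (rows a a) (∣∑ (Λ n) λ μ → ∣*ˡ (k μ) (proj₁ (rows-Θ μ) a a)))
          (node-product∣ independent-differences a λ {i} i≢a → y-y∣ (λ e → i≢a (≡.sym e)) (divides⁻ a i i≢a)
            (divides⁺ a i i≢a)))
        where
        -- On the diagonal x_a x_b is a square, which need not divide M_aa, so the value there is a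
        -- dummy.
        quotient-at : ∀ a b → Dec (a ≡ b) → ∃ λ q → a ≢ b → M a b ≈ X a * X b * q
        quotient-at a b (yes a≡b) = 0# , λ a≢b → contradiction a≡b a≢b
        quotient-at a b (no a≢b) with coprime-∣* (coprime-X λ e → a≢b (≡.sym e)) (rows a b)
          (∣-respʳ (M-sym b a) (rows b a))
        ... | q , eq = q , λ _ → eq
        f : Matrix
        f a b = proj₁ (quotient-at a b (a Fin.≟ b))
        f-eq : ∀ {a b} → a ≢ b → M a b ≈ X a * X b * f a b
        f-eq {a} {b} = proj₂ (quotient-at a b (a Fin.≟ b))
        f-sym : ∀ {a b} → a ≢ b → f a b ≈ f b a
        f-sym {a} {b} a≢b = nzd-cancel (nzd-* (nzd-X a) (nzd-X b))
          (trans (sym (f-eq a≢b)) (trans (M-sym a b) (trans (f-eq λ e → a≢b (≡.sym e)) (*-congʳ (*-comm _ _)))))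
        -- For either sign, (M_aj ∓ M_bj) - x_j (x_a ∓ x_b) f_bj = x_j x_a (f_aj - f_bj). The linear
        -- form is coprime to x_j and x_a, so both signs divide the same difference.
        f-rows : ∀ {a b j} → a ≢ b → a ≢ j → b ≢ j → y a - y b ∣ f a j - f b j
        f-rows {a} {b} {j} a≢b a≢j b≢j = y-y∣ a≢b
          (cancel true (∣-respʳ
            (trans (+-congʳ (+-cong (f-eq a≢j) (-‿cong (f-eq b≢j))))
              (solve 5 (λ x y z s t → (x :* z :* s :- y :* z :* t) :- z :* ((x :- y) :* t) := z :*
                (x :* (s :- t))) refl
                (X a) (X b) (X j) (f a j) (f b j)))
            (∣-difference (rows⁻ a b j) (∣*ˡ (X j) (f b j , refl)))))
          (cancel false (∣-respʳ
            (trans (+-congʳ (+-cong (f-eq a≢j) (f-eq b≢j)))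
              (solve 5 (λ x y z s t → (x :* z :* s :+ y :* z :* t) :- z :* ((x :+ y) :* t) := z :*
                (x :* (s :- t))) refl
                (X a) (X b) (X j) (f a j) (f b j)))
            (∣-difference (rows⁺ a b j) (∣*ˡ (X j) (f b j , refl)))))
          where
          cancel : ∀ s {x} → linear s a b ∣ X j * (X a * x) → linear s a b ∣ x
          cancel s h = coprime-sym (nzd-X a) (coprime-X-form s a a≢b) _
            (coprime-sym (nzd-X j) (coprime-X-form s j a≢b) _ h)
        interpolation = schur-spans separated nzd-2 independent-differences f f-sym f-rows
        k = proj₁ interpolation
        off : ∀ {a b} → a ≢ b → M a b ≈ symmetricPart k a b
        off {a} {b} a≢b = trans (f-eq a≢b) (trans (*-congˡ (proj₂ interpolation a≢b))
          (sym (symmetricPart-schur k a b)))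
        divides⁻ : ∀ a i → i ≢ a → X a - X i ∣ M a a - symmetricPart k a a
        divides⁻ a i i≢a = ∣-respʳ (trans (+-congʳ (+-congˡ (-‿cong (off i≢a))))
            (solve 3 (λ m s t → (m :- t) :- (s :- t) := m :- s) refl (M a a) (symmetricPart k a a)
              (symmetricPart k i a)))
          (∣-difference (rows⁻ a i a) (∣-respʳ (∑-difference (Λ n) _ _) (∣∑ (Λ n) λ μ →
            ∣-respʳ (solve 3 (λ k x y → k :* (x :- y) := k :* x :- k :* y) refl (k μ) (Θ μ a a) (Θ μ i a))
              (∣*ˡ (k μ) (proj₁ (proj₂ (rows-Θ μ)) a i a)))))
        divides⁺ : ∀ a i → i ≢ a → X a + X i ∣ M a a - symmetricPart k a a
        divides⁺ a i i≢a = ∣-respʳ (trans (+-congʳ (+-congˡ (off i≢a)))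
            (solve 3 (λ m s t → (m :+ t) :- (s :+ t) := m :- s) refl (M a a) (symmetricPart k a a)
              (symmetricPart k i a)))
          (∣-difference (rows⁺ a i a) (∣-respʳ (∑-+ (Λ n) _ _) (∣∑ (Λ n) λ μ →
            ∣-respʳ (solve 3 (λ k x y → k :* (x :+ y) := k :* x :+ k :* y) refl (k μ) (Θ μ a a) (Θ μ i a))
              (∣*ˡ (k μ) (proj₂ (proj₂ (rows-Θ μ)) a i a)))))

-- Multi-indices of size two

sum-+ : ∀ {n} (α β : Vec ℕ n) → Vec.sum (Vec.zipWith ℕ._+_ α β) ≡ Vec.sum α ℕ.+ Vec.sum β
sum-+ []      []      = ≡.refl
sum-+ (a ∷ α) (b ∷ β) = ≡.trans (≡.cong (a ℕ.+ b ℕ.+_) (sum-+ α β)) (interchange a b (Vec.sum α) (Vec.sum β))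
  where
  open import Algebra.Properties.CommutativeSemigroup ℕ.+-commutativeSemigroup using (interchange)

sum-0 : ∀ n → Vec.sum (Vec.replicate n 0) ≡ 0
sum-0 zero    = ≡.refl
sum-0 (suc n) = sum-0 n

sum-unit : ∀ {n} (i : Fin n) → Vec.sum (unit i) ≡ 1
sum-unit {suc n} zero    = ≡.cong suc (sum-0 n)
sum-unit         (suc i) = sum-unit i

unit-injective : ∀ {n} {i j : Fin n} → unit i ≡ unit j → i ≡ j
unit-injective {i = i} {j} e with i Fin.≟ j
... | yes i≡j = i≡j
... | no i≢j with () ← ≡.trans (≡.sym (lookup-unit i)) (≡.trans (≡.cong (λ α → Vec.lookup α i) e) (lookup-unit-≢ i≢j))

units-injective : ∀ {n} {i j a b : Fin n} → Vec.zipWith ℕ._+_ (unit i) (unit j) ≡ Vec.zipWith ℕ._+_ (unit a)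
  (unit b) →
                  (i ≡ a × j ≡ b) ⊎ (i ≡ b × j ≡ a)
units-injective {i = i} {j} {a} {b} e with i Fin.≟ a | i Fin.≟ b
... | yes ≡.refl | _ = inj₁ (≡.refl , unit-injective (+ᵛ-cancelˡ (unit i) _ _ e))
... | no _ | yes ≡.refl = inj₂ (≡.refl , unit-injective (+ᵛ-cancelˡ (unit i) _ _
  (≡.trans e (Vec.zipWith-comm ℕ.+-comm (unit a) (unit i)))))
... | no i≢a | no i≢b with () ← ≡.trans
  (≡.sym (≡.trans (lookup-+ (unit i) (unit j) i) (≡.cong (ℕ._+ Vec.lookup (unit j) i) (lookup-unit i))))
  (≡.trans (≡.cong (λ α → Vec.lookup α i) e)
    (≡.trans (lookup-+ (unit a) (unit b) i) (≡.cong₂ ℕ._+_ (lookup-unit-≢ i≢a) (lookup-unit-≢ i≢b))))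

0ᵛ-! : ∀ n → Vec.replicate n 0 !ᵛ ≡ 1
0ᵛ-! zero    = ≡.refl
0ᵛ-! (suc n) = ≡.trans (ℕ.*-identityˡ _) (0ᵛ-! n)

unit-! : ∀ {n} (i : Fin n) → unit i !ᵛ ≡ 1
unit-! {suc n} zero    = ≡.trans (ℕ.*-identityˡ _) (0ᵛ-! n)
unit-!         (suc i) = ≡.trans (ℕ.*-identityˡ _) (unit-! i)

0ᵛ-+ : ∀ {n} (α : Vec ℕ n) → Vec.zipWith ℕ._+_ (Vec.replicate n 0) α ≡ α
0ᵛ-+ = Vec.zipWith-identityˡ ℕ.+-identityˡ

units-!-≡ : ∀ {n} (i : Fin n) → Vec.zipWith ℕ._+_ (unit i) (unit i) !ᵛ ≡ 2
units-!-≡ {suc n} zero    = ≡.cong (2 ℕ.*_) (≡.trans (≡.cong _!ᵛ (0ᵛ-+ (Vec.replicate n 0))) (0ᵛ-! n))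
units-!-≡         (suc i) = ≡.trans (ℕ.*-identityˡ _) (units-!-≡ i)

units-!-≢ : ∀ {n} {i j : Fin n} → i ≢ j → Vec.zipWith ℕ._+_ (unit i) (unit j) !ᵛ ≡ 1
units-!-≢ {i = zero}  {zero}  i≢j = contradiction ≡.refl i≢j
units-!-≢ {i = zero}  {suc j} i≢j = ≡.trans (ℕ.*-identityˡ _) (≡.trans (≡.cong _!ᵛ (0ᵛ-+ (unit j))) (unit-! j))
units-!-≢ {i = suc i} {zero}  i≢j = ≡.trans (ℕ.*-identityˡ _)
  (≡.trans (≡.cong _!ᵛ (≡.trans (Vec.zipWith-comm ℕ.+-comm (unit i) _) (0ᵛ-+ (unit i)))) (unit-! i))
units-!-≢ {i = suc i} {suc j} i≢j = ≡.trans (ℕ.*-identityˡ _) (units-!-≢ λ e → i≢j (≡.cong suc e))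

foldr-map-suc : ∀ {a n m} {A : Set a} (E : Fin (suc n) → A → A) f (v : Vec (Fin n) m) →
                Vec.foldr′ E f (Vec.map suc v) ≡ Vec.foldr′ (λ i → E (suc i)) f v
foldr-map-suc E f []      = ≡.refl
foldr-map-suc E f (i ∷ v) = ≡.cong (E (suc i)) (foldr-map-suc E f v)

foldr-replicate-++ : ∀ {a b m} {A : Set a} {B : Set b} (E : B → A → A) f x k (v : Vec B m) →
                     Vec.foldr′ E f (Vec.replicate k x Vec.++ v) ≡ fold (Vec.foldr′ E f v) (E x) k
foldr-replicate-++ E f x zero    v = ≡.refl
foldr-replicate-++ E f x (suc k) v = ≡.cong (E x) (foldr-replicate-++ E f x k v)

foldr-cast : ∀ {a b m n} {A : Set a} {B : Set b} (E : B → A → A) f .(e : m ≡ n) (v : Vec B m) →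
             Vec.foldr′ E f (Vec.cast e v) ≡ Vec.foldr′ E f v
foldr-cast {n = zero}  E f e []      = ≡.refl
foldr-cast {n = suc n} E f e (x ∷ v) = ≡.cong (E x) (foldr-cast E f (ℕ.suc-injective e) v)

-- Identifies iteration over the variables with multiplicities, as in `∂^`, with iteration over the
-- positions, as in x_α; for size two both become an ordered pair of indices.
foldr-repeated : ∀ {a n} {A : Set a} (α : Vec ℕ n) (E : Fin n → A → A) f →
  List.foldr (λ i g → fold g (E i) (Vec.lookup α i)) f (List.allFin n) ≡ Vec.foldr′ E f (repeated α)
foldr-repeated {n = zero} [] E f = ≡.refl
foldr-repeated {n = suc n} (a ∷ α) E f = begin
  fold (List.foldr step f (List.tabulate suc)) (E zero) a
    ≡⟨ ≡.cong (λ is → fold (List.foldr step f is) (E zero) a) (List.map-tabulate (λ i → i) suc) ⟨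
  fold (List.foldr step f (List.map suc (List.allFin n))) (E zero) a
    ≡⟨ ≡.cong (λ z → fold z (E zero) a) (foldr-map (List.allFin n)) ⟩
  fold (List.foldr (λ i → step (suc i)) f (List.allFin n)) (E zero) a
    ≡⟨ ≡.cong (λ z → fold z (E zero) a) (foldr-repeated α (λ i → E (suc i)) f) ⟩
  fold (Vec.foldr′ (λ i → E (suc i)) f (repeated α)) (E zero) a
    ≡⟨ ≡.cong (λ z → fold z (E zero) a) (foldr-map-suc E f (repeated α)) ⟨
  fold (Vec.foldr′ E f (Vec.map suc (repeated α))) (E zero) a
    ≡⟨ foldr-replicate-++ E f zero a (Vec.map suc (repeated α)) ⟨
  Vec.foldr′ E f (repeated (a ∷ α)) ∎
  where
  open ≡.≡-Reasoning
  step = λ i g → fold g (E i) (Vec.lookup (a ∷ α) i)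
  foldr-map : ∀ is → List.foldr step f (List.map suc is) ≡ List.foldr (λ i → step (suc i)) f is
  foldr-map []       = ≡.refl
  foldr-map (i ∷ is) = ≡.cong (step (suc i)) (foldr-map is)

sum-units-repeated : ∀ {n} (α : Vec ℕ n) → α ≡ Vec.foldr′ (λ i → Vec.zipWith ℕ._+_ (unit i)) (Vec.replicate n 0)
  (repeated α)
sum-units-repeated []      = ≡.refl
sum-units-repeated {suc n} (a ∷ α) = ≡.sym (begin
  Vec.foldr′ E (0 ∷ Vec.replicate n 0) (repeated (a ∷ α))
    ≡⟨ foldr-replicate-++ E (0 ∷ Vec.replicate n 0) zero a (Vec.map suc (repeated α)) ⟩
  fold (Vec.foldr′ E (0 ∷ Vec.replicate n 0) (Vec.map suc (repeated α))) (E zero) a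
    ≡⟨ ≡.cong (λ z → fold z (E zero) a) (≡.trans (foldr-map-suc E _ (repeated α)) (tail-only (repeated α))) ⟩
  fold (0 ∷ Vec.foldr′ (λ i → Vec.zipWith ℕ._+_ (unit i)) (Vec.replicate n 0) (repeated α)) (E zero) a
    ≡⟨ ≡.cong (λ z → fold (0 ∷ z) (E zero) a) (sum-units-repeated α) ⟨
  fold (0 ∷ α) (E zero) a
    ≡⟨ head-only a ⟩
  a ∷ α ∎)
  where
  open ≡.≡-Reasoning
  E : Fin (suc n) → Vec ℕ (suc n) → Vec ℕ (suc n)
  E i = Vec.zipWith ℕ._+_ (unit i)
  tail-only : ∀ {m} (v : Vec (Fin n) m) → Vec.foldr′ (λ i → E (suc i)) (0 ∷ Vec.replicate n 0) v ≡
                                         0 ∷ Vec.foldr′ (λ i → Vec.zipWith ℕ._+_ (unit i)) (Vec.replicate n 0) v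
  tail-only []      = ≡.refl
  tail-only (i ∷ v) = ≡.cong (E (suc i)) (tail-only v)
  head-only : ∀ k → fold (0 ∷ α) (E zero) k ≡ k ∷ α
  head-only zero    = ≡.refl
  head-only (suc k) = ≡.trans (≡.cong (E zero) (head-only k)) (≡.cong (suc k ∷_) (0ᵛ-+ α))

positions : ∀ {ℓ m} → MultiIndex ℓ m → Vec (Fin ℓ) m
positions (mkMultiIndex α e) = Vec.cast e (repeated α)

module _ {ℓ : ℕ} where

  first second : MultiIndex ℓ 2 → Fin ℓ
  first  α = Vec.lookup (positions α) zero
  second α = Vec.lookup (positions α) (suc zero)

  foldr-pair : ∀ {a} {A : Set a} (α : MultiIndex ℓ 2) (E : Fin ℓ → A → A) f →
               Vec.foldr′ E f (repeated (exponents α)) ≡ E (first α) (E (second α) f)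
  foldr-pair α@(mkMultiIndex α′ e) E f = ≡.trans (≡.sym (foldr-cast E f e (repeated α′)))
    (two (Vec.cast e (repeated α′)))
    where
    two : ∀ v → Vec.foldr′ E f v ≡ E (Vec.lookup v zero) (E (Vec.lookup v (suc zero)) f)
    two (i ∷ j ∷ []) = ≡.refl

  exponents-pair : ∀ α → exponents α ≡ Vec.zipWith ℕ._+_ (unit (first α)) (unit (second α))
  exponents-pair α = ≡.trans (sum-units-repeated (exponents α)) (≡.trans
    (foldr-pair α (λ i → Vec.zipWith ℕ._+_ (unit i)) (Vec.replicate ℓ 0))
    (≡.cong (Vec.zipWith ℕ._+_ (unit (first α))) (Vec.zipWith-identityʳ ℕ.+-identityʳ (unit (second α)))))

  pairIndex : Fin ℓ → Fin ℓ → MultiIndex ℓ 2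
  pairIndex a b = mkMultiIndex (Vec.zipWith ℕ._+_ (unit a) (unit b))
    (≡.trans (sum-+ (unit a) (unit b)) (≡.cong₂ ℕ._+_ (sum-unit a) (sum-unit b)))

exponents-injective : ∀ {ℓ m} {α β : MultiIndex ℓ m} → exponents α ≡ exponents β → α ≡ β
exponents-injective ≡.refl = ≡.refl

module _ {c e} (S : CommutativeRing c e) where
  open CommutativeRing S hiding (zero)
  open ListSums S

  -- This expresses that `multiIndices` contains α exactly once. The comparison is by exponents,
  -- which determine a multi-index because its size proof is irrelevant.
  ∑-multiIndices-single : ∀ ℓ m (α : MultiIndex ℓ m) F → (∀ β → exponents β ≢ exponents α → F β ≈ 0#) →
                          ∑ (multiIndices ℓ m) F ≈ F α
  private
    module _ (ℓ m : ℕ) (α : MultiIndex (suc ℓ) m) (F : MultiIndex (suc ℓ) m → Carrier)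
             (h : ∀ β → exponents β ≢ exponents α → F β ≈ 0#)
             (ih : ∀ {m} (α : MultiIndex ℓ m) F → (∀ β → exponents β ≢ exponents α → F β ≈ 0#) →
                   ∑ (multiIndices ℓ m) F ≈ F α)
             -- Stands for the function `cons` local to `multiIndices`; unification supplies it at
             -- the call below.
             (prepend : (a : Fin (suc m)) → MultiIndex ℓ (m ℕ.∸ toℕ a) → MultiIndex (suc ℓ) m)
             (exponents-prepend : ∀ a β → exponents (prepend a β) ≡ toℕ a ∷ exponents β) where

      row : Fin (suc m) → List (MultiIndex (suc ℓ) m)
      row a = List.map (prepend a) (multiIndices ℓ (m ℕ.∸ toℕ a))

      row-spec : ∀ a → ∑ (row a) F ≈ ∑ (multiIndices ℓ (m ℕ.∸ toℕ a)) (λ β → F (prepend a β))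
      row-spec a = reflexive (∑-map (prepend a) (multiIndices ℓ (m ℕ.∸ toℕ a)) F)

      single : ∀ {a β} → exponents (prepend a β) ≡ exponents α → ∑ (List.concatMap row (List.allFin (suc m))) F ≈ F α
      single {a} {β} eq = begin
        ∑ (List.concatMap row (List.allFin (suc m))) F
          ≈⟨ ∑-concatMap row (List.allFin (suc m)) F ⟩
        ∑ (List.allFin (suc m)) (λ a → ∑ (row a) F)
          ≈⟨ ∑-allFin-single a (λ a′ a′≢a → trans (row-spec a′)
            (∑-zero (multiIndices ℓ (m ℕ.∸ toℕ a′)) λ β′ → h _ λ eq′ →
               a′≢a (Fin.toℕ-injective (proj₁ (same eq′))))) ⟩
        ∑ (row a) F
          ≈⟨ trans (row-spec a) (ih β (λ β → F (prepend a β)) λ β′ β′≢β → h _ λ eq′ → β′≢β (proj₂ (same eq′))) ⟩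
        F (prepend a β)
          ≡⟨ ≡.cong F (exponents-injective eq) ⟩
        F α ∎
        where
        open import Relation.Binary.Reasoning.Setoid setoid
        same : ∀ {a′ β′} → exponents (prepend a′ β′) ≡ exponents α → toℕ a′ ≡ toℕ a × exponents β′ ≡ exponents β
        same {a′} {β′} eq′ = Vec.∷-injective (≡.trans (≡.sym (exponents-prepend a′ β′))
          (≡.trans eq′ (≡.trans (≡.sym eq) (exponents-prepend a β))))

  ∑-multiIndices-single zero    zero    (mkMultiIndex [] _) F h = +-identityʳ _
  ∑-multiIndices-single zero    (suc m) (mkMultiIndex [] ()) F h
  ∑-multiIndices-single (suc ℓ) m α@(mkMultiIndex (a ∷ α′) s) F h =
    single ℓ m α F h (∑-multiIndices-single ℓ _) _ (λ _ _ → ≡.refl) {a′} {mkMultiIndex α′ sum-α′}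
      (≡.cong (_∷ α′) toℕ-a′)
    where
    s′ : a ℕ.+ Vec.sum α′ ≡ m
    s′ = recompute (_ ℕ.≟ _) s
    a<1+m : a ℕ.< suc m
    a<1+m = ℕ.s≤s (ℕ.≤-trans (ℕ.m≤m+n a (Vec.sum α′)) (ℕ.≤-reflexive s′))
    a′ : Fin (suc m)
    a′ = Fin.fromℕ< a<1+m
    toℕ-a′ : toℕ a′ ≡ a
    toℕ-a′ = Fin.toℕ-fromℕ< a<1+m
    sum-α′ : Vec.sum α′ ≡ m ℕ.∸ toℕ a′
    sum-α′ = ≡.trans (≡.sym (ℕ.m+n∸m≡n a (Vec.sum α′))) (≡.cong₂ ℕ._∸_ s′ (≡.sym toℕ-a′))

-- Preservation of Q S as a condition on the matrix

increasing : ∀ ℓ → List (Fin ℓ × Fin ℓ)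
increasing ℓ = List.filter (λ (i , j) → i Fin.<? j) (List.cartesianProduct (List.allFin ℓ) (List.allFin ℓ))

∈-increasing : ∀ {ℓ} {a b : Fin ℓ} → a Fin.< b → (a , b) ∈ increasing ℓ
∈-increasing a<b = Membership.∈-filter⁺ (λ (i , j) → i Fin.<? j)
  (Membership.∈-cartesianProduct⁺ (Membership.∈-allFin _) (Membership.∈-allFin _)) a<b

increasing⇒< : ∀ ℓ → All (λ (i , j) → i Fin.< j) (increasing ℓ)
increasing⇒< ℓ = All.all-filter (λ (i , j) → i Fin.<? j) (List.cartesianProduct (List.allFin ℓ) (List.allFin ℓ))

increasing-unique : ∀ ℓ → Unique (increasing ℓ)
increasing-unique ℓ = Unique.filter⁺ (λ (i , j) → i Fin.<? j)
  (Unique.cartesianProduct⁺ (Unique.allFin⁺ ℓ) (Unique.allFin⁺ ℓ))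

-- One half yields G_pp = 0 from 2 G_pp = 0, separates x_a - x_b from x_a + x_b, and allows the
-- factor 2 to be cancelled from the diagonal of `matrix`.
IsHalf : ∀ {r ℓr} (R : CommutativeRing r ℓr) → CommutativeRing.Carrier R → Set ℓr
IsHalf R ½ = (1# + 1#) * ½ ≈ 1#
  where open CommutativeRing R

module LogarithmicOperators {r ℓr} (R : CommutativeRing r ℓr) (½ : CommutativeRing.Carrier R)
  (½-inverse : IsHalf R ½) (ℓ : ℕ) where
  open Polynomials R ℓ
  private
    module R where
      open CommutativeRing R public
      open IntegerRingSolver R public
      open import Algebra.Properties.Ring (CommutativeRing.ring R) public using (-‿involutive)
  open CommutativeRing polynomialRing hiding (zero)
  open IntegerRingSolver polynomialRing
  open Divisibility polynomialRing
  open ListSums polynomialRing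
  open PolynomialProperties R ℓ hiding (nzd-linear)
  open Substitution R ℓ hiding (coprime-forms; coprime-X-form)
  private module Sub = Substitution R ℓ
  open RowConditions polynomialRing X
  open import Algebra.Properties.Semiring.Exp semiring using (_^_)
  open import Relation.Binary.Reasoning.Setoid setoid

  sign : Bool → R.Carrier
  sign true  = R.1#
  sign false = R.- R.1#

  sign-unit : ∀ s → sign s R.* sign s R.≈ R.1#
  sign-unit true  = R.*-identityˡ _
  sign-unit false = R.solve 0 (R.:- R.:1 R.:* R.:- R.:1 R.:= R.:1) R.refl

  form≈linear : ∀ s a b → form (sign s) a b ≈ linear s a b
  form≈linear true  a b = solve 2 (λ x y → x :- :1 :* y := x :- y) refl (X a) (X b)
  form≈linear false a b = trans (+-congˡ {X a} (-‿cong (*-congʳ {X b} (C-neg R.1#))))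
    (solve 2 (λ x y → x :- (:- :1) :* y := x :+ y) refl (X a) (X b))

  coprimeForms : CoprimeForms
  coprimeForms = record
    { nzd-2 = nzd-resp (C-+ R.1# R.1#) (nzd-C ½-inverse)
    ; nzd-X = nzd-X
    ; nzd-linear = λ s {a} {b} a≢b → nzd-resp (form≈linear s a b) (nzd-form (sign s) a≢b)
    ; coprime-X = coprime-X-X
    ; coprime-X-form = λ s a {b} {c} b≢c → coprime-resp {X a} {X a} {form (sign s) b c} {linear s b c} refl
      (form≈linear s b c)
        (Sub.coprime-X-form (sign-unit s) b≢c)
    ; coprime-signs = λ {a} {b} a≢b → coprime-resp {form (sign true) a b} {linear true a b}
      {form (sign false) a b} {linear false a b}
        (form≈linear true a b) (form≈linear false a b)
        (coprime-same-variables (R.trans (R.*-congʳ (R.+-congˡ (R.-‿involutive _))) ½-inverse) a≢b)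
    ; coprime-forms = λ s t {a} {b} {i} {j} a≢b i≢j ne ne′ →
        coprime-resp {form (sign s) i j} {linear s i j} {form (sign t) a b} {linear t a b} (form≈linear s i j)
          (form≈linear t a b)
        (Sub.coprime-forms (sign-unit s) i≢j a≢b (λ (e , e′) → ne (≡.sym e , ≡.sym e′))
          (λ (e , e′) → ne′ (≡.sym e′ , ≡.sym e)))
    }
  open CoprimeForms coprimeForms hiding (nzd-X)

  ∂^ : Vec ℕ ℓ → Poly → Poly
  ∂^ α f = List.foldr (λ i g → fold g (∂ i) (Vec.lookup α i)) f (List.allFin ℓ)

  ∂^-pair : ∀ (α : MultiIndex ℓ 2) f → ∂^ (exponents α) f ≡ ∂ (first α) (∂ (second α) f)
  ∂^-pair α f = ≡.trans (foldr-repeated (exponents α) ∂ f) (foldr-pair α ∂ f)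

  open SecondOrderOperators.Action polynomialRing ∂ ∂-cong ∂-+ leibniz (multiIndices ℓ 2) first second
    (λ α → ∂^ (exponents α)) (λ α f → reflexive (∂^-pair α f))

  kronecker : Fin ℓ → Fin ℓ → Poly
  kronecker i a = if does (i Fin.≟ a) then 1# else 0#

  kronecker-≡ : ∀ a → kronecker a a ≈ 1#
  kronecker-≡ a = reflexive (≡.cong (if_then 1# else 0#) (dec-true (a Fin.≟ a) ≡.refl))

  kronecker-≢ : ∀ {i a} → i ≢ a → kronecker i a ≈ 0#
  kronecker-≢ {i} {a} i≢a = reflexive (≡.cong (if_then 1# else 0#) (dec-false (i Fin.≟ a) i≢a))

  ∂-X-kronecker : ∀ i a → ∂ i (X a) ≈ kronecker i a
  ∂-X-kronecker i a with i Fin.≟ a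
  ... | yes ≡.refl = ∂-X i
  ... | no i≢a = ∂-X-≢ i≢a

  ∂∂-X : ∀ i j a → ∂ i (∂ j (X a)) ≈ 0#
  ∂∂-X i j a = trans (∂-cong i (∂-X-kronecker j a)) constant
    where
    constant : ∂ i (kronecker j a) ≈ 0#
    constant with j Fin.≟ a
    ... | yes _ = ∂-C i R.1#
    ... | no  _ = refl

  -- The factorial α! for the exponent α of x_a x_b.
  multiplicity : Fin ℓ → Fin ℓ → Poly
  multiplicity a b = if does (a Fin.≟ b) then 1# + 1# else 1#

  multiplicity-≡ : ∀ a → multiplicity a a ≈ 1# + 1#
  multiplicity-≡ a = reflexive (≡.cong (if_then 1# + 1# else 1#) (dec-true (a Fin.≟ a) ≡.refl))

  multiplicity-≢ : ∀ {a b} → a ≢ b → multiplicity a b ≈ 1#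
  multiplicity-≢ {a} {b} a≢b = reflexive (≡.cong (if_then 1# + 1# else 1#) (dec-false (a Fin.≟ b) a≢b))

  -- The values θ(xₐ x_b), that is the coefficients of θ multiplied by α!.
  matrix : (MultiIndex ℓ 2 → Poly) → Matrix
  matrix θ a b = multiplicity a b * θ (pairIndex a b)

  cross-X : ∀ α a b → cross α (X a) (X b) ≈ kronecker (first α) a * kronecker (second α) b + kronecker
    (second α) a * kronecker (first α) b
  cross-X α a b = +-cong (*-cong (∂-X-kronecker (first α) a) (∂-X-kronecker (second α) b))
                         (*-cong (∂-X-kronecker (second α) a) (∂-X-kronecker (first α) b))

  -- Among the cross terms only the multi-index of x_a x_b survives; for a = b its two products
  -- coincide, which gives the multiplicity 2.
  polar-X : ∀ θ a b → polar θ (X a) (X b) ≈ matrix θ a b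
  polar-X θ a b = begin
    polar θ (X a) (X b)
      ≈⟨ ∑-multiIndices-single polynomialRing ℓ 2 (pairIndex a b) (λ α → θ α * cross α (X a) (X b)) other ⟩
    θ (pairIndex a b) * cross (pairIndex a b) (X a) (X b)
      ≈⟨ *-congˡ {θ (pairIndex a b)} (trans (cross-X (pairIndex a b) a b)
        (value (units-injective {i = a} {b} {first (pairIndex a b)} {second (pairIndex a b)}
          (exponents-pair (pairIndex a b))))) ⟩
    θ (pairIndex a b) * multiplicity a b
      ≈⟨ *-comm (θ (pairIndex a b)) (multiplicity a b) ⟩
    matrix θ a b ∎
    where
    product-zero : ∀ {i j c d} → ¬ (i ≡ c × j ≡ d) → kronecker i c * kronecker j d ≈ 0#
    product-zero {i} {j} {c} {d} ne with i Fin.≟ c | j Fin.≟ d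
    ... | no _     | _        = refl
    ... | yes _    | no _     = refl
    ... | yes i≡c | yes j≡d = contradiction (i≡c , j≡d) ne
    other : ∀ α → exponents α ≢ exponents (pairIndex a b) → θ α * cross α (X a) (X b) ≈ 0#
    other α ne = trans (*-congˡ {θ α} (trans (cross-X α a b) (trans (+-cong
      (product-zero λ (e , e′) → ne (≡.trans (exponents-pair α) (≡.cong₂ (λ i j → unit i +ᵉ unit j) e e′)))
      (product-zero λ (e , e′) → ne (≡.trans (exponents-pair α)
        (≡.trans (+ᵉ-comm _ _) (≡.cong₂ (λ i j → unit i +ᵉ unit j) e e′)))))
      (+-identityˡ 0#)))) (zeroʳ (θ α))
    kk : ∀ i j → Dec (i ≡ j) → kronecker i i * kronecker j j + kronecker j i * kronecker i j ≈ multiplicity i j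
    kk i j (yes ≡.refl) = trans (+-cong ones ones) (sym (multiplicity-≡ i))
      where
      ones : kronecker i i * kronecker i i ≈ 1#
      ones = trans (*-cong (kronecker-≡ i) (kronecker-≡ i)) (*-identityˡ 1#)
    kk i j (no i≢j) = trans (+-cong (trans (*-cong (kronecker-≡ i) (kronecker-≡ j)) (*-identityˡ 1#))
                                    (trans (*-congʳ {kronecker i j} (kronecker-≢ λ e → i≢j (≡.sym e)))
                                      (zeroˡ (kronecker i j))))
                      (trans (+-identityʳ 1#) (sym (multiplicity-≢ i≢j)))
    value : ∀ {i j} → (a ≡ i × b ≡ j) ⊎ (a ≡ j × b ≡ i) →
            kronecker i a * kronecker j b + kronecker j a * kronecker i b ≈ multiplicity a b
    value (inj₁ (≡.refl , ≡.refl)) = kk a b (a Fin.≟ b)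
    value (inj₂ (≡.refl , ≡.refl)) = trans (+-comm (kronecker b a * kronecker a b)
      (kronecker a a * kronecker b b)) (kk a b (a Fin.≟ b))

  matrix-sym : ∀ θ → Symmetric (matrix θ)
  matrix-sym θ a b = trans (sym (polar-X θ a b)) (trans (polar-sym θ (X a) (X b)) (polar-X θ b a))

  polar-C : ∀ θ c f → polar θ (C c) f ≈ 0#
  polar-C θ c f = polar-constantˡ θ f λ i → ∂-C i c

  -- The polarisation is a derivation in its second argument, so divisibility at the coordinates
  -- passes to all polynomials.
  ∣polar : ∀ θ {d f} → (∀ j → d ∣ polar θ f (X j)) → ∀ g → d ∣ polar θ f g
  ∣polar θ {d} {f} h g = ∣-respʳ (polar-sym θ g f) (polynomial-induction (λ g → d ∣ polar θ g f)
    (λ {g} {g′} e → ∣-respʳ (polar-congˡ θ f e))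
    (λ c → ∣-respʳ (sym (polar-C θ c f)) (∣0 d))
    (λ i → ∣-respʳ (polar-sym θ f (X i)) (h i))
    (λ {g} {g′} k k′ → ∣-respʳ (sym (polar-+ˡ θ g g′ f)) (∣+ k k′))
    (λ {g} {g′} k k′ → ∣-respʳ (sym (polar-*ˡ θ g g′ f)) (∣+
      (∣*ˡ g k′) (∣*ˡ g′ k)))
    g)

  apply-zero : ∀ θ f → (∀ i j → ∂ i (∂ j f) ≈ 0#) → apply θ f ≈ 0#
  apply-zero θ f e = ∑-zero (multiIndices ℓ 2) λ α → trans
    (*-congˡ {θ α} (trans (reflexive (∂^-pair α f)) (e (first α) (second α)))) (zeroʳ (θ α))

  apply-X : ∀ θ a → apply θ (X a) ≈ 0#
  apply-X θ a = apply-zero θ (X a) λ i j → ∂∂-X i j a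

  apply-linear : ∀ θ s a b → apply θ (linear s a b) ≈ 0#
  apply-linear θ true a b = apply-zero θ (X a - X b) λ i j → begin
    ∂ i (∂ j (X a - X b))  ≈⟨ ∂-cong i (trans (∂-+ j (X a) (- X b)) (+-congˡ {∂ j (X a)} (∂-neg j (X b)))) ⟩
    ∂ i (∂ j (X a) - ∂ j (X b))  ≈⟨ trans (∂-+ i (∂ j (X a)) (- ∂ j (X b)))
      (+-congˡ {∂ i (∂ j (X a))} (∂-neg i (∂ j (X b)))) ⟩
    ∂ i (∂ j (X a)) - ∂ i (∂ j (X b))  ≈⟨ +-cong (∂∂-X i j a) (-‿cong (∂∂-X i j b)) ⟩
    0# - 0#  ≈⟨ -‿inverseʳ 0# ⟩
    0#                                 ∎
  apply-linear θ false a b = apply-zero θ (X a + X b) λ i j → begin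
    ∂ i (∂ j (X a + X b))  ≈⟨ ∂-cong i (∂-+ j (X a) (X b)) ⟩
    ∂ i (∂ j (X a) + ∂ j (X b))  ≈⟨ ∂-+ i (∂ j (X a)) (∂ j (X b)) ⟩
    ∂ i (∂ j (X a)) + ∂ i (∂ j (X b))  ≈⟨ +-cong (∂∂-X i j a) (∂∂-X i j b) ⟩
    0# + 0#  ≈⟨ +-identityˡ 0# ⟩
    0#                                 ∎

  combine : Bool → Poly → Poly → Poly
  combine true  f g = f - g
  combine false f g = f + g

  polar-linear : ∀ θ s a b j → polar θ (linear s a b) (X j) ≈ combine s (matrix θ a j) (matrix θ b j)
  polar-linear θ true a b j = begin
    polar θ (X a - X b) (X j)  ≈⟨ polar-+ˡ θ (X a) (- X b) (X j) ⟩
    polar θ (X a) (X j) + polar θ (- X b) (X j)  ≈⟨ +-congˡ {polar θ (X a) (X j)} (polar-negˡ θ (X b) (X j)) ⟩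
    polar θ (X a) (X j) - polar θ (X b) (X j)    ≈⟨ +-cong (polar-X θ a j) (-‿cong (polar-X θ b j)) ⟩
    matrix θ a j - matrix θ b j                  ∎
  polar-linear θ false a b j = trans (polar-+ˡ θ (X a) (X b) (X j)) (+-cong (polar-X θ a j) (polar-X θ b j))

  Preserves : Poly → (MultiIndex ℓ 2 → Poly) → Set _
  Preserves Q θ = ∀ f → ∃ λ g → apply θ (Q * f) ≈ Q * g

  divides⇒∃ : ∀ {d f} → d ∣ f → ∃ λ g → f ≈ d * g
  divides⇒∃ (g , eq) = g , eq

  ∃⇒divides : ∀ {d f} → (∃ λ g → f ≈ d * g) → d ∣ f
  ∃⇒divides (g , eq) = g , eq

  divides-resp : ∀ {Q Q′} θ → Q ≈ Q′ → (∀ f → Q ∣ apply θ (Q * f)) → ∀ f → Q′ ∣ apply θ (Q′ * f)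
  divides-resp θ e h f = ∣-resp e (apply-cong θ (*-congʳ {f} e)) (h f)

  signedForm : Bool → Fin ℓ × Fin ℓ → Poly
  signedForm s (i , j) = linear s i j

  <⇒≢ : ∀ {i j : Fin ℓ} → i Fin.< j → i ≢ j
  <⇒≢ i<j ≡.refl = ℕ.<-irrefl ≡.refl i<j

  forms-nzd : ∀ s → All (λ p → NonZeroDivisor (signedForm s p)) (increasing ℓ)
  forms-nzd s = All.map (λ i<j → nzd-linear s (<⇒≢ i<j)) (increasing⇒< ℓ)

  coprime-increasing : ∀ s t {a b i j} → a Fin.< b → i Fin.< j → (a , b) ≢ (i , j) → Coprime (linear s a b)
    (linear t i j)
  coprime-increasing s t {a} {b} {i} {j} a<b i<j ne = coprime-forms s t (<⇒≢ i<j) (<⇒≢ a<b)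
    (λ { (≡.refl , ≡.refl) → ne ≡.refl }) (λ { (≡.refl , ≡.refl) → ℕ.<-asym a<b i<j })

  forms-coprime : ∀ s → AllPairs (λ p q → Coprime (signedForm s p) (signedForm s q)) (increasing ℓ)
  forms-coprime s = unique⇒allPairs (coprime-increasing s s) (increasing⇒< ℓ) (increasing-unique ℓ)

  rows-from-increasing : ∀ s {M : Matrix} → (∀ {a b} → a Fin.< b → ∀ j → linear s a b ∣ combine s (M a j) (M b j)) →
                         ∀ {a b} → a ≢ b → ∀ j → linear s a b ∣ combine s (M a j) (M b j)
  rows-from-increasing s {M} h {a} {b} a≢b j with Fin.<-cmp a b
  ... | tri< a<b _ _ = h a<b j
  ... | tri≈ _ a≡b _ = contradiction a≡b a≢b
  ... | tri> _ _ b<a = swap s (h b<a j)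
    where
    swap : ∀ s → linear s b a ∣ combine s (M b j) (M a j) → linear s a b ∣ combine s (M a j) (M b j)
    swap true  h = ∣-resp
      (solve 2 (λ x y → :- (x :- y) := y :- x) refl (X b) (X a))
        (solve 2 (λ x y → :- (x :- y) := y :- x) refl (M b j) (M a j))
      (-∣ (∣- h))
    swap false h = ∣-resp (+-comm (X b) (X a)) (+-comm (M b j) (M a j)) h

  polar-signed : ∀ θ s → (∀ a b j → linear s a b ∣ combine s (matrix θ a j) (matrix θ b j)) →
                 All (λ d → ∀ f → d ∣ polar θ d f) (List.map (signedForm s) (increasing ℓ))
  polar-signed θ s h = All.map⁺ (All.universal (λ (a , b) → ∣polar θ {f = linear s a b} λ j →
    ∣-respʳ (sym (polar-linear θ s a b j)) (h a b j)) (increasing ℓ))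

  apply-signed : ∀ θ s → All (λ d → d ∣ apply θ d) (List.map (signedForm s) (increasing ℓ))
  apply-signed θ s = All.map⁺ (All.universal (λ (a , b) →
    ∣-respʳ (sym (apply-linear θ s a b)) (∣0 (linear s a b))) (increasing ℓ))

  signed-rows : ∀ θ s → (∀ j → All (λ d → d ∣ polar θ d (X j)) (List.map (signedForm s) (increasing ℓ))) →
                ∀ {a b} → a ≢ b → ∀ j → linear s a b ∣ combine s (matrix θ a j) (matrix θ b j)
  signed-rows θ s h = rows-from-increasing s {matrix θ} λ {a} {b} a<b j →
    ∣-respʳ (polar-linear θ s a b j) (All.lookup (All.map⁻ (h j)) (∈-increasing a<b))

  minus-rows : ∀ {M : Matrix} → (∀ {a b} → a ≢ b → ∀ j → X a - X b ∣ M a j - M b j) → RowsA M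
  minus-rows {M} h a b j with a Fin.≟ b
  ... | yes ≡.refl = ∣x-x (M a j)
  ... | no a≢b = h a≢b j

  QA QB : Poly
  QA = ∏ (increasing ℓ) λ (i , j) → X i - X j
  QB = ∏ (List.allFin ℓ) X * ∏ (increasing ℓ) λ (i , j) → X i ^ 2 - X j ^ 2

  factorsA factorsB : List Poly
  factorsA = List.map (signedForm true) (increasing ℓ)
  factorsB = List.map X (List.allFin ℓ) ++ (factorsA ++ List.map (signedForm false) (increasing ℓ))

  product-A : product factorsA ≈ QA
  product-A = reflexive (product-map (signedForm true) (increasing ℓ))

  product-++ : ∀ fs gs → product (fs ++ gs) ≈ product fs * product gs
  product-++ []       gs = sym (*-identityˡ (product gs))
  product-++ (f ∷ fs) gs = trans (*-congˡ {f} (product-++ fs gs)) (sym (*-assoc f (product fs) (product gs)))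

  product-B : product factorsB ≈ QB
  product-B = begin
    product factorsB
      ≈⟨ product-++ (List.map X (List.allFin ℓ)) (factorsA ++ List.map (signedForm false) (increasing ℓ)) ⟩
    product (List.map X (List.allFin ℓ)) * product (factorsA ++ List.map (signedForm false) (increasing ℓ))
      ≈⟨ *-cong (reflexive (product-map X (List.allFin ℓ)))
        (trans (product-++ factorsA (List.map (signedForm false) (increasing ℓ)))
           (*-cong (reflexive (product-map (signedForm true) (increasing ℓ)))
             (reflexive (product-map (signedForm false) (increasing ℓ))))) ⟩
    ∏ (List.allFin ℓ) X * (∏ (increasing ℓ) (signedForm true) * ∏ (increasing ℓ) (signedForm false))
      ≈⟨ *-congˡ {∏ (List.allFin ℓ) X} (∏-* (increasing ℓ) (signedForm true) (signedForm false)) ⟨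
    ∏ (List.allFin ℓ) X * ∏ (increasing ℓ) (λ p → signedForm true p * signedForm false p)
      ≈⟨ *-congˡ {∏ (List.allFin ℓ) X} (∏-cong (increasing ℓ) λ (i , j) →
           solve 2 (λ x y → (x :- y) :* (x :+ y) := x :* (x :* :1) :- y :* (y :* :1)) refl (X i) (X j)) ⟩
    QB ∎

  nzd-A : All NonZeroDivisor factorsA
  nzd-A = All.map⁺ (forms-nzd true)

  coprime-A : AllPairs Coprime factorsA
  coprime-A = AllPairs.map⁺ (forms-coprime true)

  nzd-B : All NonZeroDivisor factorsB
  nzd-B = All.++⁺ (All.map⁺ (All.universal nzd-X (List.allFin ℓ))) (All.++⁺ nzd-A (All.map⁺ (forms-nzd false)))

  coprime-B : AllPairs Coprime factorsB
  coprime-B = AllPairs.++⁺ (AllPairs.map⁺ (AllPairs.map (λ {a} {b} → coprime-X {a} {b}) (Unique.allFin⁺ ℓ)))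
    (AllPairs.++⁺ coprime-A (AllPairs.map⁺ (forms-coprime false))
      (All.map⁺ (All.map (λ a<b → All.map⁺ (All.map (opposite a<b) (increasing⇒< ℓ))) (increasing⇒< ℓ))))
    (All.map⁺ (All.universal (λ a → All.++⁺ (X-form true a) (X-form false a)) (List.allFin ℓ)))
    where
    X-form : ∀ s a → All (Coprime (X a)) (List.map (signedForm s) (increasing ℓ))
    X-form s a = All.map⁺ (All.map (λ b<c → coprime-X-form s a (<⇒≢ b<c)) (increasing⇒< ℓ))
    opposite : ∀ {a b i j} → a Fin.< b → i Fin.< j → Coprime (linear true a b) (linear false i j)
    opposite {a} {b} {i} {j} a<b i<j with a Fin.≟ i ×-dec b Fin.≟ j
    ... | yes (≡.refl , ≡.refl) = coprime-signs (<⇒≢ a<b)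
    ... | no ne = coprime-increasing true false a<b i<j λ { ≡.refl → ne (≡.refl , ≡.refl) }

  preserves-A⁺ : ∀ θ → RowsA (matrix θ) → Preserves QA θ
  preserves-A⁺ θ rows f = divides⇒∃ (divides-resp θ product-A
    (preserves-product θ nzd-A coprime-A (apply-signed θ true) (polar-signed θ true rows)) f)

  preserves-A⁻ : ∀ θ → Preserves QA θ → RowsA (matrix θ)
  preserves-A⁻ θ h = minus-rows {matrix θ} (signed-rows θ true λ j → preserves-product⁻ θ nzd-A coprime-A
    (divides-resp θ (sym product-A) λ f → ∃⇒divides (h f)) (X j))

  preserves-B⁺ : ∀ θ → RowsB (matrix θ) → Preserves QB θ
  preserves-B⁺ θ (rows , rows⁻ , rows⁺) f = divides⇒∃ (divides-resp θ product-B
    (preserves-product θ nzd-B coprime-B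
      (All.++⁺ (All.map⁺ (All.universal (λ a → ∣-respʳ (sym (apply-X θ a)) (∣0 (X a))) (List.allFin ℓ)))
        (All.++⁺ (apply-signed θ true) (apply-signed θ false)))
      (All.++⁺ (All.map⁺ (All.universal (λ a → ∣polar θ {f = X a} λ j → ∣-respʳ (sym (polar-X θ a j))
        (rows a j)) (List.allFin ℓ)))
        (All.++⁺ (polar-signed θ true rows⁻) (polar-signed θ false rows⁺)))) f)

  preserves-B⁻ : ∀ θ → Preserves QB θ → RowsB (matrix θ)
  preserves-B⁻ θ h =
    (λ a j → ∣-respʳ (polar-X θ a j) (All.lookup (All.map⁻ (All.++⁻ˡ (List.map X (List.allFin ℓ)) (divides j)))
      (Membership.∈-allFin a))) ,
    minus-rows {matrix θ} (signed-rows θ true λ j → All.++⁻ˡ factorsA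
      (All.++⁻ʳ (List.map X (List.allFin ℓ)) (divides j))) ,
    plus
    where
    divides : ∀ j → All (λ d → d ∣ polar θ d (X j)) factorsB
    divides j = preserves-product⁻ θ nzd-B coprime-B (divides-resp θ (sym product-B) λ f → ∃⇒divides (h f)) (X j)
    plus : ∀ a b j → X a + X b ∣ matrix θ a j + matrix θ b j
    plus a b j with a Fin.≟ b
    ... | no a≢b = signed-rows θ false (λ j → All.++⁻ʳ factorsA
      (All.++⁻ʳ (List.map X (List.allFin ℓ)) (divides j))) a≢b j
    ... | yes ≡.refl = ∣-double (∣-respʳ (polar-X θ a j)
      (All.lookup (All.map⁻ (All.++⁻ˡ (List.map X (List.allFin ℓ)) (divides j))) (Membership.∈-allFin a)))

-- Bases with coefficients indexed by a type

module IndexedBases {r ℓr m ℓm} {R : CommutativeRing r ℓr} (M : Module R m ℓm) where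
  open CommutativeRing R using (Carrier; _≈_; 0#; refl; trans)
  open Module M
  open SubmoduleBases M

  module _ {a} {A : Set a} (F : A → Carrierᴹ) where

    combination : List A → (A → Carrier) → Carrierᴹ
    combination xs k = List.foldr (λ x m → k x *ₗ F x +ᴹ m) 0ᴹ xs

    coefficientAt : (A → Carrier) → ∀ xs → Fin (length (List.map F xs)) → Carrier
    coefficientAt k (x ∷ xs) zero    = k x
    coefficientAt k (x ∷ xs) (suc i) = coefficientAt k xs i

    linearCombination-map : ∀ xs k c → (∀ i → c i ≈ coefficientAt k xs i) →
                            linearCombination (List.map F xs) c ≈ᴹ combination xs k
    linearCombination-map []       k c e = ≈ᴹ-refl
    linearCombination-map (x ∷ xs) k c e = +ᴹ-cong (*ₗ-cong (e zero) ≈ᴹ-refl)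
      (linearCombination-map xs k (λ i → c (suc i)) λ i → e (suc i))

    module _ (_≟_ : DecidableEquality A) where

      -- `IsBasis` attaches coefficients to positions in a list. Distinct indices allow them to be
      -- read as a function of the index; the elements themselves need not be compared.
      coefficientFunction : ∀ xs → Unique xs → (c : Fin (length (List.map F xs)) → Carrier) →
                            ∃ λ k → ∀ i → c i ≈ coefficientAt k xs i
      coefficientFunction []       []       c = (λ _ → 0#) , λ ()
      coefficientFunction (x ∷ xs) (u ∷ us) c = k′ , λ { zero → at-x ; (suc i) → trans (proj₂ ih i)
        (elsewhere xs u i) }
        where
        ih = coefficientFunction xs us (λ i → c (suc i))
        k = proj₁ ih
        k′ : A → Carrier
        k′ z with x ≟ z
        ... | yes _ = c zero
        ... | no  _ = k z
        at-x : c zero ≈ k′ x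
        at-x with x ≟ x
        ... | yes _ = refl
        ... | no x≢x = contradiction ≡.refl x≢x
        elsewhere : ∀ ys → All (x ≢_) ys → ∀ i → coefficientAt k ys i ≈ coefficientAt k′ ys i
        elsewhere (y ∷ ys) (x≢y ∷ x≢ys) zero with x ≟ y
        ... | yes x≡y = contradiction x≡y x≢y
        ... | no  _   = refl
        elsewhere (y ∷ ys) (x≢y ∷ x≢ys) (suc i) = elsewhere ys x≢ys i

      isBasis-map : ∀ {p} {P : Carrierᴹ → Set p} {xs} → Unique xs → All P (List.map F xs) →
        (∀ θ → P θ → ∃ λ k → θ ≈ᴹ combination xs k) →
        (∀ k → combination xs k ≈ᴹ 0ᴹ → ∀ x → x ∈ xs → k x ≈ 0#) → IsBasis P (List.map F xs)
      isBasis-map {xs = xs} unique members spans independent = record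
        { members = members
        ; spans = λ θ Pθ → let k , e = spans θ Pθ in
            coefficientAt k xs , ≈ᴹ-trans e (≈ᴹ-sym (linearCombination-map xs k (coefficientAt k xs) λ _ → refl))
        ; independent = λ c e i → let k , c≈k = coefficientFunction xs unique c in
            trans (c≈k i) (vanish k xs (independent k (≈ᴹ-trans (≈ᴹ-sym (linearCombination-map xs k c c≈k)) e)) i)
        }
        where
        vanish : ∀ k ys → (∀ y → y ∈ ys → k y ≈ 0#) → ∀ i → coefficientAt k ys i ≈ 0#
        vanish k (y ∷ ys) h zero    = h y (here ≡.refl)
        vanish k (y ∷ ys) h (suc i) = vanish k ys (λ y y∈ → h y (there y∈)) i

-- Multisets of degrees and graded changes of basis

occurrences : ℕ → List ℕ → ℕ
occurrences k []       = 0
occurrences k (x ∷ xs) = (if does (x ℕ.≟ k) then 1 else 0) ℕ.+ occurrences k xs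

occurrences-here : ∀ x xs → occurrences x (x ∷ xs) ≡ suc (occurrences x xs)
occurrences-here x xs = ≡.cong (λ b → (if b then 1 else 0) ℕ.+ occurrences x xs) (dec-true (x ℕ.≟ x) ≡.refl)

occurrences-↭ : ∀ k {xs ys} → xs ↭ ys → occurrences k xs ≡ occurrences k ys
occurrences-↭ k Perm.refl           = ≡.refl
occurrences-↭ k (Perm.prep x p)     = ≡.cong (_ ℕ.+_) (occurrences-↭ k p)
occurrences-↭ k (Perm.swap x y p) = ≡.trans
  (≡.cong (λ n → (if does (x ℕ.≟ k) then 1 else 0) ℕ.+ ((if does (y ℕ.≟ k) then 1 else 0) ℕ.+ n)) (occurrences-↭ k p))
  (x∙yz≈y∙xz (if does (x ℕ.≟ k) then 1 else 0) (if does (y ℕ.≟ k) then 1 else 0) _)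
  where open import Algebra.Properties.CommutativeSemigroup ℕ.+-commutativeSemigroup using (x∙yz≈y∙xz)
occurrences-↭ k (Perm.trans p q)    = ≡.trans (occurrences-↭ k p) (occurrences-↭ k q)

occurs⇒∈ : ∀ x ys {n} → occurrences x ys ≡ suc n → x ∈ ys
occurs⇒∈ x (y ∷ ys) e with y ℕ.≟ x
... | yes ≡.refl = here ≡.refl
... | no y≢x     = there (occurs⇒∈ x ys (≡.trans
  (≡.sym (≡.cong (λ b → (if b then 1 else 0) ℕ.+ occurrences x ys) (dec-false (y ℕ.≟ x) y≢x))) e))

occurrences⇒↭ : ∀ xs ys → (∀ k → occurrences k xs ≡ occurrences k ys) → xs ↭ ys
occurrences⇒↭ []       []       e = Perm.refl
occurrences⇒↭ []       (y ∷ ys) e with () ← ≡.trans (e y) (occurrences-here y ys)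
occurrences⇒↭ (x ∷ xs) ys       e with Membership.∈-∃++ (occurs⇒∈ x ys
  (≡.trans (≡.sym (e x)) (occurrences-here x xs)))
... | as , bs , ≡.refl = Perm.trans (Perm.prep x (occurrences⇒↭ xs (as ++ bs) λ k →
        ℕ.+-cancelˡ-≡ (if does (x ℕ.≟ k) then 1 else 0) _ _ (≡.trans (e k) (occurrences-↭ k (Perm.shift x as bs)))))
      (Perm.↭-sym (Perm.shift x as bs))

module MatrixSums {c ℓ} (S : CommutativeRing c ℓ) where
  open CommutativeRing S hiding (zero)
  open import Algebra.Properties.Semiring.Sum semiring
  open import Algebra.Properties.Semiring.Mult semiring using (×-homo-+; ×-homo-1) renaming (_×_ to _·_)
  open import Relation.Binary.Reasoning.Setoid setoid

  sum-matrix : ∀ {m n} (A : Fin m → Carrier) (B : Fin m → Fin n → Carrier) (v : Fin n → Carrier) →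
    sum (λ j → A j * sum (λ k → B j k * v k)) ≈ sum (λ k → sum (λ j → A j * B j k) * v k)
  sum-matrix A B v = begin
    sum (λ j → A j * sum (λ k → B j k * v k))      ≈⟨ sum-cong-≋
      (λ j → trans (*-distribˡ-sum (A j) (λ k → B j k * v k)) (sum-cong-≋ λ k → sym (*-assoc (A j) (B j k) (v k)))) ⟩
    sum (λ j → sum (λ k → A j * B j k * v k))      ≈⟨ ∑-comm (λ j k → A j * B j k * v k) ⟩
    sum (λ k → sum (λ j → A j * B j k * v k))      ≈⟨ sum-cong-≋ (λ k → *-distribʳ-sum (v k) (λ j → A j * B j k)) ⟨
    sum (λ k → sum (λ j → A j * B j k) * v k)      ∎

  sum-zero : ∀ {n} (f : Fin n → Carrier) → (∀ i → f i ≈ 0#) → sum f ≈ 0#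
  sum-zero {n} f e = trans (sum-cong-≋ e) (sum-replicate-zero n)

  kronecker : ∀ {n} → Fin n → Fin n → Carrier
  kronecker i k = if does (i Fin.≟ k) then 1# else 0#

  sum-kronecker : ∀ {n} i (v : Fin n → Carrier) → sum (λ k → kronecker i k * v k) ≈ v i
  sum-kronecker {suc n} zero    v = trans (+-cong (*-identityˡ (v zero))
    (sum-zero {n} (λ k → kronecker (zero {n}) (suc k) * v (suc k)) λ k → zeroˡ (v (suc k)))) (+-identityʳ (v zero))
  sum-kronecker {suc n} (suc i) v = trans (+-cong (zeroˡ (v zero)) (sum-kronecker i (λ k → v (suc k))))
    (+-identityˡ (v (suc i)))

  indicator : ℕ → ℕ → Carrier
  indicator k d = if does (d ℕ.≟ k) then 1# else 0#

  sum-indicator : ∀ k {n} (d : Fin n → ℕ) → sum (λ i → indicator k (d i)) ≈ occurrences k (List.tabulate d) · 1#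
  sum-indicator k {zero}  d = refl
  sum-indicator k {suc n} d = trans (+-cong at-zero (sum-indicator k (λ i → d (suc i))))
    (sym (×-homo-+ 1# (if does (d zero ℕ.≟ k) then 1 else 0) (occurrences k (List.tabulate λ i → d (suc i)))))
    where
    at-zero : indicator k (d zero) ≈ (if does (d zero ℕ.≟ k) then 1 else 0) · 1#
    at-zero with does (d zero ℕ.≟ k)
    ... | true  = sym (×-homo-1 1#)
    ... | false = refl

  -- Both sides are the trace of the block of degree k, computed from a b and from b a.
  sum-indicator-≈ : ∀ {m n} k (d : Fin m → ℕ) (e : Fin n → ℕ) (a : Fin m → Fin n → Carrier)
    (b : Fin n → Fin m → Carrier) →
    (∀ i → sum (λ j → a i j * b j i) ≈ 1#) → (∀ j → sum (λ i → b j i * a i j) ≈ 1#) →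
    (∀ i j → d i ≢ e j → a i j ≈ 0#) → sum (λ i → indicator k (d i)) ≈ sum (λ j → indicator k (e j))
  sum-indicator-≈ k d e a b ab ba graded = begin
    sum (λ i → indicator k (d i))
      ≈⟨ sum-cong-≋ (λ i → trans (trans (sym (*-identityʳ (indicator k (d i))))
        (*-congˡ {indicator k (d i)} (sym (ab i)))) (*-distribˡ-sum (indicator k (d i)) (λ j → a i j * b j i))) ⟩
    sum (λ i → sum (λ j → indicator k (d i) * (a i j * b j i)))
      ≈⟨ ∑-comm (λ i j → indicator k (d i) * (a i j * b j i)) ⟩
    sum (λ j → sum (λ i → indicator k (d i) * (a i j * b j i)))
      ≈⟨ sum-cong-≋ (λ j → sum-cong-≋ λ i → same i j (d i ℕ.≟ e j)) ⟩
    sum (λ j → sum (λ i → indicator k (e j) * (b j i * a i j)))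
      ≈⟨ sum-cong-≋ (λ j → trans (trans (sym (*-identityʳ (indicator k (e j))))
        (*-congˡ {indicator k (e j)} (sym (ba j)))) (*-distribˡ-sum (indicator k (e j)) (λ i → b j i * a i j))) ⟨
    sum (λ j → indicator k (e j)) ∎
    where
    same : ∀ i j → Dec (d i ≡ e j) → indicator k (d i) * (a i j * b j i) ≈ indicator k (e j) * (b j i * a i j)
    same i j (yes eq) = *-cong (reflexive (≡.cong (indicator k) eq)) (*-comm (a i j) (b j i))
    same i j (no ne)  = trans (vanish (indicator k (d i)) (trans (*-congʳ {b j i} (graded i j ne)) (zeroˡ (b j i))))
                         (sym (vanish (indicator k (e j)) (trans (*-congˡ {b j i} (graded i j ne)) (zeroʳ (b j i)))))
      where
      vanish : ∀ x {y} → y ≈ 0# → x * y ≈ 0#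
      vanish x e = trans (*-congˡ e) (zeroʳ x)

module GradedPolynomials {r ℓr} (R : CommutativeRing r ℓr) (n : ℕ) where
  open Polynomials R n
  private
    module R where
      open CommutativeRing R public
      open IntegerRingSolver R public
      open import Algebra.Properties.Semiring.Sum (CommutativeRing.semiring R) public using (sum)
      open import Algebra.Properties.Semiring.Mult (CommutativeRing.semiring R) public using () renaming (_×_ to _·_)
      open import Algebra.Properties.Ring (CommutativeRing.ring R) public using (-0#≈0#)
      module Matrix = MatrixSums R
  open CommutativeRing polynomialRing hiding (zero)
  open IntegerRingSolver polynomialRing
  open PolynomialProperties R n
  open MatrixSums polynomialRing
  open import Algebra.Properties.Semiring.Sum semiring using (sum; sum-cong-≋; ∑-distrib-+)
  open import Algebra.Properties.Ring ring using (x∙y⁻¹≈ε⇒x≈y)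

  only : ∀ {p} {P : Set p} → Dec P → R.Carrier → R.Carrier
  only P? x = if does P? then x else R.0#

  only-yes : ∀ {p} {P : Set p} (P? : Dec P) x → P → only P? x ≡ x
  only-yes P? x h = ≡.cong (if_then x else R.0#) (dec-true P? h)

  only-no : ∀ {p} {P : Set p} (P? : Dec P) x → ¬ P → only P? x ≡ R.0#
  only-no P? x h = ≡.cong (if_then x else R.0#) (dec-false P? h)

  only-vanishes : ∀ {p} {P : Set p} (P? : Dec P) {x} → (P → x R.≈ R.0#) → only P? x R.≈ R.0#
  only-vanishes (yes h) e = e h
  only-vanishes (no _)  e = R.refl

  only-cong : ∀ {p} {P : Set p} (P? : Dec P) {x y} → (P → x R.≈ y) → only P? x R.≈ only P? y
  only-cong (yes h) e = e h
  only-cong (no _)  e = R.refl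

  -- An equation in place of the degree `e ∸ d`, whose truncation would wrongly admit constants when
  -- d > e.
  degree? : ∀ e d (α : Exponents) → Dec (Vec.sum α ℕ.+ d ≡ e)
  degree? e d α = Vec.sum α ℕ.+ d ℕ.≟ e

  -- The part of f of degree e - d, which is zero for d > e.
  component : ℕ → ℕ → Poly → Poly
  component e d = List.filter λ (c , α) → degree? e d α

  L-component : ∀ e d f φ → L (component e d f) φ R.≈ L f (λ α → only (degree? e d α) (φ α))
  L-component e d []            φ = R.refl
  L-component e d ((c , α) ∷ f) φ with does (degree? e d α)
  ... | true  = R.+-congˡ (L-component e d f φ)
  ... | false = R.trans (L-component e d f φ) (R.sym (R.trans (R.+-congʳ (R.zeroʳ c)) (R.+-identityˡ _)))

  component-cong : ∀ e d {f g} → f ≈ g → component e d f ≈ component e d g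
  component-cong e d {f} {g} eq = L⇒≈ᴾ λ φ → R.trans (L-component e d f φ)
    (R.trans (≈ᴾ⇒L eq _) (R.sym (L-component e d g φ)))

  component-sum : ∀ e d {m} (f : Fin m → Poly) → component e d (sum f) ≈ sum (λ i → component e d (f i))
  component-sum e d {zero}  f = refl
  component-sum e d {suc m} f = trans (reflexive (List.filter-++ (λ (c , α) → degree? e d α) (f zero)
    (sum (λ i → f (suc i)))))
    (+-congˡ {component e d (f zero)} (component-sum e d (λ i → f (suc i))))

  δ-≢ : ∀ {α β} → α ≢ β → δ β α ≡ R.0#
  δ-≢ {α} {β} ne = ≡.cong (if_then R.1# else R.0#) (dec-false (α ≟ᵉ β) ne)

  homogeneous⇒component : ∀ {d f} → Homogeneous d f → f ≈ component d 0 f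
  homogeneous⇒component {d} {f} hom = mk≈ᴾ λ β → R.sym (R.trans (coeff-L (component d 0 f) β)
    (R.trans (L-component d 0 f (δ β)) (at β (degree? d 0 β))))
    where
    at : ∀ β → Dec (Vec.sum β ℕ.+ 0 ≡ d) → L f (λ α → only (degree? d 0 α) (δ β α)) R.≈ coeff f β
    at β (yes eq) = R.trans (L-cong f same) (R.sym (coeff-L f β))
      where
      same : ∀ α → only (degree? d 0 α) (δ β α) R.≈ δ β α
      same α with α ≟ᵉ β
      ... | yes ≡.refl = R.reflexive (only-yes (degree? d 0 α) _ eq)
      ... | no  _      = only-vanishes (degree? d 0 α) λ _ → R.refl
    at β (no ne) = R.trans (R.trans (L-cong f vanish) (L-zero f))
      (R.sym (hom β λ e → ne (≡.trans (ℕ.+-identityʳ _) e)))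
      where
      vanish : ∀ α → only (degree? d 0 α) (δ β α) R.≈ R.0#
      vanish α = only-vanishes (degree? d 0 α) λ eq → R.reflexive (δ-≢ {α} {β} λ { ≡.refl → ne eq })

  component⇒homogeneous : ∀ {d f} → f ≈ component d 0 f → Homogeneous d f
  component⇒homogeneous {d} {f} eq α ne = R.trans (_≈ᴾ_.coeff-≈ eq α) (R.trans (coeff-L (component d 0 f) α)
    (R.trans (L-component d 0 f (δ α)) (R.trans (L-cong f vanish) (L-zero f))))
    where
    vanish : ∀ β → only (degree? d 0 β) (δ α β) R.≈ R.0#
    vanish β = only-vanishes (degree? d 0 β) λ e → R.reflexive
      (δ-≢ {β} {α} λ { ≡.refl → ne (≡.trans (≡.sym (ℕ.+-identityʳ _)) e) })

  -- Multiplication by g shifts degrees by d; hence an expansion of a homogeneous element can be cut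
  -- down to coefficients of the expected degrees.
  component-* : ∀ e {d} f {g} → Homogeneous d g → component e 0 (f * g) ≈ component e d f * g
  component-* e {d} f {g} hom = L⇒≈ᴾ λ φ → begin
    L (component e 0 (f * g)) φ
      ≈⟨ L-component e 0 (f * g) φ ⟩
    L (f * g) (λ γ → only (degree? e 0 γ) (φ γ))
      ≈⟨ L-*ᴾ f g _ ⟩
    L f (λ α → L g (λ β → only (degree? e 0 (α +ᵉ β)) (φ (α +ᵉ β))))
      ≈⟨ L-cong f (λ α → R.trans (restrict _) (R.trans (at φ α (degree? e d α))
        (R.sym (only-cong (degree? e d α) λ _ → restrict _)))) ⟩
    L f (λ α → only (degree? e d α) (L g (λ β → φ (α +ᵉ β))))
      ≈⟨ L-component e d f _ ⟨
    L (component e d f) (λ α → L g (λ β → φ (α +ᵉ β)))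
      ≈⟨ L-*ᴾ (component e d f) g φ ⟨
    L (component e d f * g) φ ∎
    where
    open import Relation.Binary.Reasoning.Setoid R.setoid
    restrict : ∀ ψ → L g ψ R.≈ L g (λ β → only (degree? d 0 β) (ψ β))
    restrict ψ = R.trans (≈ᴾ⇒L (homogeneous⇒component {d} {g} hom) ψ) (L-component d 0 g ψ)
    degree : ∀ {α β} → Vec.sum β ℕ.+ 0 ≡ d → Vec.sum (α +ᵉ β) ℕ.+ 0 ≡ Vec.sum α ℕ.+ d
    degree {α} {β} eq = ≡.trans (ℕ.+-identityʳ _) (≡.trans (sum-+ α β)
      (≡.cong (Vec.sum α ℕ.+_) (≡.trans (≡.sym (ℕ.+-identityʳ _)) eq)))
    at : ∀ φ α (e? : Dec (Vec.sum α ℕ.+ d ≡ e)) →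
      L g (λ β → only (degree? d 0 β) (only (degree? e 0 (α +ᵉ β)) (φ (α +ᵉ β)))) R.≈
      only e? (L g (λ β → only (degree? d 0 β) (φ (α +ᵉ β))))
    at φ α (yes eq) = L-cong g λ β → same β
      where
      same : ∀ β → only (degree? d 0 β) (only (degree? e 0 (α +ᵉ β)) (φ (α +ᵉ β))) R.≈
                   only (degree? d 0 β) (φ (α +ᵉ β))
      same β = only-cong (degree? d 0 β) λ eq′ → R.reflexive
        (only-yes (degree? e 0 (α +ᵉ β)) _ (≡.trans (degree {α} {β} eq′) eq))
    at φ α (no ne) = R.trans (L-cong g λ β → vanish β) (L-zero g)
      where
      vanish : ∀ β → only (degree? d 0 β) (only (degree? e 0 (α +ᵉ β)) (φ (α +ᵉ β))) R.≈ R.0#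
      vanish β = only-vanishes (degree? d 0 β) λ eq′ → R.reflexive
        (only-no (degree? e 0 (α +ᵉ β)) _ λ eq → ne (≡.trans (≡.sym (degree {α} {β} eq′)) eq))

  homogeneous-resp : ∀ {d f g} → f ≈ g → Homogeneous d f → Homogeneous d g
  homogeneous-resp eq hom α ne = R.trans (R.sym (_≈ᴾ_.coeff-≈ eq α)) (hom α ne)

  homogeneous-0 : ∀ {d} → Homogeneous d 0#
  homogeneous-0 α ne = R.refl

  homogeneous-+ : ∀ {d f g} → Homogeneous d f → Homogeneous d g → Homogeneous d (f + g)
  homogeneous-+ {d} {f} {g} hom hom′ α ne = R.trans (coeff-+ f g α)
    (R.trans (R.+-cong (hom α ne) (hom′ α ne)) (R.+-identityˡ R.0#))

  homogeneous-neg : ∀ {d f} → Homogeneous d f → Homogeneous d (- f)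
  homogeneous-neg {d} {f} hom α ne = R.trans (coeff-L (- f) α) (R.trans (L-neg f (δ α))
    (R.trans (R.-‿cong (R.trans (R.sym (coeff-L f α)) (hom α ne))) R.-0#≈0#))

  homogeneous-term : ∀ c {α d} → Vec.sum α ≡ d → Homogeneous d List.[ c , α ]
  homogeneous-term c {α} eq β ne = R.trans (R.+-identityʳ _)
    (R.reflexive (≡.cong (if_then c else R.0#) (dec-false (α ≟ᵉ β) λ { ≡.refl → ne eq })))

  homogeneous-X : ∀ i → Homogeneous 1 (X i)
  homogeneous-X i = homogeneous-term R.1# {unit i} (sum-unit i)

  homogeneous-C : ∀ c → Homogeneous 0 (C c)
  homogeneous-C c = homogeneous-term c {0ᵉ} (sum-0 n)

  homogeneous-* : ∀ {d e f g} → Homogeneous d f → Homogeneous e g → Homogeneous (d ℕ.+ e) (f * g)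
  homogeneous-* {d} {e} {f} {g} hom hom′ = component⇒homogeneous {d ℕ.+ e} {f * g}
    (trans (*-congʳ {g} (trans (homogeneous⇒component {d} {f} hom) shift)) (sym (component-* (d ℕ.+ e) f {g} hom′)))
    where
    shift : component d 0 f ≈ component (d ℕ.+ e) e f
    shift = L⇒≈ᴾ λ φ → R.trans (L-component d 0 f φ) (R.trans (L-cong f (λ α → same φ α (Vec.sum α ℕ.≟ d)))
      (R.sym (L-component (d ℕ.+ e) e f φ)))
      where
      same : ∀ φ α → Dec (Vec.sum α ≡ d) → only (degree? d 0 α) (φ α) R.≈ only (degree? (d ℕ.+ e) e α) (φ α)
      same φ α (yes eq) = R.reflexive (≡.trans (only-yes (degree? d 0 α) (φ α) (≡.trans (ℕ.+-identityʳ _) eq))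
        (≡.sym (only-yes (degree? (d ℕ.+ e) e α) (φ α) (≡.cong (ℕ._+ e) eq))))
      same φ α (no ne)  = R.reflexive (≡.trans (only-no (degree? d 0 α) (φ α)
        (λ eq → ne (≡.trans (≡.sym (ℕ.+-identityʳ _)) eq)))
        (≡.sym (only-no (degree? (d ℕ.+ e) e α) (φ α) (λ eq → ne (ℕ.+-cancelʳ-≡ e _ _ eq)))))

  -- Evaluation at the origin, which turns transition matrices over the polynomial ring into
  -- matrices over R.
  constant : Poly → R.Carrier
  constant f = coeff f 0ᵉ

  constant-* : ∀ f g → constant (f * g) R.≈ constant f R.* constant g
  constant-* f g = begin
    coeff (f * g) 0ᵉ  ≈⟨ R.trans (coeff-L (f * g) 0ᵉ) (L-*ᴾ f g (δ 0ᵉ)) ⟩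
    L f (λ α → L g (λ β → δ 0ᵉ (α +ᵉ β)))  ≈⟨ L-cong f (λ α → R.trans (L-cong g λ β → δ-* α β)
      (L-* g (δ 0ᵉ α) (δ 0ᵉ))) ⟩
    L f (λ α → δ 0ᵉ α R.* L g (δ 0ᵉ))  ≈⟨ L-cong f (λ α → R.*-comm _ _) ⟩
    L f (λ α → L g (δ 0ᵉ) R.* δ 0ᵉ α)  ≈⟨ L-* f (L g (δ 0ᵉ)) (δ 0ᵉ) ⟩
    L g (δ 0ᵉ) R.* L f (δ 0ᵉ)  ≈⟨ R.trans (R.*-comm _ _) (R.*-cong (R.sym (coeff-L f 0ᵉ)) (R.sym (coeff-L g 0ᵉ))) ⟩
    coeff f 0ᵉ R.* coeff g 0ᵉ                              ∎
    where
    open import Relation.Binary.Reasoning.Setoid R.setoid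
    +≡0 : ∀ {m} (α β : Vec ℕ m) → Vec.zipWith ℕ._+_ α β ≡ Vec.replicate m 0 → α ≡ Vec.replicate m 0 × β ≡
      Vec.replicate m 0
    +≡0 []      []      e = ≡.refl , ≡.refl
    +≡0 (zero ∷ α) (zero ∷ β) e = let e₁ , e₂ = +≡0 α β (Vec.∷-injectiveʳ e) in ≡.cong (0 ∷_) e₁ , ≡.cong (0 ∷_) e₂
    δ-* : ∀ α β → δ 0ᵉ (α +ᵉ β) R.≈ δ 0ᵉ α R.* δ 0ᵉ β
    δ-* α β with α ≟ᵉ 0ᵉ | β ≟ᵉ 0ᵉ
    ... | yes ≡.refl | yes ≡.refl = R.trans (R.reflexive
      (≡.cong (if_then R.1# else R.0#) (dec-true ((0ᵉ +ᵉ 0ᵉ) ≟ᵉ 0ᵉ) (0ᵉ-+ 0ᵉ)))) (R.sym (R.*-identityˡ _))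
    ... | no α≢0 | _      = R.trans (R.reflexive (δ-≢ λ e → α≢0 (proj₁ (+≡0 α β e)))) (R.sym (R.zeroˡ _))
    ... | yes _  | no β≢0 = R.trans (R.reflexive (δ-≢ λ e → β≢0 (proj₂ (+≡0 α β e)))) (R.sym (R.zeroʳ _))

  constant-sum : ∀ {m} (f : Fin m → Poly) → constant (sum f) R.≈ R.sum (λ i → constant (f i))
  constant-sum {zero}  f = R.refl
  constant-sum {suc m} f = R.trans (coeff-+ (f zero) (sum (λ i → f (suc i))) 0ᵉ)
    (R.+-congˡ (constant-sum (λ i → f (suc i))))

  constant-1 : constant 1# R.≈ R.1#
  constant-1 = R.trans (R.+-identityʳ _) (R.reflexive (≡.cong (if_then R.1# else R.0#) (dec-true (0ᵉ ≟ᵉ 0ᵉ) ≡.refl)))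

  constant-component : ∀ {e d} f → e ≢ d → constant (component e d f) R.≈ R.0#
  constant-component {e} {d} f ne = R.trans (coeff-L (component e d f) 0ᵉ) (R.trans (L-component e d f (δ 0ᵉ))
    (R.trans (L-cong f vanish) (L-zero f)))
    where
    vanish : ∀ α → only (degree? e d α) (δ 0ᵉ α) R.≈ R.0#
    vanish α = only-vanishes (degree? e d α) λ eq → R.reflexive
      (δ-≢ {α} {0ᵉ} λ { ≡.refl → ne (≡.trans (≡.sym eq) (≡.cong (ℕ._+ d) (sum-0 n))) })

  module _ {i} {I : Set i} where

    Independent : ∀ {m} → (Fin m → I → Poly) → Set _
    Independent {m} b = ∀ (c : Fin m → Poly) → (∀ α → sum (λ j → c j * b j α) ≈ 0#) → ∀ j → c j ≈ 0#

    independent⇒≈ : ∀ {m} {b : Fin m → I → Poly} → Independent b → ∀ (c c′ : Fin m → Poly) →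
                    (∀ α → sum (λ j → c j * b j α) ≈ sum (λ j → c′ j * b j α)) → ∀ j → c j ≈ c′ j
    independent⇒≈ {m} {b} ind c c′ e j = x∙y⁻¹≈ε⇒x≈y (c j) (c′ j) (ind (λ j → c j - c′ j) (λ α → begin
      sum (λ j → (c j - c′ j) * b j α)  ≈⟨ sum-cong-≋ (λ j → solve 3
        (λ x y z → (x :- y) :* z := x :* z :+ (:- :1) :* (y :* z)) refl (c j) (c′ j) (b j α)) ⟩
      sum (λ j → c j * b j α + - 1# * (c′ j * b j α))  ≈⟨ ∑-distrib-+ (λ j → c j * b j α)
        (λ j → - 1# * (c′ j * b j α)) ⟩
      sum (λ j → c j * b j α) + sum (λ j → - 1# * (c′ j * b j α))      ≈⟨ +-cong (e α)
        (sym (*-distribˡ-sum (- 1#) (λ j → c′ j * b j α))) ⟩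
      sum (λ j → c′ j * b j α) + - 1# * sum (λ j → c′ j * b j α)  ≈⟨ solve 1 (λ x → x :+ :- :1 :* x := :0) refl
        (sum (λ j → c′ j * b j α)) ⟩
      0#                                                               ∎) j)
      where
      open import Relation.Binary.Reasoning.Setoid setoid
      open import Algebra.Properties.Semiring.Sum semiring using (*-distribˡ-sum)

    -- Inserting one expansion into the other expresses b_i through the family b. Independence
    -- identifies the coefficients with those of the identity matrix; evaluation at the origin then
    -- gives the diagonal entry.
    inverse-matrices : ∀ {m m′} {b : Fin m → I → Poly} {c : Fin m′ → I → Poly} → Independent b →
      (A : Fin m → Fin m′ → Poly) (B : Fin m′ → Fin m → Poly) →
      (∀ i α → b i α ≈ sum (λ j → A i j * c j α)) → (∀ j α → c j α ≈ sum (λ i → B j i * b i α)) →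
      ∀ i → R.sum (λ j → constant (A i j) R.* constant (B j i)) R.≈ R.1#
    inverse-matrices {m} {b = b} {c} ind A B b-eq c-eq i = R.trans
      (R.sym (R.trans (constant-sum (λ j → A i j * B j i))
        (sum-cong-R (λ j → constant-* (A i j) (B j i)))))
      (R.trans (_≈ᴾ_.coeff-≈ (independent⇒≈ {b = b} ind (λ k → sum (λ j → A i j * B j k)) (kronecker i) (λ α → begin
          sum (λ k → sum (λ j → A i j * B j k) * b k α)      ≈⟨ sum-matrix (A i) B (λ k → b k α) ⟨
          sum (λ j → A i j * sum (λ k → B j k * b k α))      ≈⟨ sum-cong-≋ (λ j → *-congˡ {A i j} (c-eq j α)) ⟨
          sum (λ j → A i j * c j α)  ≈⟨ b-eq i α ⟨
          b i α  ≈⟨ sum-kronecker i (λ k → b k α) ⟨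
          sum (λ k → kronecker i k * b k α)                  ∎) i) 0ᵉ)
        (R.trans (_≈ᴾ_.coeff-≈ (reflexive (≡.cong (if_then 1# else 0#) (dec-true (i Fin.≟ i) ≡.refl))) 0ᵉ)
          constant-1))
      where
      open import Relation.Binary.Reasoning.Setoid setoid
      open import Algebra.Properties.Semiring.Sum R.semiring using () renaming (sum-cong-≋ to sum-cong-R)

    -- The traces agree as elements of R; characteristic zero turns this into equality of the two
    -- counts.
    same-degrees : (∀ p q → p R.· R.1# R.≈ q R.· R.1# → p ≡ q) →
      ∀ {m m′} {b : Fin m → I → Poly} {c : Fin m′ → I → Poly} (d : Fin m → ℕ) (e : Fin m′ → ℕ) →
      Independent b → Independent c → (∀ i α → Homogeneous (d i) (b i α)) → (∀ j α → Homogeneous (e j) (c j α)) →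
      (∀ i → ∃ λ A → ∀ α → b i α ≈ sum (λ j → A j * c j α)) → (∀ j → ∃ λ B → ∀ α → c j α ≈ sum (λ i → B i * b i α)) →
      ∀ k → occurrences k (List.tabulate d) ≡ occurrences k (List.tabulate e)
    same-degrees char-0 {b = b} {c} d e ind-b ind-c hom-b hom-c b-spans c-spans k = char-0 _ _
      (R.trans (R.sym (R.Matrix.sum-indicator k d)) (R.trans
        (R.Matrix.sum-indicator-≈ k d e (λ i j → constant (A i j)) (λ j i → constant (B j i))
          (inverse-matrices {b = b} {c} ind-b A B b-eq c-eq) (inverse-matrices {b = c} {b} ind-c B A c-eq b-eq)
            graded)
        (R.Matrix.sum-indicator k e)))
      where
      open import Relation.Binary.Reasoning.Setoid setoid
      A = λ i → proj₁ (b-spans i)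
      B = λ j → proj₁ (c-spans j)
      b-eq = λ i → proj₂ (b-spans i)
      c-eq = λ j → proj₂ (c-spans j)
      -- The component of degree d_i of the expansion of b_i is again an expansion of b_i, so by
      -- uniqueness A_ij is homogeneous of degree d_i - e_j, and it vanishes at the origin unless
      -- d_i = e_j.
      A-graded : ∀ i j → A i j ≈ component (d i) (e j) (A i j)
      A-graded i = independent⇒≈ {b = c} ind-c (A i) (λ j → component (d i) (e j) (A i j)) λ α → begin
        sum (λ j → A i j * c j α)  ≈⟨ b-eq i α ⟨
        b i α  ≈⟨ homogeneous⇒component {d i} {b i α} (hom-b i α) ⟩
        component (d i) 0 (b i α)  ≈⟨ component-cong (d i) 0 (b-eq i α) ⟩
        component (d i) 0 (sum (λ j → A i j * c j α))  ≈⟨ component-sum (d i) 0 (λ j → A i j * c j α) ⟩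
        sum (λ j → component (d i) 0 (A i j * c j α))  ≈⟨ sum-cong-≋
          (λ j → component-* (d i) (A i j) {c j α} (hom-c j α)) ⟩
        sum (λ j → component (d i) (e j) (A i j) * c j α)      ∎
      graded : ∀ i j → d i ≢ e j → constant (A i j) R.≈ R.0#
      graded i j ne = R.trans (_≈ᴾ_.coeff-≈ (A-graded i j) 0ᵉ) (constant-component (A i j) ne)

-- Enumeration, evaluation and degrees of the Schur quotients

Λ-unique : ∀ ℓ → Unique (Λ ℓ)
Λ-unique ℓ = Unique.concat⁺
  (All.map⁺ (All.universal (λ λ₁ → Unique.map⁺ (λ e → Vec.∷-injectiveˡ (Vec.∷-injectiveʳ e))
    (Unique.upTo⁺ (suc λ₁))) (List.upTo (ℓ ℕ.∸ 1))))
  (AllPairs.map⁺ (AllPairs.map disjoint (Unique.upTo⁺ (ℓ ℕ.∸ 1))))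
  where
  same : ∀ {p q μ} → μ ∈ pairsBelow p → μ ∈ pairsBelow q → p ≡ q
  same {p} {q} μ∈p μ∈q with Membership.∈-map⁻ (λ λ₂ → p ∷ λ₂ ∷ []) μ∈p | Membership.∈-map⁻ (λ λ₂ → q ∷ λ₂ ∷ []) μ∈q
  ... | _ , _ , ≡.refl | _ , _ , e = Vec.∷-injectiveˡ e
  disjoint : ∀ {p q} → p ≢ q → Disjoint (pairsBelow p) (pairsBelow q)
  disjoint p≢q (μ∈p , μ∈q) = p≢q (same μ∈p μ∈q)

module _ {a ℓa b ℓb} (A : CommutativeRing a ℓa) (B : CommutativeRing b ℓb) where
  private
    module A where
      open CommutativeRing A public
      open AntisymmetricQuotient A public using (g; h)
      open import Algebra.Properties.Semiring.Exp (CommutativeRing.semiring A) public using (_^_)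
    module B where
      open AntisymmetricQuotient B public using (g; h)
      open import Algebra.Properties.Semiring.Exp (CommutativeRing.semiring B) public using (_^_)
  open CommutativeRing B hiding (zero)

  module Homomorphism (f : A.Carrier → Carrier) (f-0 : f A.0# ≈ 0#) (f-1 : f A.1# ≈ 1#)
    (f-+ : ∀ x y → f (x A.+ y) ≈ f x + f y) (f-* : ∀ x y → f (x A.* y) ≈ f x * f y) (f-neg : ∀ x → f (A.- x) ≈ - f x) where

    f-^ : ∀ x k → f (x A.^ k) ≈ f x B.^ k
    f-^ x zero    = f-1
    f-^ x (suc k) = trans (f-* x (x A.^ k)) (*-congˡ (f-^ x k))

    f-g : ∀ s t p → f (A.g s t p) ≈ B.g (f s) (f t) p
    f-g s t zero    = f-0
    f-g s t (suc p) = trans (f-+ (s A.* A.g s t p) (t A.^ p))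
      (+-cong (trans (f-* s (A.g s t p)) (*-congˡ (f-g s t p))) (f-^ t p))

    -- The comparison follows the recursion because the defining equation of the quotient says
    -- nothing at s = t, a value that occurs for the exponents with α_i = 2.
    f-h : ∀ s t p q → f (A.h s t p q) ≈ B.h (f s) (f t) p q
    f-h s t p       zero    = f-g s t p
    f-h s t zero    (suc q) = trans (f-neg (A.g s t (suc q))) (-‿cong (f-g s t (suc q)))
    f-h s t (suc p) (suc q) = trans (f-* (s A.* t) (A.h s t p q)) (*-cong (f-* s t) (f-h s t p q))

module _ {c ℓ} (S : CommutativeRing c ℓ) where
  open CommutativeRing S hiding (zero)
  open AntisymmetricQuotient S using (g; h)
  open import Algebra.Properties.Semiring.Exp semiring using (_^_)

  ^-cong : ∀ {s s′} k → s ≈ s′ → s ^ k ≈ s′ ^ k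
  ^-cong zero    e = refl
  ^-cong (suc k) e = *-cong e (^-cong k e)

  g-cong : ∀ {s s′ t t′} p → s ≈ s′ → t ≈ t′ → g s t p ≈ g s′ t′ p
  g-cong zero    e e′ = refl
  g-cong (suc p) e e′ = +-cong (*-cong e (g-cong p e e′)) (^-cong p e′)

  h-cong : ∀ {s s′ t t′} p q → s ≈ s′ → t ≈ t′ → h s t p q ≈ h s′ t′ p q
  h-cong p       zero    e e′ = g-cong p e e′
  h-cong zero    (suc q) e e′ = -‿cong (g-cong (suc q) e e′)
  h-cong (suc p) (suc q) e e′ = *-cong (*-cong e e′) (h-cong p q e e′)

module HomogeneousQuotients {r ℓr} (R : CommutativeRing r ℓr) (n : ℕ) where
  open Polynomials R n
  open GradedPolynomials R n
  open CommutativeRing polynomialRing hiding (zero)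
  open AntisymmetricQuotient polynomialRing using (g; h)
  open import Algebra.Properties.Semiring.Exp semiring using (_^_)

  module _ {e : ℕ} {s t : Poly} (hom-s : Homogeneous e s) (hom-t : Homogeneous e t) where

    homogeneous-^ : ∀ k → Homogeneous (k ℕ.* e) (t ^ k)
    homogeneous-^ zero    = homogeneous-C (CommutativeRing.1# R)
    homogeneous-^ (suc k) = homogeneous-* {e} {k ℕ.* e} {t} {t ^ k} hom-t (homogeneous-^ k)

    homogeneous-g : ∀ p → Homogeneous (p ℕ.* e) (g s t (suc p))
    homogeneous-g zero    = homogeneous-+ {0} {s * 0#} {1#}
      (homogeneous-resp {0} {0#} {s * 0#} (sym (zeroʳ s)) (homogeneous-0 {0})) (homogeneous-^ 0)
    homogeneous-g (suc p) = homogeneous-+ {suc p ℕ.* e} {s * g s t (suc p)} {t ^ suc p}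
      (homogeneous-* {e} {p ℕ.* e} {s} {g s t (suc p)} hom-s (homogeneous-g p)) (homogeneous-^ (suc p))

    homogeneous-h : ∀ p q d → p ℕ.+ q ≡ suc d → Homogeneous (d ℕ.* e) (h s t p q)
    homogeneous-h p zero d eq = ≡.subst (λ p → Homogeneous (d ℕ.* e) (g s t p))
      (≡.trans (≡.sym eq) (ℕ.+-identityʳ p)) (homogeneous-g d)
    homogeneous-h zero (suc q) .q ≡.refl = homogeneous-neg {q ℕ.* e} {g s t (suc q)} (homogeneous-g q)
    -- The recursive call would be at p = q = 0, where p + q is no successor; there the quotient is
    -- zero, which is homogeneous of every degree.
    homogeneous-h (suc zero) (suc zero) d eq = homogeneous-resp {d ℕ.* e} {0#} {(s * t) * 0#}
      (sym (zeroʳ (s * t))) (homogeneous-0 {d ℕ.* e})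
    homogeneous-h (suc (suc p)) (suc q) d eq = step (suc p) q (p ℕ.+ q) ≡.refl d eq
      where
      step : ∀ p q d′ → p ℕ.+ q ≡ suc d′ → ∀ d → suc p ℕ.+ suc q ≡ suc d → Homogeneous (d ℕ.* e) ((s * t) * h s t p q)
      step p q d′ eq′ d eq = ≡.subst (λ k → Homogeneous k ((s * t) * h s t p q)) degree
        (homogeneous-* {e ℕ.+ e} {d′ ℕ.* e} {s * t} {h s t p q} (homogeneous-* {e} {e} {s} {t} hom-s hom-t)
          (homogeneous-h p q d′ eq′))
        where
        degree : e ℕ.+ e ℕ.+ d′ ℕ.* e ≡ d ℕ.* e
        degree = ≡.trans (ℕ.+-assoc e e _) (≡.cong (ℕ._* e) {suc (suc d′)}
          (≡.trans (≡.sym (≡.cong suc eq′)) (≡.trans (≡.sym (ℕ.+-suc p q)) (ℕ.suc-injective eq))))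
    homogeneous-h (suc zero) (suc (suc q)) d eq = ≡.subst (λ k → Homogeneous k ((s * t) * h s t 0 (suc q))) degree
        (homogeneous-* {e ℕ.+ e} {q ℕ.* e} {s * t} {h s t 0 (suc q)} (homogeneous-* {e} {e} {s} {t} hom-s hom-t)
          (homogeneous-h 0 (suc q) q ≡.refl))
        where
        degree : e ℕ.+ e ℕ.+ q ℕ.* e ≡ d ℕ.* e
        degree = ≡.trans (ℕ.+-assoc e e _) (≡.cong (ℕ._* e) (ℕ.suc-injective eq))

-- Characteristic zero, and the exponents as invariants

module RealNumbers where
  open Reals using (ℝ; fromℚ; ℝ-commutativeRing; seq; mk≈; pointwise)
  open CommutativeRing ℝ-commutativeRing hiding (zero)
  open import Algebra.Definitions.RawMonoid +-rawMonoid using () renaming (_×_ to _·_)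

  fromℕ : ℕ → ℚ
  fromℕ zero    = 0ℚ
  fromℕ (suc n) = 1ℚ ℚ.+ fromℕ n

  seq-· : ∀ n i → seq (n · 1#) i ≡ fromℕ n
  seq-· zero    i = ≡.refl
  seq-· (suc n) i = ≡.cong (1ℚ ℚ.+_) (seq-· n i)

  0≤fromℕ : ∀ n → 0ℚ ℚ.≤ fromℕ n
  0≤fromℕ zero    = ℚ.≤-refl
  0≤fromℕ (suc n) = ℚ.≤-trans (ℚ.nonNegative⁻¹ 1ℚ) (≡.subst (ℚ._≤ 1ℚ ℚ.+ fromℕ n) (ℚ.+-identityʳ 1ℚ)
    (ℚ.+-monoʳ-≤ 1ℚ (0≤fromℕ n)))

  -- The sequence is constantly n + 1, so it fails to be null at tolerance 1.
  suc≉0 : ∀ n → ¬ (suc n · 1# ≈ 0#)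
  suc≉0 n (mk≈ null) with null 1ℚ (ℚ.positive⁻¹ 1ℚ)
  ... | N , h = ℚ.<-irrefl ≡.refl (ℚ.≤-<-trans 1≤ (≡.subst (λ q → ℚ.∣ q ∣ ℚ.< 1ℚ) value (h N ℕ.≤-refl)))
    where
    value : seq (suc n · 1#) N ℚ.- 0ℚ ≡ fromℕ (suc n)
    value = ≡.trans (ℚ.+-identityʳ _) (seq-· (suc n) N)
    1≤ : 1ℚ ℚ.≤ ℚ.∣ fromℕ (suc n) ∣
    1≤ = ≡.subst (1ℚ ℚ.≤_) (≡.sym (ℚ.0≤p⇒∣p∣≡p (0≤fromℕ (suc n))))
      (≡.subst (ℚ._≤ 1ℚ ℚ.+ fromℕ n) (ℚ.+-identityʳ 1ℚ) (ℚ.+-monoʳ-≤ 1ℚ (0≤fromℕ n)))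

  characteristic-0 : ∀ p q → p · 1# ≈ q · 1# → p ≡ q
  characteristic-0 zero    zero    e = ≡.refl
  characteristic-0 zero    (suc q) e = contradiction (sym e) (suc≉0 q)
  characteristic-0 (suc p) zero    e = contradiction e (suc≉0 p)
  characteristic-0 (suc p) (suc q) e = ≡.cong suc (characteristic-0 p q (+-cancelˡ 1# _ _ e))
    where open import Algebra.Properties.Ring ring using (+-cancelˡ)

  ½ᴿ : ℝ
  ½ᴿ = fromℚ (ℤ.+ 1 ℚ./ 2)

  ½-inverse : (1# + 1#) * ½ᴿ ≈ 1#
  ½-inverse = pointwise ((1# + 1#) * ½ᴿ) 1# λ _ → ≡.refl

Pointwise⇒tabulate : ∀ {a b r} {A : Set a} {B : Set b} {R : A → B → Set r} {xs ys} → Pointwise R xs ys →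
  ∃ λ (f : Fin (length xs) → B) → List.tabulate f ≡ ys × ∀ i → R (List.lookup xs i) (f i)
Pointwise⇒tabulate []       = (λ ()) , ≡.refl , λ ()
Pointwise⇒tabulate (p ∷ ps) with Pointwise⇒tabulate ps
... | f , eq , h = (λ { zero → _ ; (suc i) → f i }) , ≡.cong (_ ∷_) eq , λ { zero → p ; (suc i) → h i }

module Exponents (ℓ : ℕ) where
  open Operators ℓ
  open CommutativeRing polynomialRing hiding (zero)
  open import Algebra.Properties.Semiring.Sum semiring using (sum)
  open GradedPolynomials Reals.ℝ-commutativeRing ℓ using (Independent; same-degrees; constant-1)
  open MatrixSums polynomialRing using (kronecker; sum-kronecker)

  linearCombination-at : ∀ bs (c : Fin (length bs) → Poly) α →
    linearCombination {2} bs c α ≡ sum (λ i → c i * List.lookup bs i α)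
  linearCombination-at bs c α = at (λ i β → c i * List.lookup bs i β)
    where
    at : ∀ {n} (v : Fin n → DiffOp 2) → RawMonoid.sum (Module.+ᴹ-rawMonoid (diffOpModule 2)) v α ≡ sum (λ i → v i α)
    at {zero}  v = ≡.refl
    at {suc n} v = ≡.cong (v zero α +_) (at (λ i → v (suc i)))

  module _ {P : DiffOp 2 → Set} where

    basis-independent : ∀ {bs} → IsBasis P bs → Independent (List.lookup bs)
    basis-independent {bs} basis c e = IsBasis.independent basis c λ α → trans
      (reflexive (linearCombination-at bs c α)) (e α)

    basis-spans : ∀ {bs} → IsBasis P bs → ∀ θ → P θ → ∃ λ c → ∀ α → θ α ≈ sum (λ i → c i * List.lookup bs i α)
    basis-spans {bs} basis θ Pθ = let c , e = IsBasis.spans basis θ Pθ in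
      c , λ α → trans (e α) (reflexive (linearCombination-at bs c α))

    basis-member : ∀ {bs} → IsBasis P bs → ∀ i → P (List.lookup bs i)
    basis-member basis i = All.lookup (IsBasis.members basis) (Membership.∈-lookup i)

    -- Homogeneity demands nonzero operators. A zero element of the basis would be a relation with
    -- coefficient 1, forcing 1 = 0 in ℝ.
    basis-nonzero : ∀ {bs} → IsBasis P bs → All (λ θ → ¬ (θ ≈ᴹ 0ᴹ)) bs
    basis-nonzero {bs} basis = All.tabulate λ {θ} θ∈ θ≈0 → let i = index θ∈ in
      RealNumbers.suc≉0 0 (R.trans (R.+-identityʳ R.1#) (R.trans (R.sym constant-1)
        (_≈ᴾ_.coeff-≈ {1#} {0#} (trans (reflexive (≡.sym (≡.cong (if_then 1# else 0#) (dec-true (i Fin.≟ i) ≡.refl))))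
          (basis-independent basis (kronecker i) (λ α → trans (sum-kronecker i (λ j → List.lookup bs j α))
            (trans (reflexive (≡.cong (λ θ → θ α) (≡.sym (Any.lookup-index θ∈)))) (θ≈0 α))) i)) 0ᵉ)))
      where module R = CommutativeRing Reals.ℝ-commutativeRing

    degrees-unique : (B B′ : HomogeneousBasis P) → HomogeneousBasis.degrees B ↭ HomogeneousBasis.degrees B′
    degrees-unique B B′ = occurrences⇒↭ _ _ λ k → ≡.trans (≡.cong (occurrences k) (≡.sym (proj₁ (proj₂ d))))
      (≡.trans (same-degrees RealNumbers.characteristic-0 {b = List.lookup B.elements}
        {c = List.lookup B′.elements} (proj₁ d) (proj₁ d′)
          (basis-independent B.isBasis) (basis-independent B′.isBasis)
          (λ i → proj₂ (proj₂ (proj₂ d) i)) (λ i → proj₂ (proj₂ (proj₂ d′) i))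
          (λ i → basis-spans B′.isBasis (List.lookup B.elements i) (basis-member B.isBasis i))
          (λ i → basis-spans B.isBasis (List.lookup B′.elements i) (basis-member B′.isBasis i)) k)
        (≡.cong (occurrences k) (proj₁ (proj₂ d′))))
      where
      module B = HomogeneousBasis B
      module B′ = HomogeneousBasis B′
      d = Pointwise⇒tabulate B.homogeneous
      d′ = Pointwise⇒tabulate B′.homogeneous

    isExp : ∀ {a} {A : Set a} (F : A → DiffOp 2) (degree : A → ℕ) zs → IsBasis P (List.map F zs) →
            (∀ z α → Homogeneous (degree z) (F z α)) → IsExp P (List.map degree zs)
    isExp F degree zs basis hom = B , λ B′ → degrees-unique B′ B
      where
      homogeneous-zs : ∀ zs → All (λ θ → ¬ (θ ≈ᴹ 0ᴹ)) (List.map F zs) → Pointwise IsHomogeneous (List.map F zs)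
        (List.map degree zs)
      homogeneous-zs []       []       = []
      homogeneous-zs (z ∷ zs) (n ∷ ns) = (n , hom z) ∷ homogeneous-zs zs ns
      B : HomogeneousBasis P
      B = record
        { elements = List.map F zs
        ; degrees = List.map degree zs
        ; isBasis = basis
        ; homogeneous = homogeneous-zs zs (basis-nonzero basis)
        }

-- From matrices to bases, for both types at once

units≡2 : ∀ {n} (k : Fin n) → Vec.zipWith ℕ._+_ (unit k) (unit k) ≡ Vec.replicate n 0 Vec.[ k ]≔ 2
units≡2 {suc n} zero    = ≡.cong (2 ∷_) (0ᵛ-+ (Vec.replicate n 0))
units≡2         (suc k) = ≡.cong (0 ∷_) (units≡2 k)

length-filter-suc : ∀ {n p q} {P : Fin (suc n) → Set p} {Q : Fin n → Set q} (P? : ∀ i → Dec (P i))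
  (Q? : ∀ i → Dec (Q i)) →
  (∀ i → does (P? (suc i)) ≡ does (Q? i)) → ∀ is → length (List.filter P? (List.map suc is)) ≡ length
    (List.filter Q? is)
length-filter-suc P? Q? e []       = ≡.refl
length-filter-suc P? Q? e (i ∷ is) with does (P? (suc i)) | does (Q? i) | e i
... | true  | true  | _ = ≡.cong suc (length-filter-suc P? Q? e is)
... | false | false | _ = length-filter-suc P? Q? e is

length-others : ∀ {n} (k : Fin n) → suc (length (otherIndices k)) ≡ n
length-others {suc n} zero = ≡.cong suc (≡.trans
  (≡.cong length (List.filter-all (λ (i : Fin (suc n)) → ¬? (i Fin.≟ zero)) (All.tabulate⁺ {f = successor} λ i ())))
  (List.length-tabulate successor))
  where
  successor : Fin n → Fin (suc n)
  successor = suc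
length-others {suc (suc n)} (suc k) = ≡.cong suc (≡.trans
  (≡.cong (λ is → suc (length (List.filter (λ i → ¬? (i Fin.≟ suc k)) is)))
    (≡.sym (List.map-tabulate {n = suc n} (λ i → i) suc)))
  (≡.trans (≡.cong suc (length-filter-suc (λ i → ¬? (i Fin.≟ suc k)) (λ i → ¬? (i Fin.≟ k)) (λ _ → ≡.refl)
    (List.allFin (suc n))))
    (length-others k)))

Index : ℕ → Set
Index ℓ = Fin ℓ ⊎ Vec ℕ 2

basisIndices : ∀ ℓ → List (Index ℓ)
basisIndices ℓ = List.map inj₁ (List.allFin ℓ) ++ List.map inj₂ (Λ ℓ)

_≟ⁱ_ : ∀ {ℓ} → DecidableEquality (Index ℓ)
_≟ⁱ_ = Sum.≡-dec Fin._≟_ (Vec.≡-dec ℕ._≟_)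

basisIndices-unique : ∀ ℓ → Unique (basisIndices ℓ)
basisIndices-unique ℓ = Unique.++⁺ (Unique.map⁺ Sum.inj₁-injective (Unique.allFin⁺ ℓ))
  (Unique.map⁺ Sum.inj₂-injective (Λ-unique ℓ)) λ (z∈ , z∈′) → apart (Membership.∈-map⁻ inj₁ z∈)
    (Membership.∈-map⁻ inj₂ z∈′)
  where
  apart : ∀ {z} → (∃ λ i → i ∈ List.allFin ℓ × z ≡ inj₁ i) → ¬ (∃ λ μ → μ ∈ Λ ℓ × z ≡ inj₂ μ)
  apart (_ , _ , ≡.refl) (_ , _ , ())

inj₂∈basisIndices : ∀ ℓ {μ} → inj₂ μ ∈ basisIndices ℓ → μ ∈ Λ ℓ
inj₂∈basisIndices ℓ μ∈ with Membership.∈-++⁻ (List.map inj₁ (List.allFin ℓ)) μ∈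
... | inj₁ μ∈′ with () ← proj₂ (proj₂ (Membership.∈-map⁻ inj₁ μ∈′))
... | inj₂ μ∈′ with Membership.∈-map⁻ inj₂ μ∈′
... | _ , μ∈Λ , ≡.refl = μ∈Λ

map-basisIndices : ∀ {a} {A : Set a} ℓ (f : Fin ℓ → A) (g : Vec ℕ 2 → A) →
  List.map [ f , g ]′ (basisIndices ℓ) ≡ List.map f (List.allFin ℓ) ++ List.map g (Λ ℓ)
map-basisIndices ℓ f g = ≡.trans (List.map-++ [ f , g ]′ (List.map inj₁ (List.allFin ℓ)) (List.map inj₂ (Λ ℓ)))
  (≡.cong₂ _++_ (≡.sym (List.map-∘ (List.allFin ℓ))) (≡.sym (List.map-∘ (Λ ℓ))))

map-const-allFin : ∀ {a} {A : Set a} ℓ (x : A) → List.map (λ _ → x) (List.allFin ℓ) ≡ List.replicate ℓ x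
map-const-allFin zero    x = ≡.refl
map-const-allFin (suc ℓ) x = ≡.cong (x ∷_) (≡.trans
  (≡.trans (List.map-tabulate suc (λ _ → x)) (≡.sym (List.map-tabulate (λ i → i) (λ _ → x)))) (map-const-allFin ℓ x))

module CoxeterBases (ℓ : ℕ) where
  open Operators ℓ
  open CommutativeRing polynomialRing hiding (zero)
  open import Relation.Binary.Reasoning.Setoid setoid
  open Divisibility polynomialRing
  open Interpolation polynomialRing using (Separated)
  private
    module ∑ = ListSums polynomialRing
    module Log = LogarithmicOperators Reals.ℝ-commutativeRing RealNumbers.½ᴿ RealNumbers.½-inverse ℓ
  open Log using (matrix; multiplicity; coprimeForms)
  open RowConditions polynomialRing X
  open IndexedBases (diffOpModule 2) using (combination; isBasis-map)

  combination-at : ∀ {a} {A : Set a} (F : A → DiffOp 2) xs k α → combination F xs k α ≡ ∑ xs (λ x → k x * F x α)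
  combination-at F []       k α = ≡.refl
  combination-at F (x ∷ xs) k α = ≡.cong (k x * F x α +_) (combination-at F xs k α)

  matrix-combination : ∀ {a} {A : Set a} (F : A → DiffOp 2) xs k a b →
    matrix (combination F xs k) a b ≈ ∑ xs (λ x → k x * matrix (F x) a b)
  matrix-combination F xs k a b = begin
    m * combination F xs k (pairIndex a b)  ≡⟨ ≡.cong (m *_) (combination-at F xs k (pairIndex a b)) ⟩
    m * ∑ xs (λ x → k x * F x (pairIndex a b))  ≈⟨ ∑.∑-*-swap xs m k (λ x → F x (pairIndex a b)) ⟩
    ∑ xs (λ x → k x * matrix (F x) a b)                     ∎
    where m = multiplicity a b

  nzd-multiplicity : ∀ a b → NonZeroDivisor (multiplicity a b)
  nzd-multiplicity a b with a Fin.≟ b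
  ... | yes _ = CoprimeForms.nzd-2 coprimeForms
  ... | no  _ = nzd-1

  -- Every multi-index of size two belongs to the pair of its positions, and the multiplicity is a
  -- non-zero-divisor.
  matrix-injective : ∀ θ φ → (∀ a b → matrix θ a b ≈ matrix φ a b) → θ ≈ᴹ φ
  matrix-injective θ φ e α = ≡.subst (λ α → θ α ≈ φ α) (exponents-injective (≡.sym (exponents-pair α)))
    (nzd-cancel {multiplicity i j} {θ (pairIndex i j)} {φ (pairIndex i j)} (nzd-multiplicity i j) (e i j))
    where
    i = first α
    j = second α

  module _ (w y E : Fin ℓ → Poly) (sep : Separated y) (nzd-w : ∀ a → NonZeroDivisor (w a)) (nzd-E : ∀ a → NonZeroDivisor (E a)) where
    open Weighted w y E sep

    module _ (Q : Poly) (F : Index ℓ → DiffOp 2)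
      (F-η : ∀ i a b → matrix (F (inj₁ i)) a b ≈ diagonal i (E i) a b)
      (F-θ : ∀ μ a b → matrix (F (inj₂ μ)) a b ≈ Θ μ a b)
      (members : ∀ z → D 2 Q (F z))
      (decomposition : ∀ θ → D 2 Q θ → ∃ λ e → ∃ λ k → ∀ a b → matrix θ a b ≈ diagonalPart e a b + symmetricPart k a b) where

      private
        zs = basisIndices ℓ

        matrix-F : ∀ k a b → matrix (combination F zs k) a b ≈ diagonalPart (λ i → k (inj₁ i)) a b +
          symmetricPart (λ μ → k (inj₂ μ)) a b
        matrix-F k a b = begin
          matrix (combination F zs k) a b
            ≈⟨ matrix-combination F zs k a b ⟩
          ∑ zs f
            ≈⟨ ∑.∑-++ (List.map inj₁ (List.allFin ℓ)) (List.map inj₂ (Λ ℓ)) f ⟩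
          ∑ (List.map inj₁ (List.allFin ℓ)) f + ∑ (List.map inj₂ (Λ ℓ)) f
            ≈⟨ +-cong (reflexive (∑.∑-map inj₁ (List.allFin ℓ) f)) (reflexive (∑.∑-map inj₂ (Λ ℓ) f)) ⟩
          ∑ (List.allFin ℓ) (λ i → f (inj₁ i)) + ∑ (Λ ℓ) (λ μ → f (inj₂ μ))
            ≈⟨ +-cong (∑.∑-cong (List.allFin ℓ) λ i → *-congˡ {k (inj₁ i)} (F-η i a b))
                      (∑.∑-cong (Λ ℓ) λ μ → *-congˡ {k (inj₂ μ)} (F-θ μ a b)) ⟩
          diagonalPart (λ i → k (inj₁ i)) a b + symmetricPart (λ μ → k (inj₂ μ)) a b ∎
          where
          f : Index ℓ → Poly
          f z = k z * matrix (F z) a b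

        spanning : ∀ θ → D 2 Q θ → ∃ λ k → θ ≈ᴹ combination F zs k
        spanning θ θ∈D = let e , k , eq = decomposition θ θ∈D in
          [ e , k ]′ , matrix-injective θ (combination F zs [ e , k ]′) λ a b → trans (eq a b)
            (sym (matrix-F [ e , k ]′ a b))

        independence : ∀ k → combination F zs k ≈ᴹ 0ᴹ → ∀ z → z ∈ zs → k z ≈ 0#
        independence k k≈0 = λ where
            (inj₁ i) _  → proj₁ zero-coefficients i
            (inj₂ μ) z∈ → proj₂ zero-coefficients μ (inj₂∈basisIndices ℓ z∈)
          where
          zero-coefficients : (∀ i → k (inj₁ i) ≈ 0#) × (∀ μ → μ ∈ Λ ℓ → k (inj₂ μ) ≈ 0#)
          zero-coefficients = independent nzd-w nzd-E (λ i → k (inj₁ i)) (λ μ → k (inj₂ μ)) λ a b →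
            trans (sym (matrix-F k a b)) (trans (*-congˡ {multiplicity a b} (k≈0 (pairIndex a b)))
              (zeroʳ (multiplicity a b)))

      isBasis : IsBasis (D 2 Q) (List.map F zs)
      isBasis = isBasis-map F _≟ⁱ_ {xs = zs} (basisIndices-unique ℓ) (All.map⁺ (All.universal members zs))
        spanning independence

1/ᶜ-cong : ∀ ℓ {m n} .{{p : ℕ.NonZero m}} .{{q : ℕ.NonZero n}} → m ≡ n → Operators.1/ᶜ ℓ m ≡ Operators.1/ᶜ ℓ n
1/ᶜ-cong ℓ ≡.refl = ≡.refl

map-pair : ∀ {a b} {A : Set a} {B : Set b} (f : A → B) (v : Vec A 2) → Vec.map f v ≡ f (Vec.lookup v zero) ∷ f
  (Vec.lookup v (suc zero)) ∷ []
map-pair f (x ∷ y ∷ []) = ≡.refl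

-- Matrices and degrees of the generators

module GeneratorMatrices (ℓ : ℕ) where
  open Operators ℓ
  open CommutativeRing polynomialRing hiding (zero)
  open import Algebra.Properties.Semiring.Exp semiring using (_^_)
  open import Relation.Binary.Reasoning.Setoid setoid
  open AntisymmetricQuotient polynomialRing using (h)
  open LogarithmicOperators Reals.ℝ-commutativeRing RealNumbers.½ᴿ RealNumbers.½-inverse ℓ using
    (matrix; multiplicity; multiplicity-≡; multiplicity-≢)
  open RowConditions polynomialRing X using (diagonal; Symmetric)
  open PolynomialProperties Reals.ℝ-commutativeRing ℓ using (C-cong; C-*; C-+; C-neg)
  private
    module ℝ = CommutativeRing Reals.ℝ-commutativeRing
    module P₂ = Polynomials Reals.ℝ-commutativeRing 2

  2*1/ᶜ2 : (1# + 1#) * 1/ᶜ 2 ≈ 1#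
  2*1/ᶜ2 = trans (*-congʳ {1/ᶜ 2} (sym (C-+ ℝ.1# ℝ.1#)))
    (trans (sym (C-* (ℝ.1# ℝ.+ ℝ.1#) RealNumbers.½ᴿ)) (C-cong RealNumbers.½-inverse))

  1/ᶜ1 : 1/ᶜ 1 ≈ 1#
  1/ᶜ1 = C-cong (Reals.pointwise (Reals.fromℚ (ℤ.+ 1 ℚ./ 1)) ℝ.1# λ _ → ≡.refl)

  -- The passage to `matrix` multiplies by α!, which cancels the normalisation 1/α! of θ_λ and
  -- leaves the bare values of the Schur polynomial.
  multiplicity-1/! : ∀ a b → multiplicity a b * 1/ᶜ (exponents (pairIndex a b) !ᵛ)
    {{ !ᵛ≢0 (exponents (pairIndex a b)) }} ≈ 1#
  multiplicity-1/! a b = at (a Fin.≟ b)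
    where
    instance _ = !ᵛ≢0 (exponents (pairIndex a b))
    at : Dec (a ≡ b) → multiplicity a b * 1/ᶜ (exponents (pairIndex a b) !ᵛ) ≈ 1#
    at (yes ≡.refl) = trans (*-cong (multiplicity-≡ a) (reflexive (1/ᶜ-cong ℓ (units-!-≡ a)))) 2*1/ᶜ2
    at (no a≢b) = trans (*-cong (multiplicity-≢ a≢b) (trans (reflexive (1/ᶜ-cong ℓ (units-!-≢ a≢b))) 1/ᶜ1))
      (*-identityˡ 1#)

  evaluateAt : Fin ℓ → Fin ℓ → P₂.Poly → Poly
  evaluateAt i j s = s at (X i ∷ X j ∷ [])

  module _ (i j : Fin ℓ) where
    open Evaluation Reals.ℝ-commutativeRing 2 polynomialRing C refl C-* C-neg (X i ∷ X j ∷ [])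
    open Homomorphism P₂.polynomialRing polynomialRing eval refl eval-1 eval-+ eval-* eval-neg

    evaluate-sᴬ : ∀ λ₁ λ₂ → evaluateAt i j (Schur.sᴬ (λ₁ ∷ λ₂ ∷ [])) ≈ h (X i) (X j) (λ₁ ℕ.+ 1) (λ₂ ℕ.+ 0)
    evaluate-sᴬ λ₁ λ₂ = trans (f-h (P₂.X zero) (P₂.X (suc zero)) (λ₁ ℕ.+ 1) (λ₂ ℕ.+ 0))
      (h-cong polynomialRing (λ₁ ℕ.+ 1) (λ₂ ℕ.+ 0) (eval-X zero) (eval-X (suc zero)))

    private module P₂^ where
      open import Algebra.Properties.Semiring.Exp (CommutativeRing.semiring P₂.polynomialRing) public using (_^_)
      open AntisymmetricQuotient P₂.polynomialRing public using (h)
    open P₂^ using () renaming (_^_ to _^₂_; h to h₂)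

    evaluate-sᴮ : ∀ λ₁ λ₂ → evaluateAt i j (Schur.sᴮ (λ₁ ∷ λ₂ ∷ [])) ≈ X i * X j * h (X i ^ 2) (X j ^ 2)
      (λ₁ ℕ.+ 1) (λ₂ ℕ.+ 0)
    evaluate-sᴮ λ₁ λ₂ = trans (eval-* (x₀ P₂.*ᴾ x₁) (h₂ (x₀ ^₂ 2) (x₁ ^₂ 2) p q))
      (*-cong (trans (eval-* x₀ x₁) (*-cong (eval-X zero) (eval-X (suc zero))))
        (trans (f-h (x₀ ^₂ 2) (x₁ ^₂ 2) p q) (h-cong polynomialRing p q (square zero) (square (suc zero)))))
      where
      x₀ = P₂.X zero
      x₁ = P₂.X (suc zero)
      p = λ₁ ℕ.+ 1
      q = λ₂ ℕ.+ 0
      square : ∀ k → eval (P₂.X k ^₂ 2) ≈ Vec.lookup (X i ∷ X j ∷ []) k ^ 2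
      square k = trans (f-^ (P₂.X k) 2) (^-cong polynomialRing 2 (eval-X k))

  θ-at : ∀ s α → θ[ s ] α ≡ evaluateAt (first α) (second α) s * 1/ᶜ (exponents α !ᵛ) {{ !ᵛ≢0 (exponents α) }}
  θ-at s (mkMultiIndex α e) = ≡.cong (λ v → (s at v) * 1/ᶜ (α !ᵛ) {{ !ᵛ≢0 α }}) (map-pair X (Vec.cast e (repeated α)))

  module _ (s : P₂.Poly) (T : Fin ℓ → Fin ℓ → Poly) (T-sym : Symmetric T) (value : ∀ i j → evaluateAt i j s ≈ T i j) where

    matrix-θ : ∀ a b → matrix θ[ s ] a b ≈ T a b
    matrix-θ a b = begin
      m * θ[ s ] α  ≡⟨ ≡.cong (m *_) (θ-at s α) ⟩
      m * (v * c)  ≈⟨ *-congˡ {m} (*-comm v c) ⟩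
      m * (c * v)  ≈⟨ *-assoc m c v ⟨
      (m * c) * v  ≈⟨ *-cong (multiplicity-1/! a b) (value (first α) (second α)) ⟩
      1# * T (first α) (second α) ≈⟨ *-identityˡ (T (first α) (second α)) ⟩
      -- `repeated` lists the positions in increasing order, so a and b may come back exchanged.
      T (first α) (second α)     ≈⟨ swap (units-injective {i = a} {b} {first α} {second α} (exponents-pair α)) ⟩
      T a b                      ∎
      where
      α = pairIndex a b
      m = multiplicity a b
      v = evaluateAt (first α) (second α) s
      c = 1/ᶜ (exponents α !ᵛ) {{ !ᵛ≢0 (exponents α) }}
      swap : ∀ {i j} → (a ≡ i × b ≡ j) ⊎ (a ≡ j × b ≡ i) → T i j ≈ T a b
      swap (inj₁ (≡.refl , ≡.refl)) = refl
      swap (inj₂ (≡.refl , ≡.refl)) = T-sym b a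

    open GradedPolynomials Reals.ℝ-commutativeRing ℓ

    homogeneous-θ : ∀ {d} → (∀ i j → Homogeneous d (T i j)) → ∀ α → Homogeneous d (θ[ s ] α)
    homogeneous-θ {d} hom α = ≡.subst₂ Homogeneous (ℕ.+-identityʳ d) (≡.sym (θ-at s α))
      (homogeneous-* {d} {0} {evaluateAt (first α) (second α) s} {c}
        (homogeneous-resp {d} {T (first α) (second α)} {evaluateAt (first α) (second α) s}
          (sym (value (first α) (second α))) (hom (first α) (second α)))
        (homogeneous-C _))
      where c = 1/ᶜ (exponents α !ᵛ) {{ !ᵛ≢0 (exponents α) }}

  module _ (f : Poly) (k : Fin ℓ) where

    matrix-η : ∀ a b → matrix η[ f , k ] a b ≈ diagonal k f a b
    matrix-η a b = at (a Fin.≟ k ×-dec b Fin.≟ k)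
      where
      g : Bool → Poly
      g t = if t then f * 1/ᶜ 2 else 0#
      k? : Dec (exponents (pairIndex a b) ≡ 0ᵉ Vec.[ k ]≔ 2)
      k? = exponents (pairIndex a b) ≟ᵉ 0ᵉ Vec.[ k ]≔ 2
      at : (d : Dec (a ≡ k × b ≡ k)) → multiplicity a b * g (does k?) ≈ (if does d then f else 0#)
      at (yes (≡.refl , ≡.refl)) = begin
        multiplicity k k * g (does k?)      ≡⟨ ≡.cong (λ t → multiplicity k k * g t) (dec-true k? (units≡2 k)) ⟩
        multiplicity k k * (f * 1/ᶜ 2)      ≈⟨ *-cong (multiplicity-≡ k) (*-comm f (1/ᶜ 2)) ⟩
        (1# + 1#) * (1/ᶜ 2 * f)  ≈⟨ *-assoc (1# + 1#) (1/ᶜ 2) f ⟨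
        (1# + 1#) * 1/ᶜ 2 * f  ≈⟨ *-congʳ {f} 2*1/ᶜ2 ⟩
        1# * f  ≈⟨ *-identityˡ f ⟩
        f                                   ∎
      at (no ne) = trans (reflexive (≡.cong (λ t → multiplicity a b * g t) (dec-false k? λ e →
          ne (both (units-injective {i = a} {b} {k} {k} (≡.trans e (≡.sym (units≡2 k))))))))
            (zeroʳ (multiplicity a b))
        where
        both : (a ≡ k × b ≡ k) ⊎ (a ≡ k × b ≡ k) → a ≡ k × b ≡ k
        both = [ (λ p → p) , (λ p → p) ]′

    open GradedPolynomials Reals.ℝ-commutativeRing ℓ

    homogeneous-η : ∀ {d} → Homogeneous d f → ∀ (α : MultiIndex ℓ 2) → Homogeneous d (η[ f , k ] α)
    homogeneous-η {d} hom α = at (exponents α ≟ᵉ 0ᵉ Vec.[ k ]≔ 2)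
      where
      at : ∀ {P : Set} (P? : Dec P) → Homogeneous d (if does P? then f * 1/ᶜ 2 else 0#)
      at (no _)  = homogeneous-0 {d}
      at (yes _) = ≡.subst (λ d → Homogeneous d (f * 1/ᶜ 2)) (ℕ.+-identityʳ d)
        (homogeneous-* {d} {0} {f} {1/ᶜ 2} hom (homogeneous-C _))

open import Data.List.Base using (_++_; map; replicate)
open import Data.Nat.Base using (ℕ; _≤_; _∸_; _+_; _*_)
open import Data.Product using (_×_)
open import Data.Vec.Base using (sum)
open Operators using (IsBasis; IsExp; D; Qᴬ; Qᴮ; Cᴬ; Cᴮ)

-- The two Coxeter arrangements

module BasesAndExponents (ℓ : ℕ) where
  open Operators ℓ hiding (IsBasis; IsExp; D; Qᴬ; Qᴮ; Cᴬ; Cᴮ)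
  open Operators ℓ using () renaming (IsBasis to Basis; IsExp to Exp)
  open CommutativeRing polynomialRing hiding (zero) renaming (_+_ to _⊕_; _*_ to _⊛_)
  open LogarithmicOperators Reals.ℝ-commutativeRing RealNumbers.½ᴿ RealNumbers.½-inverse ℓ
    using (matrix; matrix-sym; coprimeForms; preserves-A⁺; preserves-A⁻; preserves-B⁺; preserves-B⁻)
  open RowConditions polynomialRing X
  open GradedPolynomials Reals.ℝ-commutativeRing ℓ
  open HomogeneousQuotients Reals.ℝ-commutativeRing ℓ
  open import Algebra.Properties.Semiring.Exp semiring using (_^_)
  open SchurInterpolation polynomialRing using (schur)
  open CoxeterBases ℓ using (isBasis)
  open GeneratorMatrices ℓ
  open Exponents ℓ using (isExp)
  private
    module A = TypeA coprimeForms
    module B = TypeB coprimeForms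

  homogeneous-∏ : ∀ {a} {I : Set a} e (f : I → Poly) → (∀ i → Homogeneous e (f i)) → ∀ is → Homogeneous
    (length is * e) (∏ is f)
  homogeneous-∏ e f hom []       = homogeneous-C (CommutativeRing.1# Reals.ℝ-commutativeRing)
  homogeneous-∏ e f hom (i ∷ is) = homogeneous-* {e} {length is * e} {f i} {∏ is f} (hom i) (homogeneous-∏ e f hom is)

  homogeneous-difference : ∀ {d f g} → Homogeneous d f → Homogeneous d g → Homogeneous d (f - g)
  homogeneous-difference {d} {f} {g} hom hom′ = homogeneous-+ {d} {f} { - g} hom (homogeneous-neg {d} {g} hom′)

  homogeneous-schur : ∀ e {s t} → Homogeneous e s → Homogeneous e t → ∀ μ → Homogeneous (sum μ * e) (schur s t μ)
  homogeneous-schur e {s} {t} hom hom′ (λ₁ ∷ λ₂ ∷ []) = homogeneous-h {e} {s} {t} hom hom′ (λ₁ + 1) (λ₂ + 0)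
    -- The exponents add up to |λ| + 1 and division by s - t takes one off; written in this way, |λ|
    -- is `sum μ` definitionally.
    (λ₁ + (λ₂ + 0))
    (≡.trans (≡.cong (_+ (λ₂ + 0)) (ℕ.+-comm λ₁ 1)) ≡.refl)

  homogeneous-X² : ∀ i → Homogeneous 2 (X i ^ 2)
  homogeneous-X² i = homogeneous-^ {1} {X i} {X i} (homogeneous-X i) (homogeneous-X i) 2

  valueᴬ : ∀ μ i j → evaluateAt i j (Schur.sᴬ μ) ≈ A.Θ μ i j
  valueᴬ (λ₁ ∷ λ₂ ∷ []) i j = trans (evaluate-sᴬ i j λ₁ λ₂)
    (sym (trans (*-congʳ {s} (*-identityˡ 1#)) (*-identityˡ s)))
    where s = schur (X i) (X j) (λ₁ ∷ λ₂ ∷ [])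

  valueᴮ : ∀ μ i j → evaluateAt i j (Schur.sᴮ μ) ≈ B.Θ μ i j
  valueᴮ (λ₁ ∷ λ₂ ∷ []) i j = evaluate-sᴮ i j λ₁ λ₂

  generatorᴬ generatorᴮ : Index ℓ → DiffOp 2
  generatorᴬ = [ ηᴬ , θᴬ ]′
  generatorᴮ = [ ηᴮ , θᴮ ]′

  matrix-ηᴬ : ∀ i a b → matrix (ηᴬ i) a b ≈ diagonal i (A.E i) a b
  matrix-ηᴬ i = matrix-η (A.E i) i

  matrix-ηᴮ : ∀ i a b → matrix (ηᴮ i) a b ≈ diagonal i (B.E i) a b
  matrix-ηᴮ i = matrix-η (B.E i) i

  matrix-θᴬ : ∀ μ a b → matrix (θᴬ μ) a b ≈ A.Θ μ a b
  matrix-θᴬ μ = matrix-θ (Schur.sᴬ μ) (A.Θ μ) (A.Θ-sym μ) (valueᴬ μ)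

  matrix-θᴮ : ∀ μ a b → matrix (θᴮ μ) a b ≈ B.Θ μ a b
  matrix-θᴮ μ = matrix-θ (Schur.sᴮ μ) (B.Θ μ) (B.Θ-sym μ) (valueᴮ μ)

  membersᴬ : ∀ z → D ℓ 2 (Qᴬ ℓ) (generatorᴬ z)
  membersᴬ (inj₁ i) = preserves-A⁺ (ηᴬ i) (rowsA-resp {diagonal i (A.E i)} {matrix (ηᴬ i)}
    (λ a b → sym (matrix-ηᴬ i a b)) (A.rows-diagonal i))
  membersᴬ (inj₂ μ) = preserves-A⁺ (θᴬ μ) (rowsA-resp {A.Θ μ} {matrix (θᴬ μ)} (λ a b → sym (matrix-θᴬ μ a b))
    (A.rows-Θ μ))

  membersᴮ : ∀ z → D ℓ 2 (Qᴮ ℓ) (generatorᴮ z)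
  membersᴮ (inj₁ i) = preserves-B⁺ (ηᴮ i) (rowsB-resp {diagonal i (B.E i)} {matrix (ηᴮ i)}
    (λ a b → sym (matrix-ηᴮ i a b)) (B.rows-diagonal i))
  membersᴮ (inj₂ μ) = preserves-B⁺ (θᴮ μ) (rowsB-resp {B.Θ μ} {matrix (θᴮ μ)} (λ a b → sym (matrix-θᴮ μ a b))
    (B.rows-Θ μ))

  basisᴬ : Basis (D ℓ 2 (Qᴬ ℓ)) (map generatorᴬ (basisIndices ℓ))
  basisᴬ = isBasis (λ _ → 1#) X A.E (CoprimeForms.nzd-linear coprimeForms true)
    (λ _ → Divisibility.nzd-1 polynomialRing) A.nzd-E
    (Qᴬ ℓ) generatorᴬ matrix-ηᴬ matrix-θᴬ membersᴬ
    λ θ θ∈D → A.spans (matrix θ) (matrix-sym θ) (preserves-A⁻ θ θ∈D)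

  basisᴮ : Basis (D ℓ 2 (Qᴮ ℓ)) (map generatorᴮ (basisIndices ℓ))
  basisᴮ = isBasis X B.y B.E B.separated (CoprimeForms.nzd-X coprimeForms) B.nzd-E
    (Qᴮ ℓ) generatorᴮ matrix-ηᴮ matrix-θᴮ membersᴮ
    λ θ θ∈D → B.spans (matrix θ) (matrix-sym θ) (preserves-B⁻ θ θ∈D)

  degreeᴬ degreeᴮ : Index ℓ → ℕ
  degreeᴬ = [ (λ _ → ℓ ∸ 1) , sum ]′
  degreeᴮ = [ (λ _ → 2 * ℓ ∸ 1) , (λ μ → 2 * sum μ + 2) ]′

  homogeneousᴬ : ∀ z α → Homogeneous (degreeᴬ z) (generatorᴬ z α)
  homogeneousᴬ (inj₁ i) = homogeneous-η (A.E i) i (≡.subst (λ d → Homogeneous d (A.E i))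
    (≡.trans (ℕ.*-identityʳ _) (≡.cong (_∸ 1) (length-others i)))
    (homogeneous-∏ 1 (λ j → X i - X j) (λ j → homogeneous-difference {1} {X i} {X j} (homogeneous-X i)
      (homogeneous-X j)) (others i)))
  homogeneousᴬ (inj₂ μ) = homogeneous-θ (Schur.sᴬ μ) (A.Θ μ) (A.Θ-sym μ) (valueᴬ μ) λ i j →
    homogeneous-resp {sum μ} {schur (X i) (X j) μ} {A.Θ μ i j}
      (sym (trans (*-congʳ {schur (X i) (X j) μ} (*-identityˡ 1#)) (*-identityˡ (schur (X i) (X j) μ))))
      (≡.subst (λ d → Homogeneous d (schur (X i) (X j) μ)) (ℕ.*-identityʳ (sum μ))
        (homogeneous-schur 1 {X i} {X j} (homogeneous-X i) (homogeneous-X j) μ))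

  homogeneousᴮ : ∀ z α → Homogeneous (degreeᴮ z) (generatorᴮ z α)
  homogeneousᴮ (inj₁ i) = homogeneous-η (B.E i) i (≡.subst (λ d → Homogeneous d (B.E i)) degree
    (homogeneous-* {1} {length (others i) * 2} {X i} {∏ (others i) λ j → X i ^ 2 - X j ^ 2} (homogeneous-X i)
      (homogeneous-∏ 2 (λ j → X i ^ 2 - X j ^ 2) (λ j → homogeneous-difference {2} {X i ^ 2} {X j ^ 2}
        (homogeneous-X² i) (homogeneous-X² j)) (others i))))
    where
    degree : 1 + length (others i) * 2 ≡ 2 * ℓ ∸ 1
    degree = ≡.trans (≡.cong (_∸ 1) (ℕ.*-comm (suc (length (others i))) 2))
      (≡.cong (λ n → 2 * n ∸ 1) (length-others i))
  homogeneousᴮ (inj₂ μ) = homogeneous-θ (Schur.sᴮ μ) (B.Θ μ) (B.Θ-sym μ) (valueᴮ μ) λ i j →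
    ≡.subst (λ d → Homogeneous d (B.Θ μ i j)) (≡.trans (ℕ.+-comm 2 (sum μ * 2)) (≡.cong (_+ 2) (ℕ.*-comm (sum μ) 2)))
      (homogeneous-* {2} {sum μ * 2} {X i ⊛ X j} {schur (X i ^ 2) (X j ^ 2) μ}
        (homogeneous-* {1} {1} {X i} {X j} (homogeneous-X i) (homogeneous-X j))
        (homogeneous-schur 2 {X i ^ 2} {X j ^ 2} (homogeneous-X² i) (homogeneous-X² j) μ))

  basis-and-exponents : ∀ Q (η : Fin ℓ → DiffOp 2) (θ : Vec ℕ 2 → DiffOp 2) d e → Basis (D ℓ 2 Q)
    (map [ η , θ ]′ (basisIndices ℓ)) →
    (∀ z α → Homogeneous ([ (λ _ → d) , e ]′ z) ([ η , θ ]′ z α)) →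
    Basis (D ℓ 2 Q) (map η (List.allFin ℓ) ++ map θ (Λ ℓ)) × Exp (D ℓ 2 Q) (replicate ℓ d ++ map e (Λ ℓ))
  basis-and-exponents Q η θ d e basis hom =
    ≡.subst (Basis (D ℓ 2 Q)) (map-basisIndices ℓ η θ) basis ,
    ≡.subst (Exp (D ℓ 2 Q)) (≡.trans (map-basisIndices ℓ (λ _ → d) e)
      (≡.cong (_++ map e (Λ ℓ)) (map-const-allFin ℓ d)))
      (isExp [ η , θ ]′ [ (λ _ → d) , e ]′ (basisIndices ℓ) basis hom)

  theoremᴬ : Basis (D ℓ 2 (Qᴬ ℓ)) (Cᴬ ℓ) × Exp (D ℓ 2 (Qᴬ ℓ)) (replicate ℓ (ℓ ∸ 1) ++ map sum (Λ ℓ))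
  theoremᴬ = basis-and-exponents (Qᴬ ℓ) ηᴬ θᴬ (ℓ ∸ 1) sum basisᴬ homogeneousᴬ

  theoremᴮ : Basis (D ℓ 2 (Qᴮ ℓ)) (Cᴮ ℓ) × Exp (D ℓ 2 (Qᴮ ℓ))
    (replicate ℓ (2 * ℓ ∸ 1) ++ map (λ μ → 2 * sum μ + 2) (Λ ℓ))
  theoremᴮ = basis-and-exponents (Qᴮ ℓ) ηᴮ θᴮ (2 * ℓ ∸ 1) (λ μ → 2 * sum μ + 2) basisᴮ homogeneousᴮ

theorem4p4 : (ℓ : ℕ) → 2 ≤ ℓ →
    ( IsBasis ℓ (D ℓ 2 (Qᴬ ℓ)) (Cᴬ ℓ)
    × IsExp ℓ (D ℓ 2 (Qᴬ ℓ)) (replicate ℓ (ℓ ∸ 1) ++ map sum (Λ ℓ)) )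
    × ( IsBasis ℓ (D ℓ 2 (Qᴮ ℓ)) (Cᴮ ℓ)
    × IsExp ℓ (D ℓ 2 (Qᴮ ℓ)) (replicate ℓ (2 * ℓ ∸ 1) ++ map (λ μ → 2 * sum μ + 2) (Λ ℓ)) )
theorem4p4 ℓ _ = BasesAndExponents.theoremᴬ ℓ , BasesAndExponents.theoremᴮ ℓ
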